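{- Let $(a_n)_{n\ge0}$ be the sequence, listed in increasing order, of the non-negative integers $m$ such that $840m+121$ is a perfect square. Then $$\sum_{n=0}^\infty(-1)^{\lfloor (n+4)/8\rfloor}q^{a_n}=\frac{(q^2,q^5,q^7;q^7)_\infty}{(q,q^4;q^5)_\infty}.$$
   Context: Here $q$ is a complex number with $|q|<1$ (equivalently, the identity may be read as an identity of formal power series in $q$). For a complex number $a$, $(a;q)_\infty:=\prod_{i=0}^\infty(1-aq^i)$, and $(a_1,a_2,\dots,a_m;q)_\infty:=\prod_{j=1}^m(a_j;q)_\infty$. $\lfloor x\rfloor$ is the floor function. -}

module Defs where

open import Data.Nat as ℕ using (ℕ; zero; suc; _+_; _*_; _∸_; _≟_)
open import Data.Nat.DivMod using (_/_)
open import Data.Nat.Divisibility using (_∣?_)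
open import Data.Integer as ℤ using (ℤ; 0ℤ; 1ℤ; -1ℤ)
open import Data.Bool using (if_then_else_)
open import Relation.Nullary using (does)

-- Formal power series in q with integer coefficients: n ↦ coefficient of q^n.
FPS : Set
FPS = ℕ → ℤ

sumℤ : ℕ → (ℕ → ℤ) → ℤ
sumℤ zero    f = 0ℤ
sumℤ (suc n) f = sumℤ n f ℤ.+ f n

infixl 7 _⊛_
_⊛_ : FPS → FPS → FPS
(f ⊛ g) n = sumℤ (suc n) (λ k → f k ℤ.* g (n ∸ k))

one : FPS
one zero    = 1ℤ
one (suc _) = 0ℤ

qpow : ℕ → FPS
qpow e n = if does (n ≟ e) then 1ℤ else 0ℤ

prodFin : ℕ → (ℕ → FPS) → FPS
prodFin zero    F = one
prodFin (suc n) F = prodFin n F ⊛ F n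

-- Infinite product ∏_{i≥0} F i, for factors with F i ≡ 1 (mod q^(i+1)):
-- the coefficient of q^N is that of the partial product of the first N+1 factors.
prodInf : (ℕ → FPS) → FPS
prodInf F N = prodFin (suc N) F N

oneMinusQ : ℕ → FPS
oneMinusQ e n = one n ℤ.- qpow e n

-- 1/(1 - q^e) = Σ_j q^(e j)   (used with e ≥ 1)
geom : ℕ → FPS
geom e n = if does (e ∣? n) then 1ℤ else 0ℤ

-- (q^a; q^d)_∞ = ∏_{i≥0} (1 - q^(a + d i))   (used with a, d ≥ 1)
poch : ℕ → ℕ → FPS
poch a d = prodInf (λ i → oneMinusQ (a + d * i))

-- 1/(q^a; q^d)_∞ = ∏_{i≥0} 1/(1 - q^(a + d i))   (used with a, d ≥ 1)
invPoch : ℕ → ℕ → FPS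
invPoch a d = prodInf (λ i → geom (a + d * i))

sgn : ℕ → ℤ
sgn n = -1ℤ ℤ.^ ((n + 4) / 8)

-- Coefficient of q^N in Σ_{n≥0} sgn(n) q^(a n), for a strictly increasing a
-- (so a n ≥ n and only n ≤ N can contribute).
lhs : (ℕ → ℕ) → FPS
lhs a N = sumℤ (suc N) (λ n → if does (a n ≟ N) then sgn n else 0ℤ)

rhs : FPS
rhs = poch 2 7 ⊛ poch 5 7 ⊛ poch 7 7 ⊛ invPoch 1 5 ⊛ invPoch 4 5

{-# OPTIONS --safe #-}
module Submission where

-- By the Jacobi triple product, (q²,q⁵,q⁷;q⁷)∞ = Σ (−1)ⁿ q^((7n²+3n)/2),
-- (q²,q³,q⁵;q⁵)∞ = Σ (−1)ᵐ q^((5m²+m)/2) and (q;q)∞ = Σ (−1)ᵏ q^((3k²+k)/2). Multiplying the claim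
-- by (q;q)∞ turns it into an equality of two double sums. Writing 840 N + 156 = v² + 35u², both
-- become signed counts of lattice points on this ellipse:
--   * in the product of the first two series, the pairs with n + m even correspond to the points
--     with v ≡ 11 (70), u ≡ −v (12), those with n + m odd to v ≡ 39 (70), u ≡ −v (12);
--   * the other side counts, with signs, the points with u = 6k + 1 and v² = 840 aₙ + 121, the sign of
--     v being chosen so that v ≡ 4 (7). Since only u² matters, for fixed v this is, up to sign, the count over
--     u ≡ −v (12) minus the count over u ≡ 7v (12); for 3 ∣ v the two cancel.
-- The excess over u ≡ 7v (12) has the same size for v ≡ 11 and v ≡ 39 (70), because these two sets
-- are matched by multiplying v + u√−35 by the norm-one number (1 − √−35)/6, up to sign and conjugation.

open import Defs
open import Algebra.Bundles using (CommutativeRing)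
import Algebra.Solver.Ring as RingSolver
open import Algebra.Solver.Ring.AlmostCommutativeRing using (fromCommutativeRing; _-Raw-AlmostCommutative⟶_; Induced-equivalence)
open import Data.Bool using (if_then_else_)
open import Data.Fin using (Fin; toℕ; fromℕ<)
import Data.Fin.Properties as Finₚ
open import Data.Integer as ℤ using (ℤ; 0ℤ; 1ℤ; -1ℤ; +_; -[1+_]; ∣_∣; _⊖_)
open import Data.Integer.DivMod using (_/ℕ_; _%ℕ_; a≡a%ℕn+[a/ℕn]*n; n%ℕd<d)
open import Data.Integer.Divisibility.Signed using (_∣_; divides; _∣?_; ∣m∣n⇒∣m+n; ∣m+n∣m⇒∣n)
import Data.Integer.Properties as ℤₚ
open import Data.Integer.Tactic.RingSolver using (solve-∀)
open import Data.List using (List; []; _∷_; _++_; map; applyUpTo; upTo; cartesianProduct)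
open import Data.List.Membership.Propositional using (_∈_)
open import Data.List.Membership.Propositional.Properties using (∈-map⁺; ∈-applyUpTo⁺; ∈-upTo⁺; ∈-cartesianProduct⁺)
open import Data.List.Relation.Unary.All as All using (All)
open import Data.List.Relation.Unary.AllPairs using (_∷_)
open import Data.List.Relation.Unary.Any using (here; there)
open import Data.List.Relation.Unary.Unique.Propositional using (Unique)
import Data.List.Relation.Unary.Unique.Propositional.Properties as Uniqueₚ
open import Data.Maybe using (just; nothing)
open import Data.Nat as ℕ using (ℕ; zero; suc; _≤_; _<_; z≤n; s≤s; _∸_; _≟_)
import Data.Nat.Divisibility as ℕᵈ
open import Data.Nat.DivMod using (_/_; _%_; +-distrib-/-∣ˡ; m≡m%n+[m/n]*n; [m+kn]%n≡m%n; m%n<n)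
import Data.Nat.Properties as ℕₚ
open import Data.Nat.Tactic.RingSolver using () renaming (solve-∀ to ℕ-solve)
open import Data.Product using (_,_; _×_; ∃; proj₁; proj₂)
open import Data.Product.Properties using (≡-dec)
open import Data.Sum using (_⊎_; inj₁; inj₂)
open import Data.Unit using (tt)
open import Function.Bundles using (_⇔_; Equivalence)
open import Level using (0ℓ)
open import Relation.Binary.Definitions using (DecidableEquality; WeaklyDecidable; tri<; tri≈; tri>)
open import Relation.Binary.PropositionalEquality using (_≡_; _≢_; refl; sym; trans; cong; cong₂; subst; module ≡-Reasoning)
import Relation.Binary.Reasoning.Setoid as SetoidReasoning
open import Relation.Nullary using (Dec; yes; no; does; ¬_)
open import Relation.Nullary.Decidable using (dec-true; dec-false; toWitness; _→-dec_)
open import Relation.Nullary.Negation using (contradiction)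

-- Series are coefficient functions, so nothing infinite is ever summed: the identity is proved for
-- one coefficient q^N at a time, each double sum runs over a finite duplicate-free list, and two
-- such sums are compared through their supports. Division by (q;q)∞ is allowed because its constant
-- term is 1. The classes of v are forced. v² ≡ 121 (840) says that v is odd, prime to 3, ±1 mod 5
-- and ±4 mod 7; once v ≡ 4 (7) is chosen, 11 and 39 are the two possible residues mod 70. Then u is
-- odd too, and up to sign u ≡ -v (4). The multipliers -1 and 7 agree mod 4 and are opposite mod 3,
-- so they split these points by u ≡ -v or u ≡ v (3). The obstacle is that the product of the first
-- two series sees only the half u ≡ -v (12), while the pentagonal signs see the difference of both
-- halves. The rotation supplies the missing half: 1 + 35 = 36 makes (1 - √-35)/6 of norm one, and u
-- ≡ 7v (12) is what makes the rotated point integral.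

sumℤ-cong : ∀ n {f g : ℕ → ℤ} → (∀ k → k < n → f k ≡ g k) → sumℤ n f ≡ sumℤ n g
sumℤ-cong zero    _  = refl
sumℤ-cong (suc n) eq =
  cong₂ ℤ._+_ (sumℤ-cong n λ k k<n → eq k (ℕₚ.m<n⇒m<1+n k<n)) (eq n (ℕₚ.n<1+n n))

sumℤ-zero : ∀ n {f : ℕ → ℤ} → (∀ k → k < n → f k ≡ 0ℤ) → sumℤ n f ≡ 0ℤ
sumℤ-zero zero    _  = refl
sumℤ-zero (suc n) eq =
  cong₂ ℤ._+_ (sumℤ-zero n λ k k<n → eq k (ℕₚ.m<n⇒m<1+n k<n)) (eq n (ℕₚ.n<1+n n))

sumℤ-head : ∀ n f → sumℤ (suc n) f ≡ f 0 ℤ.+ sumℤ n (λ k → f (suc k))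
sumℤ-head zero    f = trans (ℤₚ.+-identityˡ (f 0)) (sym (ℤₚ.+-identityʳ (f 0)))
sumℤ-head (suc n) f = begin
  sumℤ (suc n) f ℤ.+ f (suc n)                        ≡⟨ cong (ℤ._+ f (suc n)) (sumℤ-head n f) ⟩
  f 0 ℤ.+ sumℤ n (λ k → f (suc k)) ℤ.+ f (suc n)      ≡⟨ ℤₚ.+-assoc (f 0) _ _ ⟩
  f 0 ℤ.+ sumℤ (suc n) (λ k → f (suc k))              ∎
  where open ≡-Reasoning

sumℤ-+ : ∀ n f g → sumℤ n (λ k → f k ℤ.+ g k) ≡ sumℤ n f ℤ.+ sumℤ n g
sumℤ-+ zero    f g = refl
sumℤ-+ (suc n) f g = trans (cong (ℤ._+ (f n ℤ.+ g n)) (sumℤ-+ n f g)) (interchange (sumℤ n f) (sumℤ n g) (f n) (g n))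
  where
  interchange : ∀ a b c d → a ℤ.+ b ℤ.+ (c ℤ.+ d) ≡ a ℤ.+ c ℤ.+ (b ℤ.+ d)
  interchange = solve-∀

sumℤ-*ˡ : ∀ n c f → sumℤ n (λ k → c ℤ.* f k) ≡ c ℤ.* sumℤ n f
sumℤ-*ˡ zero    c f = sym (ℤₚ.*-zeroʳ c)
sumℤ-*ˡ (suc n) c f = trans (cong (ℤ._+ c ℤ.* f n) (sumℤ-*ˡ n c f)) (sym (ℤₚ.*-distribˡ-+ c _ _))

-- The ring of formal power series

infix 4 _≐_ _≐[_]_
infixl 6 _⊕_
infix 8 ⊖_

_≐_ : FPS → FPS → Set
f ≐ g = ∀ n → f n ≡ g n

_≐[_]_ : FPS → ℕ → FPS → Set
f ≐[ N ] g = ∀ n → n ≤ N → f n ≡ g n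

_⊕_ : FPS → FPS → FPS
(f ⊕ g) n = f n ℤ.+ g n

⊖_ : FPS → FPS
(⊖ f) n = ℤ.- f n

nil : FPS
nil _ = 0ℤ

tail : FPS → FPS
tail f n = f (suc n)

⊛-suc : ∀ f g n → (f ⊛ g) (suc n) ≡ f 0 ℤ.* g (suc n) ℤ.+ (tail f ⊛ g) n
⊛-suc f g n = sumℤ-head (suc n) (λ k → f k ℤ.* g (suc n ∸ k))

⊛-sucʳ : ∀ f g n → (f ⊛ g) (suc n) ≡ (f ⊛ tail g) n ℤ.+ f (suc n) ℤ.* g 0
⊛-sucʳ f g n = cong₂ ℤ._+_
  (sumℤ-cong (suc n) λ k k<1+n → cong (λ i → f k ℤ.* g i) (ℕₚ.+-∸-assoc 1 (ℕₚ.≤-pred k<1+n)))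
  (cong (λ i → f (suc n) ℤ.* g i) (ℕₚ.n∸n≡0 n))

⊛-congₙ : ∀ {N f f′ g g′} → f ≐[ N ] f′ → g ≐[ N ] g′ → (f ⊛ g) ≐[ N ] (f′ ⊛ g′)
⊛-congₙ p q n n≤N = sumℤ-cong (suc n) λ k k<1+n → cong₂ ℤ._*_
  (p k (ℕₚ.≤-trans (ℕₚ.≤-pred k<1+n) n≤N))
  (q (n ∸ k) (ℕₚ.≤-trans (ℕₚ.m∸n≤m n k) n≤N))

⊛-cong : ∀ {f f′ g g′} → f ≐ f′ → g ≐ g′ → f ⊛ g ≐ f′ ⊛ g′
⊛-cong p q n = sumℤ-cong (suc n) λ k _ → cong₂ ℤ._*_ (p k) (q (n ∸ k))

⊛-congˡ : ∀ f {g g′} → g ≐ g′ → f ⊛ g ≐ f ⊛ g′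
⊛-congˡ f {g} {g′} p = ⊛-cong {f} {f} {g} {g′} (λ _ → refl) p

⊛-congʳ : ∀ g {f f′} → f ≐ f′ → f ⊛ g ≐ f′ ⊛ g
⊛-congʳ g {f} {f′} p = ⊛-cong {f} {f′} {g} {g} p (λ _ → refl)

⊛-comm : ∀ f g → f ⊛ g ≐ g ⊛ f
⊛-comm f g zero    = cong (λ z → 0ℤ ℤ.+ z) (ℤₚ.*-comm (f 0) (g 0))
⊛-comm f g (suc n) = begin
  (f ⊛ g) (suc n)                            ≡⟨ ⊛-suc f g n ⟩
  f 0 ℤ.* g (suc n) ℤ.+ (tail f ⊛ g) n       ≡⟨ cong₂ ℤ._+_ (ℤₚ.*-comm (f 0) _) (⊛-comm (tail f) g n) ⟩
  g (suc n) ℤ.* f 0 ℤ.+ (g ⊛ tail f) n       ≡⟨ ℤₚ.+-comm _ ((g ⊛ tail f) n) ⟩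
  (g ⊛ tail f) n ℤ.+ g (suc n) ℤ.* f 0       ≡⟨ ⊛-sucʳ g f n ⟨
  (g ⊛ f) (suc n)                            ∎
  where open ≡-Reasoning

⊛-distribʳ : ∀ h f g → (f ⊕ g) ⊛ h ≐ f ⊛ h ⊕ g ⊛ h
⊛-distribʳ h f g n = trans
  (sumℤ-cong (suc n) λ k _ → ℤₚ.*-distribʳ-+ (h (n ∸ k)) (f k) (g k))
  (sumℤ-+ (suc n) _ _)

⊛-scaleˡ : ∀ c f g → (λ n → c ℤ.* f n) ⊛ g ≐ (λ n → c ℤ.* (f ⊛ g) n)
⊛-scaleˡ c f g n = trans
  (sumℤ-cong (suc n) λ k _ → ℤₚ.*-assoc c (f k) (g (n ∸ k)))
  (sumℤ-*ˡ (suc n) c _)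

⊛-assoc : ∀ f g h → (f ⊛ g) ⊛ h ≐ f ⊛ (g ⊛ h)
⊛-assoc f g h zero    = eq (f 0) (g 0) (h 0)
  where
  eq : ∀ a b c → 0ℤ ℤ.+ (0ℤ ℤ.+ a ℤ.* b) ℤ.* c ≡ 0ℤ ℤ.+ a ℤ.* (0ℤ ℤ.+ b ℤ.* c)
  eq = solve-∀
⊛-assoc f g h (suc n) = begin
  ((f ⊛ g) ⊛ h) (suc n)
    ≡⟨ ⊛-suc (f ⊛ g) h n ⟩
  (f ⊛ g) 0 ℤ.* h (suc n) ℤ.+ (tail (f ⊛ g) ⊛ h) n
    ≡⟨ cong (λ z → (f ⊛ g) 0 ℤ.* h (suc n) ℤ.+ z) (⊛-congʳ h (⊛-suc f g) n) ⟩
  (f ⊛ g) 0 ℤ.* h (suc n) ℤ.+ (((λ m → f 0 ℤ.* tail g m) ⊕ tail f ⊛ g) ⊛ h) n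
    ≡⟨ cong (λ z → (f ⊛ g) 0 ℤ.* h (suc n) ℤ.+ z) (⊛-distribʳ h (λ m → f 0 ℤ.* tail g m) (tail f ⊛ g) n) ⟩
  (f ⊛ g) 0 ℤ.* h (suc n) ℤ.+ (((λ m → f 0 ℤ.* tail g m) ⊛ h) n ℤ.+ ((tail f ⊛ g) ⊛ h) n)
    ≡⟨ cong (λ z → (f ⊛ g) 0 ℤ.* h (suc n) ℤ.+ z)
         (cong₂ ℤ._+_ (⊛-scaleˡ (f 0) (tail g) h n) (⊛-assoc (tail f) g h n)) ⟩
  (f ⊛ g) 0 ℤ.* h (suc n) ℤ.+ (f 0 ℤ.* (tail g ⊛ h) n ℤ.+ (tail f ⊛ (g ⊛ h)) n)
    ≡⟨ eq (f 0) (g 0) (h (suc n)) _ _ ⟩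
  f 0 ℤ.* (g 0 ℤ.* h (suc n) ℤ.+ (tail g ⊛ h) n) ℤ.+ (tail f ⊛ (g ⊛ h)) n
    ≡⟨ cong (λ z → f 0 ℤ.* z ℤ.+ (tail f ⊛ (g ⊛ h)) n) (⊛-suc g h n) ⟨
  f 0 ℤ.* (g ⊛ h) (suc n) ℤ.+ (tail f ⊛ (g ⊛ h)) n
    ≡⟨ ⊛-suc f (g ⊛ h) n ⟨
  (f ⊛ (g ⊛ h)) (suc n) ∎
  where
  open ≡-Reasoning
  eq : ∀ a b c x y → (0ℤ ℤ.+ a ℤ.* b) ℤ.* c ℤ.+ (a ℤ.* x ℤ.+ y) ≡ a ℤ.* (b ℤ.* c ℤ.+ x) ℤ.+ y
  eq = solve-∀

nil-⊛ : ∀ f → nil ⊛ f ≐ nil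
nil-⊛ f n = sumℤ-zero (suc n) λ k _ → ℤₚ.*-zeroˡ (f (n ∸ k))

⊛-identityˡ : ∀ f → one ⊛ f ≐ f
⊛-identityˡ f zero    = trans (ℤₚ.+-identityˡ _) (ℤₚ.*-identityˡ (f 0))
⊛-identityˡ f (suc n) = begin
  (one ⊛ f) (suc n)                       ≡⟨ ⊛-suc one f n ⟩
  1ℤ ℤ.* f (suc n) ℤ.+ (nil ⊛ f) n        ≡⟨ cong₂ ℤ._+_ (ℤₚ.*-identityˡ (f (suc n))) (nil-⊛ f n) ⟩
  f (suc n) ℤ.+ 0ℤ                        ≡⟨ ℤₚ.+-identityʳ _ ⟩
  f (suc n)                               ∎
  where open ≡-Reasoning

FPS-commutativeRing : CommutativeRing 0ℓ 0ℓ
FPS-commutativeRing = record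
  { Carrier = FPS
  ; _≈_ = _≐_
  ; _+_ = _⊕_
  ; _*_ = _⊛_
  ; -_ = ⊖_
  ; 0# = nil
  ; 1# = one
  ; isCommutativeRing = record
    { isRing = record
      { +-isAbelianGroup = record
        { isGroup = record
          { isMonoid = record
            { isSemigroup = record
              { isMagma = record
                { isEquivalence = record
                  { refl = λ _ → refl
                  ; sym = λ p n → sym (p n)
                  ; trans = λ p q n → trans (p n) (q n)
                  }
                ; ∙-cong = λ p q n → cong₂ ℤ._+_ (p n) (q n)
                }
              ; assoc = λ f g h n → ℤₚ.+-assoc (f n) (g n) (h n)
              }
            ; identity = (λ f n → ℤₚ.+-identityˡ (f n)) , (λ f n → ℤₚ.+-identityʳ (f n))
            }
          ; inverse = (λ f n → ℤₚ.+-inverseˡ (f n)) , (λ f n → ℤₚ.+-inverseʳ (f n))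
          ; ⁻¹-cong = λ p n → cong ℤ.-_ (p n)
          }
        ; comm = λ f g n → ℤₚ.+-comm (f n) (g n)
        }
      ; *-cong = ⊛-cong
      ; *-assoc = ⊛-assoc
      ; *-identity = ⊛-identityˡ , λ f n → trans (⊛-comm f one n) (⊛-identityˡ f n)
      ; distrib = (λ h f g n → trans (⊛-comm h (f ⊕ g) n) (trans (⊛-distribʳ h f g n)
                    (cong₂ ℤ._+_ (⊛-comm f h n) (⊛-comm g h n))))
                , ⊛-distribʳ
      }
    ; *-comm = ⊛-comm
    }
  }

scalar : ℤ → FPS
scalar c n = c ℤ.* one n

-- Integers act as constant series, which gives the ring solver coefficients with decidable
-- equality; equality of series itself is not decidable.
scalar-morphism : ℤ.+-*-rawRing -Raw-AlmostCommutative⟶ fromCommutativeRing FPS-commutativeRing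
scalar-morphism = record
  { ⟦_⟧ = scalar
  ; +-homo = λ a b n → ℤₚ.*-distribʳ-+ (one n) a b
  ; *-homo = λ a b n → trans (ℤₚ.*-assoc a b (one n))
      (sym (trans (⊛-scaleˡ a one (scalar b) n) (cong (a ℤ.*_) (⊛-identityˡ (scalar b) n))))
  ; -‿homo = λ a n → sym (ℤₚ.neg-distribˡ-* a (one n))
  ; 0-homo = λ n → ℤₚ.*-zeroˡ (one n)
  ; 1-homo = λ n → ℤₚ.*-identityˡ (one n)
  }

scalar-≟ : WeaklyDecidable (Induced-equivalence scalar-morphism)
scalar-≟ a b with a ℤ.≟ b
... | yes refl = just λ _ → refl
... | no  _    = nothing

module FPS-Solver = RingSolver ℤ.+-*-rawRing (fromCommutativeRing FPS-commutativeRing) scalar-morphism scalar-≟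

open CommutativeRing FPS-commutativeRing using (setoid)
  renaming (refl to ≐-refl; sym to ≐-sym; trans to ≐-trans; +-cong to ⊕-cong; -‿cong to ⊖-cong; *-identityʳ to ⊛-identityʳ)
open FPS-Solver using (solve; _:=_; _:+_; _:*_; _:-_; :-_)

≐⇒≐ₙ : ∀ {N f g} → f ≐ g → f ≐[ N ] g
≐⇒≐ₙ p n _ = p n

≐ₙ-sym : ∀ {N f g} → f ≐[ N ] g → g ≐[ N ] f
≐ₙ-sym p n n≤N = sym (p n n≤N)

≐ₙ-trans : ∀ {N f g h} → f ≐[ N ] g → g ≐[ N ] h → f ≐[ N ] h
≐ₙ-trans p q n n≤N = trans (p n n≤N) (q n n≤N)

-- Since `f 0` is 1, the constant coefficient gives `g 0 ≡ 0ℤ`; then `f ⊛ g` is `f ⊛ tail g` moved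
-- up by one degree, and the induction continues with `tail g`.
⊛-zero-cancel : ∀ f g N → f 0 ≡ 1ℤ → (∀ n → n ≤ N → (f ⊛ g) n ≡ 0ℤ) → ∀ n → n ≤ N → g n ≡ 0ℤ
⊛-zero-cancel f g N f0 fg zero 0≤N = begin
  g 0                     ≡⟨ ℤₚ.*-identityˡ (g 0) ⟨
  1ℤ ℤ.* g 0              ≡⟨ cong (ℤ._* g 0) f0 ⟨
  f 0 ℤ.* g 0             ≡⟨ ℤₚ.+-identityˡ _ ⟨
  (f ⊛ g) 0               ≡⟨ fg 0 0≤N ⟩
  0ℤ                      ∎
  where open ≡-Reasoning
⊛-zero-cancel f g (suc N) f0 fg (suc n) (s≤s n≤N) = ⊛-zero-cancel f (tail g) N f0 ftg n n≤N
  where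
  open ≡-Reasoning
  g0 : g 0 ≡ 0ℤ
  g0 = ⊛-zero-cancel f g (suc N) f0 fg 0 z≤n
  ftg : ∀ m → m ≤ N → (f ⊛ tail g) m ≡ 0ℤ
  ftg m m≤N = begin
    (f ⊛ tail g) m                             ≡⟨ ℤₚ.+-identityʳ _ ⟨
    (f ⊛ tail g) m ℤ.+ 0ℤ                      ≡⟨ cong (λ z → (f ⊛ tail g) m ℤ.+ z) (ℤₚ.*-zeroʳ (f (suc m))) ⟨
    (f ⊛ tail g) m ℤ.+ f (suc m) ℤ.* 0ℤ        ≡⟨ cong (λ z → (f ⊛ tail g) m ℤ.+ f (suc m) ℤ.* z) g0 ⟨
    (f ⊛ tail g) m ℤ.+ f (suc m) ℤ.* g 0       ≡⟨ ⊛-sucʳ f g m ⟨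
    (f ⊛ g) (suc m)                            ≡⟨ fg (suc m) (s≤s m≤N) ⟩
    0ℤ                                         ∎

⊛-cancelˡₙ : ∀ f g h {N} → f 0 ≡ 1ℤ → (f ⊛ g) ≐[ N ] (f ⊛ h) → g ≐[ N ] h
⊛-cancelˡₙ f g h {N} f0 eq n n≤N =
  ℤₚ.i-j≡0⇒i≡j (g n) (h n) (⊛-zero-cancel f (g ⊕ ⊖ h) N f0 diff n n≤N)
  where
  expand : ∀ f g h → f ⊛ (g ⊕ ⊖ h) ≐ f ⊛ g ⊕ ⊖ (f ⊛ h)
  expand = solve 3 (λ f g h → f :* (g :- h) := f :* g :- f :* h) λ _ → refl
  diff : ∀ m → m ≤ N → (f ⊛ (g ⊕ ⊖ h)) m ≡ 0ℤ
  diff m m≤N = trans (expand f g h m) (ℤₚ.i≡j⇒i-j≡0 (eq m m≤N))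

⊛-cancelˡ : ∀ f g h → f 0 ≡ 1ℤ → f ⊛ g ≐ f ⊛ h → g ≐ h
⊛-cancelˡ f g h f0 eq n = ⊛-cancelˡₙ f g h {n} f0 (≐⇒≐ₙ eq) n ℕₚ.≤-refl

-- Monomials, infinite products and geometric series

qpow-zero : qpow 0 ≐ one
qpow-zero zero    = refl
qpow-zero (suc _) = refl

qpow-⊛-suc : ∀ e f n → (qpow (suc e) ⊛ f) (suc n) ≡ (qpow e ⊛ f) n
qpow-⊛-suc e f n = trans (⊛-suc (qpow (suc e)) f n)
  (trans (cong (ℤ._+ (qpow e ⊛ f) n) (ℤₚ.*-zeroˡ (f (suc n)))) (ℤₚ.+-identityˡ _))

qpow-⊛-zero : ∀ e f → (qpow (suc e) ⊛ f) 0 ≡ 0ℤ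
qpow-⊛-zero e f = trans (ℤₚ.+-identityˡ _) (ℤₚ.*-zeroˡ (f 0))

qpow-⊛-low : ∀ e f n → n < e → (qpow e ⊛ f) n ≡ 0ℤ
qpow-⊛-low (suc e) f zero    _         = qpow-⊛-zero e f
qpow-⊛-low (suc e) f (suc n) (s≤s n<e) = trans (qpow-⊛-suc e f n) (qpow-⊛-low e f n n<e)

qpow-+ : ∀ a b → qpow (a ℕ.+ b) ≐ qpow a ⊛ qpow b
qpow-+ zero    b n       = sym (trans (⊛-congʳ (qpow b) qpow-zero n) (⊛-identityˡ (qpow b) n))
qpow-+ (suc a) b zero    = sym (qpow-⊛-zero a (qpow b))
qpow-+ (suc a) b (suc n) = trans (qpow-+ a b n) (sym (qpow-⊛-suc a (qpow b) n))

qpow-eq : ∀ {e n} → n ≡ e → qpow e n ≡ 1ℤ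
qpow-eq {e} {n} p rewrite dec-true (n ≟ e) p = refl

qpow-neq : ∀ {e n} → n ≢ e → qpow e n ≡ 0ℤ
qpow-neq {e} {n} p rewrite dec-false (n ≟ e) p = refl

prodFin-⊛ : ∀ n F G → prodFin n (λ i → F i ⊛ G i) ≐ prodFin n F ⊛ prodFin n G
prodFin-⊛ zero    F G = ≐-sym (⊛-identityˡ one)
prodFin-⊛ (suc n) F G = ≐-trans (⊛-congʳ (F n ⊛ G n) (prodFin-⊛ n F G)) (interchange (prodFin n F) (prodFin n G) (F n) (G n))
  where
  interchange : ∀ a b c d → a ⊛ b ⊛ (c ⊛ d) ≐ a ⊛ c ⊛ (b ⊛ d)
  interchange = solve 4 (λ a b c d → a :* b :* (c :* d) := a :* c :* (b :* d)) λ _ → refl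

prodFin-cong : ∀ n {F G} → (∀ i → F i ≐ G i) → prodFin n F ≐ prodFin n G
prodFin-cong zero    p = ≐-refl
prodFin-cong (suc n) p = ⊛-cong (prodFin-cong n p) (p n)

-- F i = 1 + O(q^(i+1)), the hypothesis under which prodInf is the infinite product.
Convergent : (ℕ → FPS) → Set
Convergent F = ∀ i → F i ≐[ i ] one

prodFin-stable : ∀ {F} → Convergent F → ∀ N k → prodFin (N ℕ.+ k) F ≐[ N ] prodFin N F
prodFin-stable {F} conv N zero    rewrite ℕₚ.+-identityʳ N = λ _ _ → refl
prodFin-stable {F} conv N (suc k) rewrite ℕₚ.+-suc N k =
  ≐ₙ-trans (⊛-congₙ (prodFin-stable conv N k)
                    (λ n n≤N → conv (N ℕ.+ k) n (ℕₚ.≤-trans n≤N (ℕₚ.m≤m+n N k))))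
           (≐⇒≐ₙ (⊛-identityʳ _))

-- A factor `F i` with i ≥ n is 1 up to q^n, so the coefficient of q^n is already settled after n
-- factors, both in the long finite product and in `prodInf`.
prodFin-prodInf : ∀ {F} → Convergent F → ∀ {N M} → N ≤ M → prodFin M F ≐[ N ] prodInf F
prodFin-prodInf {F} conv {N} {M} N≤M n n≤N = trans (stab M (ℕₚ.≤-trans n≤N N≤M)) (sym (stab (suc n) (ℕₚ.n≤1+n n)))
  where
  stab : ∀ m → n ≤ m → prodFin m F n ≡ prodFin n F n
  stab m n≤m = trans (cong (λ k → prodFin k F n) (sym (ℕₚ.m+[n∸m]≡n n≤m)))
                     (prodFin-stable conv n (m ∸ n) n ℕₚ.≤-refl)

prodInf-⊛ : ∀ {F G} → Convergent F → Convergent G → prodInf (λ i → F i ⊛ G i) ≐ prodInf F ⊛ prodInf G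
prodInf-⊛ {F} {G} cF cG n = trans (prodFin-⊛ (suc n) F G n)
  (⊛-congₙ {n} (prodFin-prodInf cF (ℕₚ.n≤1+n n)) (prodFin-prodInf cG (ℕₚ.n≤1+n n)) n ℕₚ.≤-refl)

prodInf-one : ∀ {F} → (∀ i → F i ≐ one) → prodInf F ≐ one
prodInf-one {F} p N = go (suc N) N
  where
  go : ∀ n → prodFin n F ≐ one
  go zero    = ≐-refl
  go (suc n) = ≐-trans (⊛-cong (go n) (p n)) (⊛-identityˡ one)

oneMinusQ-low : ∀ {e N} → N < e → oneMinusQ e ≐[ N ] one
oneMinusQ-low {e} N<e n n≤N =
  trans (cong (λ z → one n ℤ.- z) (qpow-neq (ℕₚ.<⇒≢ (ℕₚ.≤-<-trans n≤N N<e)))) (ℤₚ.+-identityʳ (one n))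

-- a and d are the predecessors of the parameters of the product, so that all exponents are positive.
exponent-grows : ∀ a d i → i < suc a ℕ.+ suc d ℕ.* i
exponent-grows a d i = s≤s (ℕₚ.≤-trans (ℕₚ.m≤m+n i (d ℕ.* i)) (ℕₚ.m≤n+m _ a))

oneMinusQ-convergent : ∀ a d → Convergent (λ i → oneMinusQ (suc a ℕ.+ suc d ℕ.* i))
oneMinusQ-convergent a d i = oneMinusQ-low (exponent-grows a d i)

qpow-⊛-high : ∀ e f n → (qpow e ⊛ f) (e ℕ.+ n) ≡ f n
qpow-⊛-high zero    f n = trans (⊛-congʳ f qpow-zero n) (⊛-identityˡ f n)
qpow-⊛-high (suc e) f n = trans (qpow-⊛-suc e f (e ℕ.+ n)) (qpow-⊛-high e f n)

geom-low : ∀ {e N} → N < e → geom e ≐[ N ] one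
geom-low {e} N<e zero    _   rewrite dec-true (e ℕᵈ.∣? 0) (e ℕᵈ.∣0) = refl
geom-low {e} N<e (suc n) n≤N rewrite dec-false (e ℕᵈ.∣? suc n) (ℕᵈ.>⇒∤ (ℕₚ.≤-<-trans n≤N N<e)) = refl

geom-shift : ∀ e n → geom e (e ℕ.+ n) ≡ geom e n
geom-shift e n with e ℕᵈ.∣? n
... | yes e∣n rewrite dec-true (e ℕᵈ.∣? (e ℕ.+ n)) (ℕᵈ.∣m∣n⇒∣m+n ℕᵈ.∣-refl e∣n) = refl
... | no  e∤n rewrite dec-false (e ℕᵈ.∣? (e ℕ.+ n)) (λ e∣e+n → e∤n (ℕᵈ.∣m+n∣m⇒∣n e∣e+n ℕᵈ.∣-refl)) = refl

-- `geom` is periodic, so subtracting its shift by one period leaves only the first period, which is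
-- that of `one`.
geom-inverse : ∀ e → geom (suc e) ⊛ oneMinusQ (suc e) ≐ one
geom-inverse e n = trans (expand (geom (suc e)) one (qpow (suc e)) n)
  (trans (cong (ℤ._- (qpow (suc e) ⊛ geom (suc e)) n) (⊛-identityˡ (geom (suc e)) n)) telescope)
  where
  expand : ∀ g u x → g ⊛ (u ⊕ ⊖ x) ≐ u ⊛ g ⊕ ⊖ (x ⊛ g)
  expand = solve 3 (λ g u x → g :* (u :- x) := u :* g :- x :* g) λ _ → refl
  telescope : geom (suc e) n ℤ.- (qpow (suc e) ⊛ geom (suc e)) n ≡ one n
  telescope with n ℕ.<? suc e
  ... | yes n<e = trans
        (cong₂ ℤ._-_ (geom-low n<e n ℕₚ.≤-refl) (qpow-⊛-low (suc e) (geom (suc e)) n n<e))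
        (ℤₚ.+-identityʳ (one n))
  ... | no  n≮e with ℕₚ.m≤n⇒∃[o]m+o≡n (ℕₚ.≮⇒≥ n≮e)
  ...   | m , refl = ℤₚ.i≡j⇒i-j≡0
        (trans (geom-shift (suc e) m) (sym (qpow-⊛-high (suc e) (geom (suc e)) m)))

geom-convergent : ∀ a d → Convergent (λ i → geom (suc a ℕ.+ suc d ℕ.* i))
geom-convergent a d i = geom-low (exponent-grows a d i)

invPoch-inverse : ∀ a d → invPoch (suc a) (suc d) ⊛ poch (suc a) (suc d) ≐ one
invPoch-inverse a d = ≐-trans
  (≐-sym (prodInf-⊛ (geom-convergent a d) (oneMinusQ-convergent a d)))
  (prodInf-one λ i → geom-inverse (a ℕ.+ suc d ℕ.* i))

-- Gaussian binomial coefficients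

module QBinomial (d : ℕ) where

  Q^ : ℕ → FPS
  Q^ n = qpow (d ℕ.* n)

  Q^-+ : ∀ m n → Q^ (m ℕ.+ n) ≐ Q^ m ⊛ Q^ n
  Q^-+ m n k = trans (cong (λ e → qpow e k) (ℕₚ.*-distribˡ-+ d m n)) (qpow-+ (d ℕ.* m) (d ℕ.* n) k)

  -- qbinom m l is the Gaussian binomial coefficient [m+l choose m] in base q^d.
  qbinom : ℕ → ℕ → FPS
  qbinom zero    l       = one
  qbinom (suc m) zero    = one
  qbinom (suc m) (suc l) = qbinom m (suc l) ⊕ Q^ (suc m) ⊛ qbinom (suc m) l

  qbinom-zeroʳ : ∀ m → qbinom m 0 ≡ one
  qbinom-zeroʳ zero    = refl
  qbinom-zeroʳ (suc m) = refl

  qfac : ℕ → FPS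
  qfac n = prodFin n (λ i → oneMinusQ (d ℕ.+ d ℕ.* i))

  qfac-suc : ∀ n → qfac (suc n) ≐ qfac n ⊛ (one ⊕ ⊖ Q^ (suc n))
  qfac-suc n = ⊛-congˡ (qfac n) λ k → cong (λ e → one k ℤ.- qpow e k) (sym (ℕₚ.*-suc d n))

  -- Induction along the Pascal rule: with x = q^(d(m+1)) and y = q^(d(l+1)), its two summands yield
  -- the common product `f` times 1 - x and times x - xy, which add up to 1 - xy, the last factor of
  -- the larger q-factorial.
  qbinom-qfac : ∀ m l → qbinom m l ⊛ (qfac m ⊛ qfac l) ≐ qfac (m ℕ.+ l)
  qbinom-qfac zero    l = ≐-trans (⊛-identityˡ (one ⊛ qfac l)) (⊛-identityˡ (qfac l))
  qbinom-qfac (suc m) zero rewrite ℕₚ.+-identityʳ m =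
    ≐-trans (⊛-identityˡ (qfac (suc m) ⊛ one)) (⊛-identityʳ (qfac (suc m)))
  qbinom-qfac (suc m) (suc l) = begin
    (b₁ ⊕ x ⊛ b₂) ⊛ (qfac (suc m) ⊛ qfac (suc l))
      ≈⟨ distrib b₁ x b₂ (qfac (suc m)) (qfac (suc l)) ⟩
    b₁ ⊛ (qfac (suc m) ⊛ qfac (suc l)) ⊕ x ⊛ (b₂ ⊛ (qfac (suc m) ⊛ qfac (suc l)))
      ≈⟨ ⊕-cong (⊛-congˡ b₁ (⊛-congʳ (qfac (suc l)) (qfac-suc m)))
                (⊛-congˡ x (⊛-congˡ b₂ (⊛-congˡ (qfac (suc m)) (qfac-suc l)))) ⟩
    b₁ ⊛ (qfac m ⊛ (one ⊕ ⊖ x) ⊛ qfac (suc l)) ⊕ x ⊛ (b₂ ⊛ (qfac (suc m) ⊛ (qfac l ⊛ (one ⊕ ⊖ y))))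
      ≈⟨ regroup b₁ (qfac m) x (qfac (suc l)) b₂ (qfac (suc m)) (qfac l) y one ⟩
    b₁ ⊛ (qfac m ⊛ qfac (suc l)) ⊛ (one ⊕ ⊖ x) ⊕ b₂ ⊛ (qfac (suc m) ⊛ qfac l) ⊛ (x ⊛ one ⊕ ⊖ (x ⊛ y))
      ≈⟨ ⊕-cong (⊛-congʳ (one ⊕ ⊖ x) (qbinom-qfac m (suc l)))
                (⊛-cong (≐-trans (qbinom-qfac (suc m) l) (λ k → cong (λ i → qfac i k) (sym (ℕₚ.+-suc m l))))
                        (⊕-cong (⊛-identityʳ x) (⊖-cong (≐-sym (Q^-+ (suc m) (suc l)))))) ⟩
    f ⊛ (one ⊕ ⊖ x) ⊕ f ⊛ (x ⊕ ⊖ Q^ (suc m ℕ.+ suc l))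
      ≈⟨ cancel f one x (Q^ (suc m ℕ.+ suc l)) ⟩
    f ⊛ (one ⊕ ⊖ Q^ (suc m ℕ.+ suc l))
      ≈⟨ qfac-suc (m ℕ.+ suc l) ⟨
    qfac (suc m ℕ.+ suc l) ∎
    where
    open SetoidReasoning setoid
    b₁ b₂ x y f : FPS
    b₁ = qbinom m (suc l)
    b₂ = qbinom (suc m) l
    x = Q^ (suc m)
    y = Q^ (suc l)
    f = qfac (m ℕ.+ suc l)
    distrib : ∀ a x b s t → (a ⊕ x ⊛ b) ⊛ (s ⊛ t) ≐ a ⊛ (s ⊛ t) ⊕ x ⊛ (b ⊛ (s ⊛ t))
    distrib = solve 5 (λ a x b s t → (a :+ x :* b) :* (s :* t) := a :* (s :* t) :+ x :* (b :* (s :* t))) λ _ → refl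
    regroup : ∀ a s x t b u v y i →
      a ⊛ (s ⊛ (i ⊕ ⊖ x) ⊛ t) ⊕ x ⊛ (b ⊛ (u ⊛ (v ⊛ (i ⊕ ⊖ y)))) ≐
      a ⊛ (s ⊛ t) ⊛ (i ⊕ ⊖ x) ⊕ b ⊛ (u ⊛ v) ⊛ (x ⊛ i ⊕ ⊖ (x ⊛ y))
    regroup = solve 9 (λ a s x t b u v y i →
      a :* (s :* (i :- x) :* t) :+ x :* (b :* (u :* (v :* (i :- y)))) :=
      a :* (s :* t) :* (i :- x) :+ b :* (u :* v) :* (x :* i :- x :* y)) λ _ → refl
    cancel : ∀ f i x z → f ⊛ (i ⊕ ⊖ x) ⊕ f ⊛ (x ⊕ ⊖ z) ≐ f ⊛ (i ⊕ ⊖ z)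
    cancel = solve 4 (λ f i x z → f :* (i :- x) :+ f :* (x :- z) := f :* (i :- z)) λ _ → refl

prodFin-head : ∀ {F} → Convergent F → ∀ n → prodFin n F 0 ≡ 1ℤ
prodFin-head     conv zero    = refl
prodFin-head {F} conv (suc n) = trans (ℤₚ.+-identityˡ _) (cong₂ ℤ._*_ (prodFin-head conv n) (conv n 0 z≤n))

-- Sums over lists, antidiagonals and symmetric ranges

sumL : ∀ {A : Set} → List A → (A → ℤ) → ℤ
sumL []       f = 0ℤ
sumL (x ∷ xs) f = f x ℤ.+ sumL xs f

-- Sum of T k l over all k + l = N.
adiag : ℕ → (ℕ → ℕ → FPS) → FPS
adiag zero    T = T 0 0
adiag (suc N) T = T 0 (suc N) ⊕ adiag N (λ k l → T (suc k) l)

adiag-congₙ : ∀ M N {T U} → (∀ k l → k ℕ.+ l ≡ N → T k l ≐[ M ] U k l) → adiag N T ≐[ M ] adiag N U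
adiag-congₙ M zero    p n n≤M = p 0 0 refl n n≤M
adiag-congₙ M (suc N) p n n≤M = cong₂ ℤ._+_ (p 0 (suc N) refl n n≤M)
  (adiag-congₙ M N (λ k l k+l≡N → p (suc k) l (cong suc k+l≡N)) n n≤M)

⊛-adiag : ∀ x N T → x ⊛ adiag N T ≐ adiag N (λ k l → x ⊛ T k l)
⊛-adiag x zero    T = ≐-refl
⊛-adiag x (suc N) T = ≐-trans
  (distrib x (T 0 (suc N)) (adiag N (λ k l → T (suc k) l)))
  (λ n → cong (λ z → (x ⊛ T 0 (suc N)) n ℤ.+ z) (⊛-adiag x N (λ k l → T (suc k) l) n))
  where
  distrib : ∀ x y z → x ⊛ (y ⊕ z) ≐ x ⊛ y ⊕ x ⊛ z
  distrib = solve 3 (λ x y z → x :* (y :+ z) := x :* y :+ x :* z) λ _ → refl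

-- The common shape of both induction steps of the finite triple product: each entry splits into one
-- from each neighbour on the previous diagonal. The hypotheses are restricted to that diagonal
-- because one of the two steps needs k + l = N to compare exponents.
adiag-pascal : ∀ N T U V →
  (∀ l → T 0 (suc l) ≐ V 0 l) →
  (∀ k → k ≡ N → T (suc k) 0 ≐ U k 0) →
  (∀ k l → k ℕ.+ suc l ≡ N → T (suc k) (suc l) ≐ U k (suc l) ⊕ V (suc k) l) →
  adiag (suc N) T ≐ adiag N U ⊕ adiag N V
adiag-pascal N T U V h₀ h₁ h₂ n = trans
  (cong₂ ℤ._+_ (h₀ N n) refl)
  (trans (ℤₚ.+-comm (V 0 N n) _) (go N (λ k l → T (suc k) l) U V h₁ h₂ n))
  where
  shuffle : ∀ a b c d → a ℤ.+ b ℤ.+ c ℤ.+ d ≡ a ℤ.+ (c ℤ.+ b) ℤ.+ d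
  shuffle = solve-∀
  shuffle′ : ∀ a b c d → a ℤ.+ (b ℤ.+ c) ℤ.+ d ≡ a ℤ.+ b ℤ.+ (d ℤ.+ c)
  shuffle′ = solve-∀
  -- `T` has lost its first row here, so `V` runs one entry ahead of it; the entry `V 0 N` waits on
  -- the left until the next row supplies the rest of the diagonal of `V`.
  go : ∀ N T U V →
    (∀ k → k ≡ N → T k 0 ≐ U k 0) →
    (∀ k l → k ℕ.+ suc l ≡ N → T k (suc l) ≐ U k (suc l) ⊕ V (suc k) l) →
    adiag N T ⊕ V 0 N ≐ adiag N U ⊕ adiag N V
  go zero    T U V h₁ h₂ n = cong (ℤ._+ V 0 0 n) (h₁ 0 refl n)
  go (suc N) T U V h₁ h₂ n = begin
    T 0 (suc N) n ℤ.+ adiag N T′ n ℤ.+ V 0 (suc N) n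
      ≡⟨ cong (λ z → z ℤ.+ adiag N T′ n ℤ.+ V 0 (suc N) n) (h₂ 0 N refl n) ⟩
    U 0 (suc N) n ℤ.+ V 1 N n ℤ.+ adiag N T′ n ℤ.+ V 0 (suc N) n
      ≡⟨ shuffle (U 0 (suc N) n) (V 1 N n) (adiag N T′ n) (V 0 (suc N) n) ⟩
    U 0 (suc N) n ℤ.+ (adiag N T′ n ℤ.+ V 1 N n) ℤ.+ V 0 (suc N) n
      ≡⟨ cong (λ z → U 0 (suc N) n ℤ.+ z ℤ.+ V 0 (suc N) n)
           (go N T′ U′ V′ (λ k k≡N → h₁ (suc k) (cong suc k≡N)) (λ k l p → h₂ (suc k) l (cong suc p)) n) ⟩
    U 0 (suc N) n ℤ.+ (adiag N U′ n ℤ.+ adiag N V′ n) ℤ.+ V 0 (suc N) n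
      ≡⟨ shuffle′ (U 0 (suc N) n) (adiag N U′ n) (adiag N V′ n) (V 0 (suc N) n) ⟩
    adiag (suc N) U n ℤ.+ adiag (suc N) V n ∎
    where
    open ≡-Reasoning
    T′ U′ V′ : ℕ → ℕ → FPS
    T′ k l = T (suc k) l
    U′ k l = U (suc k) l
    V′ k l = V (suc k) l

adiag-list : ∀ {A : Set} N (p : ℕ → A) (f : A → FPS) n →
  adiag N (λ k _ → f (p k)) n ≡ sumL (applyUpTo p (suc N)) (λ x → f x n)
adiag-list zero    p f n = sym (ℤₚ.+-identityʳ (f (p 0) n))
adiag-list (suc N) p f n = cong (λ z → f (p 0) n ℤ.+ z) (adiag-list N (λ k → p (suc k)) f n)

-- The integers from -n to n, written as k ⊖ n so that this is literally the list of indices on the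
-- diagonal k + k′ = 2n.
range : ℕ → List ℤ
range n = applyUpTo (_⊖ n) (suc (n ℕ.+ n))

range-unique : ∀ n → Unique (range n)
range-unique n = Uniqueₚ.applyUpTo⁺₁ (_⊖ n) (suc (n ℕ.+ n))
  λ i<j _ → ℤₚ.<⇒≢ (ℤₚ.⊖-monoˡ-< n i<j)

∈-range : ∀ {n} j → ∣ j ∣ ≤ n → j ∈ range n
∈-range {n} (+ j) j≤n = subst (_∈ range n) eq (∈-applyUpTo⁺ (_⊖ n) (s≤s (ℕₚ.+-monoʳ-≤ n j≤n)))
  where
  eq : (n ℕ.+ j) ⊖ n ≡ + j
  eq = trans (ℤₚ.⊖-≥ (ℕₚ.m≤m+n n j)) (cong +_ (ℕₚ.m+n∸m≡n n j))
∈-range {n} -[1+ j ] j<n = subst (_∈ range n) eq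
  (∈-applyUpTo⁺ (_⊖ n) {n ∸ suc j} (s≤s (ℕₚ.≤-trans (ℕₚ.m∸n≤m n (suc j)) (ℕₚ.m≤m+n n n))))
  where
  eq : (n ∸ suc j) ⊖ n ≡ -[1+ j ]
  eq = trans (ℤₚ.⊖-≤ (ℕₚ.m∸n≤m n (suc j))) (cong (λ i → ℤ.- + i) (ℕₚ.m∸[m∸n]≡n j<n))

alternating : ℕ → ℤ
alternating zero    = 1ℤ
alternating (suc n) = ℤ.- alternating n

parity : ℤ → ℤ
parity j = alternating ∣ j ∣

parity-suc : ∀ k l → parity (suc k ⊖ l) ≡ ℤ.- parity (k ⊖ l)
parity-suc k       zero    = refl
parity-suc zero    (suc zero)    = refl
parity-suc zero    (suc (suc l)) = sym (ℤₚ.neg-involutive (parity -[1+ l ]))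
parity-suc (suc k) (suc l) rewrite ℤₚ.[1+m]⊖[1+n]≡m⊖n (suc k) l | ℤₚ.[1+m]⊖[1+n]≡m⊖n k l = parity-suc k l

⊖-distanceˡ : ∀ k n → n ≤ k ℕ.+ ∣ k ⊖ n ∣
⊖-distanceˡ k       zero    = z≤n
⊖-distanceˡ zero    (suc n) = ℕₚ.≤-refl
⊖-distanceˡ (suc k) (suc n) rewrite ℤₚ.[1+m]⊖[1+n]≡m⊖n k n = s≤s (⊖-distanceˡ k n)

⊖-distanceʳ : ∀ k n → k ≤ n ℕ.+ ∣ k ⊖ n ∣
⊖-distanceʳ k n rewrite ℤₚ.∣m⊖n∣≡∣n⊖m∣ k n = ⊖-distanceˡ n k

triangle : ℕ → ℕ
triangle zero    = 0
triangle (suc n) = triangle n ℕ.+ n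

-- The Jacobi triple product, from its finite form

module JacobiTripleProduct (a′ c′ : ℕ) where

  a c d : ℕ
  a = suc a′
  c = suc c′
  d = a ℕ.+ c

  open QBinomial d

  -- The polynomial d j(j-1)/2 + a j, kept in ℕ: at j = -y its value is d y(y-1)/2 + (d - a) y, and
  -- d - a is c.
  expo : ℤ → ℕ
  expo (+ j)    = d ℕ.* triangle j ℕ.+ a ℕ.* j
  expo -[1+ j ] = d ℕ.* triangle (suc j) ℕ.+ c ℕ.* suc j

  ∣j∣≤expo : ∀ j → ∣ j ∣ ≤ expo j
  ∣j∣≤expo (+ j)    = ℕₚ.≤-trans (ℕₚ.m≤m+n j (a′ ℕ.* j)) (ℕₚ.m≤n+m (a ℕ.* j) (d ℕ.* triangle j))
  ∣j∣≤expo -[1+ j ] = ℕₚ.≤-trans (ℕₚ.m≤m+n (suc j) (c′ ℕ.* suc j)) (ℕₚ.m≤n+m (c ℕ.* suc j) (d ℕ.* triangle (suc j)))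

  -- The first difference of the quadratic exponent at j = k - l is d j + a; the term d l is moved
  -- to the left to avoid subtraction.
  expo-suc : ∀ k l → expo (suc k ⊖ l) ℕ.+ d ℕ.* l ≡ expo (k ⊖ l) ℕ.+ (d ℕ.* k ℕ.+ a)
  expo-suc k zero = eq d a (triangle k) k
    where
    eq : ∀ d a t k → d ℕ.* (t ℕ.+ k) ℕ.+ a ℕ.* suc k ℕ.+ d ℕ.* 0 ≡ d ℕ.* t ℕ.+ a ℕ.* k ℕ.+ (d ℕ.* k ℕ.+ a)
    eq = ℕ-solve
  expo-suc zero (suc zero) = eq a c
    where
    eq : ∀ a c → (a ℕ.+ c) ℕ.* 0 ℕ.+ a ℕ.* 0 ℕ.+ (a ℕ.+ c) ℕ.* 1 ≡
                 (a ℕ.+ c) ℕ.* 0 ℕ.+ c ℕ.* 1 ℕ.+ ((a ℕ.+ c) ℕ.* 0 ℕ.+ a)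
    eq = ℕ-solve
  expo-suc zero (suc (suc l)) = eq a c (triangle l) l
    where
    eq : ∀ a c t l → (a ℕ.+ c) ℕ.* (t ℕ.+ l) ℕ.+ c ℕ.* suc l ℕ.+ (a ℕ.+ c) ℕ.* suc (suc l) ≡
         (a ℕ.+ c) ℕ.* (t ℕ.+ l ℕ.+ suc l) ℕ.+ c ℕ.* suc (suc l) ℕ.+ ((a ℕ.+ c) ℕ.* 0 ℕ.+ a)
    eq = ℕ-solve
  expo-suc (suc k) (suc l) rewrite ℤₚ.[1+m]⊖[1+n]≡m⊖n (suc k) l | ℤₚ.[1+m]⊖[1+n]≡m⊖n k l = begin
    expo (suc k ⊖ l) ℕ.+ d ℕ.* suc l               ≡⟨ eq₁ (expo (suc k ⊖ l)) d l ⟩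
    expo (suc k ⊖ l) ℕ.+ d ℕ.* l ℕ.+ d             ≡⟨ cong (ℕ._+ d) (expo-suc k l) ⟩
    expo (k ⊖ l) ℕ.+ (d ℕ.* k ℕ.+ a) ℕ.+ d         ≡⟨ eq₂ (expo (k ⊖ l)) d k a ⟩
    expo (k ⊖ l) ℕ.+ (d ℕ.* suc k ℕ.+ a)           ∎
    where
    open ≡-Reasoning
    eq₁ : ∀ e d l → e ℕ.+ d ℕ.* suc l ≡ e ℕ.+ d ℕ.* l ℕ.+ d
    eq₁ = ℕ-solve
    eq₂ : ∀ e d k a → e ℕ.+ (d ℕ.* k ℕ.+ a) ℕ.+ d ≡ e ℕ.+ (d ℕ.* suc k ℕ.+ a)
    eq₂ = ℕ-solve

  -- The term with index j = k − l of ∏_{i<m} (1 - q^(a+di)) ∏_{i<l} (1 - q^(c+di)), where k + k′ = m + l.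
  term : ℕ → ℕ → ℕ → FPS
  term l k k′ = scalar (parity (k ⊖ l)) ⊛ (qbinom k k′ ⊛ qpow (expo (k ⊖ l)))

  qfac-head : ∀ n → qfac n 0 ≡ 1ℤ
  qfac-head = prodFin-head (oneMinusQ-convergent (a′ ℕ.+ c) (a′ ℕ.+ c))

  -- Multiplied by the two q-factorials, both sides become `qfac (m + l)`, and these factors have
  -- constant term 1. The symmetry turns the defining Pascal rule into the second one.
  qbinom-sym : ∀ m l → qbinom m l ≐ qbinom l m
  qbinom-sym m l = ⊛-cancelˡ (qfac m ⊛ qfac l) (qbinom m l) (qbinom l m)
    (trans (ℤₚ.+-identityˡ _) (cong₂ ℤ._*_ (qfac-head m) (qfac-head l))) (begin
    qfac m ⊛ qfac l ⊛ qbinom m l     ≈⟨ ⊛-comm (qfac m ⊛ qfac l) (qbinom m l) ⟩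
    qbinom m l ⊛ (qfac m ⊛ qfac l)   ≈⟨ qbinom-qfac m l ⟩
    qfac (m ℕ.+ l)                   ≡⟨ cong qfac (ℕₚ.+-comm m l) ⟩
    qfac (l ℕ.+ m)                   ≈⟨ qbinom-qfac l m ⟨
    qbinom l m ⊛ (qfac l ⊛ qfac m)   ≈⟨ swap (qbinom l m) (qfac l) (qfac m) ⟩
    qfac m ⊛ qfac l ⊛ qbinom l m     ∎)
    where
    open SetoidReasoning setoid
    swap : ∀ x y z → x ⊛ (y ⊛ z) ≐ z ⊛ y ⊛ x
    swap = solve 3 (λ x y z → x :* (y :* z) := z :* y :* x) λ _ → refl

  qbinom-pascal₂ : ∀ m l → qbinom (suc m) (suc l) ≐ qbinom (suc m) l ⊕ Q^ (suc l) ⊛ qbinom m (suc l)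
  qbinom-pascal₂ m l = ≐-trans (qbinom-sym (suc m) (suc l))
    (⊕-cong (qbinom-sym l (suc m)) (⊛-congˡ (Q^ (suc l)) (qbinom-sym (suc l) m)))

  -- In each Pascal step one summand must be the old term times -q^f, where 1 - q^f is the new
  -- factor. This isolates the two facts to check: the sign flips and the exponents balance.
  monomial-shift : ∀ {s s′ e₁ e₂ e₃ f} → s′ ≡ ℤ.- s → e₁ ℕ.+ e₂ ≡ f ℕ.+ e₃ → ∀ B →
    scalar s′ ⊛ (qpow e₁ ⊛ B ⊛ qpow e₂) ≐ ⊖ qpow f ⊛ (scalar s ⊛ (B ⊛ qpow e₃))
  monomial-shift {s} {e₁ = e₁} {e₂} {e₃} {f} refl eq B = begin
    scalar (ℤ.- s) ⊛ (qpow e₁ ⊛ B ⊛ qpow e₂)      ≈⟨ ⊛-congʳ (qpow e₁ ⊛ B ⊛ qpow e₂) (λ n → sym (ℤₚ.neg-distribˡ-* s (one n))) ⟩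
    ⊖ scalar s ⊛ (qpow e₁ ⊛ B ⊛ qpow e₂)          ≈⟨ regroup (scalar s) (qpow e₁) B (qpow e₂) ⟩
    ⊖ (scalar s ⊛ B ⊛ (qpow e₁ ⊛ qpow e₂))        ≈⟨ ⊖-cong (⊛-congˡ (scalar s ⊛ B) monomials) ⟩
    ⊖ (scalar s ⊛ B ⊛ (qpow f ⊛ qpow e₃))         ≈⟨ regroup′ (scalar s) B (qpow f) (qpow e₃) ⟩
    ⊖ qpow f ⊛ (scalar s ⊛ (B ⊛ qpow e₃))         ∎
    where
    open SetoidReasoning setoid
    monomials : qpow e₁ ⊛ qpow e₂ ≐ qpow f ⊛ qpow e₃
    monomials n = trans (sym (qpow-+ e₁ e₂ n)) (trans (cong (λ e → qpow e n) eq) (qpow-+ f e₃ n))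
    regroup : ∀ s x b y → ⊖ s ⊛ (x ⊛ b ⊛ y) ≐ ⊖ (s ⊛ b ⊛ (x ⊛ y))
    regroup = solve 4 (λ s x b y → (:- s) :* (x :* b :* y) := :- (s :* b :* (x :* y))) λ _ → refl
    regroup′ : ∀ s b x y → ⊖ (s ⊛ b ⊛ (x ⊛ y)) ≐ ⊖ x ⊛ (s ⊛ (b ⊛ y))
    regroup′ = solve 4 (λ s b x y → :- (s :* b :* (x :* y)) := (:- x) :* (s :* (b :* y))) λ _ → refl

  ⊛-oneMinusQ : ∀ g e → g ⊛ oneMinusQ e ≐ g ⊕ ⊖ qpow e ⊛ g
  ⊛-oneMinusQ g e = ≐-trans (expand g one (qpow e)) (λ n → cong (ℤ._+ (⊖ qpow e ⊛ g) n) (⊛-identityʳ g n))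
    where
    expand : ∀ g i x → g ⊛ (i ⊕ ⊖ x) ≐ g ⊛ i ⊕ ⊖ x ⊛ g
    expand = solve 3 (λ g i x → g :* (i :- x) := g :* i :+ (:- x) :* g) λ _ → refl

  Q^0-⊛ : ∀ f → Q^ 0 ⊛ f ≐ f
  Q^0-⊛ f = ≐-trans (⊛-congʳ f (λ n → trans (cong (λ e → qpow e n) (ℕₚ.*-zeroʳ d)) (qpow-zero n))) (⊛-identityˡ f)

  -- Raising l lowers j = k - l by one, so the summand in which k also rises keeps its index and is
  -- an old term. The other summand carries q^(dk) and becomes an old term times -q^(c+dl).
  adiag-term-l : ∀ l → adiag (suc l) (term (suc l)) ≐ adiag l (term l) ⊛ oneMinusQ (c ℕ.+ d ℕ.* l)
  adiag-term-l l = begin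
    adiag (suc l) (term (suc l))          ≈⟨ adiag-pascal l (term (suc l)) (term l) V h₀ (λ k _ → h₁ k) (λ k k′ _ → h₂ k k′) ⟩
    adiag l (term l) ⊕ adiag l V          ≈⟨ (λ n → cong (λ z → adiag l (term l) n ℤ.+ z) (⊛-adiag (⊖ y) l (term l) n)) ⟨
    adiag l (term l) ⊕ ⊖ y ⊛ adiag l (term l)  ≈⟨ ⊛-oneMinusQ (adiag l (term l)) (c ℕ.+ d ℕ.* l) ⟨
    adiag l (term l) ⊛ oneMinusQ (c ℕ.+ d ℕ.* l) ∎
    where
    open SetoidReasoning setoid
    y : FPS
    y = qpow (c ℕ.+ d ℕ.* l)
    V : ℕ → ℕ → FPS
    V k k′ = ⊖ y ⊛ term l k k′
    shift : ∀ k → parity (k ⊖ suc l) ≡ ℤ.- parity (k ⊖ l)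
    shift k = trans (sym (ℤₚ.neg-involutive _)) (cong ℤ.-_ (trans (sym (parity-suc k (suc l))) (cong parity (ℤₚ.[1+m]⊖[1+n]≡m⊖n k l))))
    expo-shift : ∀ k → d ℕ.* k ℕ.+ expo (k ⊖ suc l) ≡ c ℕ.+ d ℕ.* l ℕ.+ expo (k ⊖ l)
    expo-shift k = ℕₚ.+-cancelʳ-≡ a _ _ (trans (eq₁ (d ℕ.* k) (expo (k ⊖ suc l)) a)
      (trans (sym (expo-suc k (suc l))) (trans (cong (λ j → expo j ℕ.+ d ℕ.* suc l) (ℤₚ.[1+m]⊖[1+n]≡m⊖n k l))
        (eq₂ (expo (k ⊖ l)) a c l))))
      where
      eq₁ : ∀ x e a → x ℕ.+ e ℕ.+ a ≡ e ℕ.+ (x ℕ.+ a)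
      eq₁ = ℕ-solve
      eq₂ : ∀ e a c l → e ℕ.+ (a ℕ.+ c) ℕ.* suc l ≡ c ℕ.+ (a ℕ.+ c) ℕ.* l ℕ.+ e ℕ.+ a
      eq₂ = ℕ-solve
    core : ∀ k B → scalar (parity (k ⊖ suc l)) ⊛ (Q^ k ⊛ B ⊛ qpow (expo (k ⊖ suc l)))
                 ≐ ⊖ y ⊛ (scalar (parity (k ⊖ l)) ⊛ (B ⊛ qpow (expo (k ⊖ l))))
    core k = monomial-shift {e₁ = d ℕ.* k} {f = c ℕ.+ d ℕ.* l} (shift k) (expo-shift k)
    h₀ : ∀ k′ → term (suc l) 0 (suc k′) ≐ V 0 k′
    h₀ k′ = ≐-trans (⊛-congˡ (scalar (parity (0 ⊖ suc l))) (⊛-congʳ (qpow (expo (0 ⊖ suc l))) (≐-sym (Q^0-⊛ one)))) (core 0 one)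
    h₁ : ∀ k → term (suc l) (suc k) 0 ≐ term l k 0
    h₁ k rewrite ℤₚ.[1+m]⊖[1+n]≡m⊖n k l | qbinom-zeroʳ k = ≐-refl
    h₂ : ∀ k k′ → term (suc l) (suc k) (suc k′) ≐ term l k (suc k′) ⊕ V (suc k) k′
    h₂ k k′ = ≐-trans
      (distrib (scalar (parity (suc k ⊖ suc l))) (qbinom k (suc k′)) (Q^ (suc k) ⊛ qbinom (suc k) k′) (qpow (expo (suc k ⊖ suc l))))
      (⊕-cong (λ n → cong (λ j → (scalar (parity j) ⊛ (qbinom k (suc k′) ⊛ qpow (expo j))) n) (ℤₚ.[1+m]⊖[1+n]≡m⊖n k l))
              (core (suc k) (qbinom (suc k) k′)))
      where
      distrib : ∀ s b b′ x → s ⊛ ((b ⊕ b′) ⊛ x) ≐ s ⊛ (b ⊛ x) ⊕ s ⊛ (b′ ⊛ x)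
      distrib = solve 4 (λ s b b′ x → s :* ((b :+ b′) :* x) := s :* (b :* x) :+ s :* (b′ :* x)) λ _ → refl

  -- Now l is fixed, so the unchanged summand is the one with the same k, which calls for the second
  -- Pascal rule. Its power q^(dk′) matches -q^(a+dm) only because k + k′ = m + l.
  adiag-term-m : ∀ l m → adiag (suc (m ℕ.+ l)) (term l) ≐ adiag (m ℕ.+ l) (term l) ⊛ oneMinusQ (a ℕ.+ d ℕ.* m)
  adiag-term-m l m = begin
    adiag (suc (m ℕ.+ l)) (term l)                          ≈⟨ adiag-pascal (m ℕ.+ l) (term l) U (term l) (λ _ → ≐-refl) h₁ h₂ ⟩
    adiag (m ℕ.+ l) U ⊕ adiag (m ℕ.+ l) (term l)            ≈⟨ (λ n → trans (cong (ℤ._+ adiag (m ℕ.+ l) (term l) n) (sym (⊛-adiag (⊖ y) (m ℕ.+ l) (term l) n))) (ℤₚ.+-comm ((⊖ y ⊛ adiag (m ℕ.+ l) (term l)) n) _)) ⟩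
    adiag (m ℕ.+ l) (term l) ⊕ ⊖ y ⊛ adiag (m ℕ.+ l) (term l)  ≈⟨ ⊛-oneMinusQ (adiag (m ℕ.+ l) (term l)) (a ℕ.+ d ℕ.* m) ⟨
    adiag (m ℕ.+ l) (term l) ⊛ oneMinusQ (a ℕ.+ d ℕ.* m)    ∎
    where
    open SetoidReasoning setoid
    y : FPS
    y = qpow (a ℕ.+ d ℕ.* m)
    U : ℕ → ℕ → FPS
    U k k′ = ⊖ y ⊛ term l k k′
    expo-shift : ∀ k k′ → k ℕ.+ k′ ≡ m ℕ.+ l → d ℕ.* k′ ℕ.+ expo (suc k ⊖ l) ≡ a ℕ.+ d ℕ.* m ℕ.+ expo (k ⊖ l)
    expo-shift k k′ k+k′≡m+l = ℕₚ.+-cancelʳ-≡ (d ℕ.* l) _ _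
      (trans (ℕₚ.+-assoc (d ℕ.* k′) _ _) (trans (cong (d ℕ.* k′ ℕ.+_) (expo-suc k l))
        (trans (eq₁ d k k′ (expo (k ⊖ l)) a) (trans (cong (λ i → d ℕ.* i ℕ.+ (expo (k ⊖ l) ℕ.+ a)) k+k′≡m+l)
          (eq₂ d m l (expo (k ⊖ l)) a)))))
      where
      eq₁ : ∀ d k k′ e a → d ℕ.* k′ ℕ.+ (e ℕ.+ (d ℕ.* k ℕ.+ a)) ≡ d ℕ.* (k ℕ.+ k′) ℕ.+ (e ℕ.+ a)
      eq₁ = ℕ-solve
      eq₂ : ∀ d m l e a → d ℕ.* (m ℕ.+ l) ℕ.+ (e ℕ.+ a) ≡ a ℕ.+ d ℕ.* m ℕ.+ e ℕ.+ d ℕ.* l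
      eq₂ = ℕ-solve
    core : ∀ k k′ B → k ℕ.+ k′ ≡ m ℕ.+ l →
      scalar (parity (suc k ⊖ l)) ⊛ (Q^ k′ ⊛ B ⊛ qpow (expo (suc k ⊖ l)))
        ≐ ⊖ y ⊛ (scalar (parity (k ⊖ l)) ⊛ (B ⊛ qpow (expo (k ⊖ l))))
    core k k′ B p = monomial-shift {e₁ = d ℕ.* k′} {f = a ℕ.+ d ℕ.* m} (parity-suc k l) (expo-shift k k′ p) B
    h₁ : ∀ k → k ≡ m ℕ.+ l → term l (suc k) 0 ≐ U k 0
    h₁ k p rewrite qbinom-zeroʳ k = ≐-trans
      (⊛-congˡ (scalar (parity (suc k ⊖ l))) (⊛-congʳ (qpow (expo (suc k ⊖ l))) (≐-sym (Q^0-⊛ one))))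
      (core k 0 one (trans (ℕₚ.+-identityʳ k) p))
    h₂ : ∀ k k′ → k ℕ.+ suc k′ ≡ m ℕ.+ l → term l (suc k) (suc k′) ≐ U k (suc k′) ⊕ term l (suc k) k′
    h₂ k k′ p = ≐-trans
      (⊛-congˡ (scalar (parity (suc k ⊖ l))) (⊛-congʳ (qpow (expo (suc k ⊖ l))) (qbinom-pascal₂ k k′)))
      (≐-trans
        (distrib (scalar (parity (suc k ⊖ l))) (qbinom (suc k) k′) (Q^ (suc k′) ⊛ qbinom k (suc k′)) (qpow (expo (suc k ⊖ l))))
        (λ n → cong (ℤ._+ term l (suc k) k′ n) (core k (suc k′) (qbinom k (suc k′)) p n)))
      where
      distrib : ∀ s b b′ x → s ⊛ ((b ⊕ b′) ⊛ x) ≐ s ⊛ (b′ ⊛ x) ⊕ s ⊛ (b ⊛ x)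
      distrib = solve 4 (λ s b b′ x → s :* ((b :+ b′) :* x) := s :* (b′ :* x) :+ s :* (b :* x)) λ _ → refl

  A C : ℕ → FPS
  A i = oneMinusQ (a ℕ.+ d ℕ.* i)
  C i = oneMinusQ (c ℕ.+ d ℕ.* i)

  -- A form of the q-binomial theorem. The second product is built up first with m = 0, then the
  -- first one; every new factor is one Pascal step.
  finite-triple-product : ∀ m l → prodFin m A ⊛ prodFin l C ≐ adiag (m ℕ.+ l) (term l)
  finite-triple-product zero    zero    n = begin
    (one ⊛ one) n                                ≡⟨ ⊛-identityˡ one n ⟩
    one n                                        ≡⟨ qpow-zero n ⟨
    qpow 0 n                                     ≡⟨ cong (λ e → qpow e n) (cong₂ ℕ._+_ (ℕₚ.*-zeroʳ d) (ℕₚ.*-zeroʳ a)) ⟨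
    qpow (expo (+ 0)) n                          ≡⟨ ⊛-identityˡ (qpow (expo (+ 0))) n ⟨
    (one ⊛ qpow (expo (+ 0))) n                  ≡⟨ ⊛-identityˡ (one ⊛ qpow (expo (+ 0))) n ⟨
    (one ⊛ (one ⊛ qpow (expo (+ 0)))) n          ≡⟨ ⊛-congʳ (one ⊛ qpow (expo (+ 0))) (λ k → ℤₚ.*-identityˡ (one k)) n ⟨
    term 0 0 0 n                                 ∎
    where open ≡-Reasoning
  finite-triple-product zero    (suc l) = begin
    one ⊛ (prodFin l C ⊛ C l)                ≈⟨ ⊛-assoc one (prodFin l C) (C l) ⟨
    one ⊛ prodFin l C ⊛ C l                  ≈⟨ ⊛-congʳ (C l) (finite-triple-product zero l) ⟩
    adiag l (term l) ⊛ C l                   ≈⟨ adiag-term-l l ⟨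
    adiag (suc l) (term (suc l))             ∎
    where open SetoidReasoning setoid
  finite-triple-product (suc m) l       = begin
    prodFin m A ⊛ A m ⊛ prodFin l C          ≈⟨ swap (prodFin m A) (A m) (prodFin l C) ⟩
    prodFin m A ⊛ prodFin l C ⊛ A m          ≈⟨ ⊛-congʳ (A m) (finite-triple-product m l) ⟩
    adiag (m ℕ.+ l) (term l) ⊛ A m           ≈⟨ adiag-term-m l m ⟨
    adiag (suc (m ℕ.+ l)) (term l)           ∎
    where
    open SetoidReasoning setoid
    swap : ∀ x y z → x ⊛ y ⊛ z ≐ x ⊛ z ⊛ y
    swap = solve 3 (λ x y z → x :* y :* z := x :* z :* y) λ _ → refl

  R : FPS
  R = poch d d

  qfac-limit : ∀ {N M} → N ≤ M → qfac M ≐[ N ] R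
  qfac-limit = prodFin-prodInf (oneMinusQ-convergent (a′ ℕ.+ c) (a′ ℕ.+ c))

  -- To this order all q-factorials involved equal `R`, so `qbinom-qfac` says that the coefficient
  -- times R² is R, and one `R` cancels.
  qbinom-limit : ∀ {N k k′} → N ≤ k → N ≤ k′ → R ⊛ qbinom k k′ ≐[ N ] one
  qbinom-limit {N} {k} {k′} N≤k N≤k′ = ⊛-cancelˡₙ R (R ⊛ qbinom k k′) one
    (prodFin-head (oneMinusQ-convergent (a′ ℕ.+ c) (a′ ℕ.+ c)) 1)
    (≐ₙ-trans (≐⇒≐ₙ (rotate R (qbinom k k′)))
    (≐ₙ-trans (⊛-congₙ {f = qbinom k k′} (λ _ _ → refl) (⊛-congₙ (≐ₙ-sym (qfac-limit N≤k)) (≐ₙ-sym (qfac-limit N≤k′))))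
    (≐ₙ-trans (≐⇒≐ₙ (qbinom-qfac k k′))
    (≐ₙ-trans (qfac-limit (ℕₚ.≤-trans N≤k (ℕₚ.m≤m+n k k′)))
    (≐⇒≐ₙ (≐-sym (⊛-identityʳ R)))))))
    where
    rotate : ∀ x y → x ⊛ (x ⊛ y) ≐ y ⊛ (x ⊛ x)
    rotate = solve 2 (λ x y → x :* (x :* y) := y :* (x :* x)) λ _ → refl

  θ-term : ℤ → FPS
  θ-term j i = parity j ℤ.* qpow (expo j) i

  scalar-⊛ : ∀ s f → scalar s ⊛ f ≐ (λ i → s ℤ.* f i)
  scalar-⊛ s f i = trans (⊛-scaleˡ s one f i) (cong (s ℤ.*_) (⊛-identityˡ f i))

  -- If the exponent exceeds N, both sides vanish up to q^N. Otherwise ∣ j ∣ ≤ N, and with m = l =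
  -- 2N both k and k′ are then at least N, where the Gaussian coefficient has reached its limit.
  term-limit : ∀ N k k′ → k ℕ.+ k′ ≡ N ℕ.+ N ℕ.+ (N ℕ.+ N) → R ⊛ term (N ℕ.+ N) k k′ ≐[ N ] θ-term (k ⊖ (N ℕ.+ N))
  term-limit N k k′ k+k′≡2n i i≤N with expo (k ⊖ (N ℕ.+ N)) ℕ.≤? N
  ... | no  e≰N = trans (trans (pull R s B x i) (qpow-⊛-low e (R ⊛ s ⊛ B) i i<e))
                        (sym (trans (cong (parity j ℤ.*_) (qpow-neq (ℕₚ.<⇒≢ i<e))) (ℤₚ.*-zeroʳ (parity j))))
    where
    j = k ⊖ (N ℕ.+ N)
    e = expo j
    s = scalar (parity j)
    B = qbinom k k′
    x = qpow e
    i<e : i < e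
    i<e = ℕₚ.≤-<-trans i≤N (ℕₚ.≰⇒> e≰N)
    pull : ∀ r s b x → r ⊛ (s ⊛ (b ⊛ x)) ≐ x ⊛ (r ⊛ s ⊛ b)
    pull = solve 4 (λ r s b x → r :* (s :* (b :* x)) := x :* (r :* s :* b)) λ _ → refl
  ... | yes e≤N = begin
    (R ⊛ (s ⊛ (B ⊛ x))) i     ≡⟨ pull R s B x i ⟩
    (R ⊛ B ⊛ (s ⊛ x)) i       ≡⟨ ⊛-congₙ {N} {g = s ⊛ x} (qbinom-limit N≤k N≤k′) (λ _ _ → refl) i i≤N ⟩
    (one ⊛ (s ⊛ x)) i         ≡⟨ ⊛-identityˡ (s ⊛ x) i ⟩
    (s ⊛ x) i                 ≡⟨ scalar-⊛ (parity j) x i ⟩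
    parity j ℤ.* x i          ∎
    where
    open ≡-Reasoning
    n = N ℕ.+ N
    j = k ⊖ n
    s = scalar (parity j)
    B = qbinom k k′
    x = qpow (expo j)
    ∣j∣≤N : ∣ j ∣ ≤ N
    ∣j∣≤N = ℕₚ.≤-trans (∣j∣≤expo j) e≤N
    N≤k : N ≤ k
    N≤k = ℕₚ.+-cancelʳ-≤ N N k (ℕₚ.≤-trans (⊖-distanceˡ k n) (ℕₚ.+-monoʳ-≤ k ∣j∣≤N))
    N≤k′ : N ≤ k′
    N≤k′ = ℕₚ.+-cancelˡ-≤ N N k′ (ℕₚ.+-cancelˡ-≤ n n (N ℕ.+ k′) (ℕₚ.≤-trans (ℕₚ.≤-reflexive (sym k+k′≡2n))
      (ℕₚ.≤-trans (ℕₚ.+-monoˡ-≤ k′ (ℕₚ.≤-trans (⊖-distanceʳ k n) (ℕₚ.+-monoʳ-≤ n ∣j∣≤N))) (ℕₚ.≤-reflexive (ℕₚ.+-assoc n N k′)))))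
    pull : ∀ r s b x → r ⊛ (s ⊛ (b ⊛ x)) ≐ r ⊛ b ⊛ (s ⊛ x)
    pull = solve 4 (λ r s b x → r :* (s :* (b :* x)) := r :* b :* (s :* x)) λ _ → refl

  θ : FPS
  θ = poch a d ⊛ poch c d ⊛ poch d d

  -- The finite identity for m = l = 2N, multiplied by `R`: up to q^N every product and every term
  -- already has its limiting value.
  triple-product : ∀ N i → i ≤ N → θ i ≡ sumL (range (N ℕ.+ N)) (λ j → θ-term j i)
  triple-product N i i≤N = begin
    θ i                                          ≡⟨ ⊛-comm (poch a d ⊛ poch c d) R i ⟩
    (R ⊛ (poch a d ⊛ poch c d)) i                ≡⟨ ⊛-congₙ {N} {f = R} (λ _ _ → refl) (⊛-congₙ
                                                      (≐ₙ-sym (prodFin-prodInf (oneMinusQ-convergent a′ (a′ ℕ.+ c)) N≤n))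
                                                      (≐ₙ-sym (prodFin-prodInf (oneMinusQ-convergent c′ (a′ ℕ.+ c)) N≤n))) i i≤N ⟩
    (R ⊛ (prodFin n A ⊛ prodFin n C)) i          ≡⟨ ⊛-congˡ R (finite-triple-product n n) i ⟩
    (R ⊛ adiag (n ℕ.+ n) (term n)) i             ≡⟨ ⊛-adiag R (n ℕ.+ n) (term n) i ⟩
    adiag (n ℕ.+ n) (λ k k′ → R ⊛ term n k k′) i ≡⟨ adiag-congₙ N (n ℕ.+ n) (term-limit N) i i≤N ⟩
    adiag (n ℕ.+ n) (λ k _ → θ-term (k ⊖ n)) i   ≡⟨ adiag-list (n ℕ.+ n) (_⊖ n) θ-term i ⟩
    sumL (range n) (λ j → θ-term j i)            ∎
    where
    open ≡-Reasoning
    n = N ℕ.+ N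
    N≤n : N ≤ n
    N≤n = ℕₚ.m≤m+n N N

-- Sums determined by their support, and reindexing

module _ {A : Set} where

  sumL-cong : ∀ (xs : List A) {f g : A → ℤ} → (∀ x → f x ≡ g x) → sumL xs f ≡ sumL xs g
  sumL-cong []       p = refl
  sumL-cong (x ∷ xs) p = cong₂ ℤ._+_ (p x) (sumL-cong xs p)

  sumL-zero : ∀ (xs : List A) {f : A → ℤ} → (∀ x → f x ≡ 0ℤ) → sumL xs f ≡ 0ℤ
  sumL-zero []       p = refl
  sumL-zero (x ∷ xs) p = cong₂ ℤ._+_ (p x) (sumL-zero xs p)

  sumL-+ : ∀ (xs : List A) f g → sumL xs (λ x → f x ℤ.+ g x) ≡ sumL xs f ℤ.+ sumL xs g
  sumL-+ []       f g = refl
  sumL-+ (x ∷ xs) f g = trans (cong (λ z → f x ℤ.+ g x ℤ.+ z) (sumL-+ xs f g)) (interchange (f x) (g x) (sumL xs f) (sumL xs g))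
    where
    interchange : ∀ a b c d → a ℤ.+ b ℤ.+ (c ℤ.+ d) ≡ a ℤ.+ c ℤ.+ (b ℤ.+ d)
    interchange = solve-∀

  sumL-*ˡ : ∀ (xs : List A) c f → sumL xs (λ x → c ℤ.* f x) ≡ c ℤ.* sumL xs f
  sumL-*ˡ []       c f = sym (ℤₚ.*-zeroʳ c)
  sumL-*ˡ (x ∷ xs) c f = trans (cong (λ z → c ℤ.* f x ℤ.+ z) (sumL-*ˡ xs c f)) (sym (ℤₚ.*-distribˡ-+ c (f x) (sumL xs f)))

  sumL-minus : ∀ (xs : List A) f g → sumL xs (λ x → f x ℤ.- g x) ≡ sumL xs f ℤ.- sumL xs g
  sumL-minus xs f g = trans (sumL-+ xs f (λ x → ℤ.- g x)) (cong (λ z → sumL xs f ℤ.+ z)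
    (trans (sumL-cong xs λ x → sym (ℤₚ.-1*i≡-i (g x))) (trans (sumL-*ˡ xs (ℤ.- 1ℤ) g) (ℤₚ.-1*i≡-i (sumL xs g)))))

  sumL-++ : ∀ (xs ys : List A) f → sumL (xs ++ ys) f ≡ sumL xs f ℤ.+ sumL ys f
  sumL-++ []       ys f = sym (ℤₚ.+-identityˡ _)
  sumL-++ (x ∷ xs) ys f = trans (cong (λ z → f x ℤ.+ z) (sumL-++ xs ys f)) (sym (ℤₚ.+-assoc (f x) _ _))

  sumL-single : ∀ {xs : List A} {x₀} (f : A → ℤ) → Unique xs → x₀ ∈ xs → (∀ x → x ≢ x₀ → f x ≡ 0ℤ) → sumL xs f ≡ f x₀
  sumL-single {x ∷ xs} f (x∉xs ∷ _) (here refl) vanish =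
    trans (cong (λ z → f x ℤ.+ z) (others xs x∉xs)) (ℤₚ.+-identityʳ (f x))
    where
    others : ∀ ys → All (x ≢_) ys → sumL ys f ≡ 0ℤ
    others []       _            = refl
    others (y ∷ ys) (p All.∷ ps) = cong₂ ℤ._+_ (vanish y λ y≡x → p (sym y≡x)) (others ys ps)
  sumL-single {x ∷ xs} f (x∉xs ∷ u) (there x₀∈xs) vanish =
    trans (cong₂ ℤ._+_ (vanish x (All.lookup x∉xs x₀∈xs)) (sumL-single f u x₀∈xs vanish)) (ℤₚ.+-identityˡ _)

module _ {A B : Set} where

  sumL-swap : ∀ (xs : List A) (ys : List B) (F : A → B → ℤ) →
    sumL xs (λ x → sumL ys (F x)) ≡ sumL ys (λ y → sumL xs (λ x → F x y))
  sumL-swap []       ys F = sym (sumL-zero ys λ _ → refl)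
  sumL-swap (x ∷ xs) ys F = trans (cong (λ z → sumL ys (F x) ℤ.+ z) (sumL-swap xs ys F)) (sym (sumL-+ ys (F x) _))

  sumL-map : ∀ (φ : A → B) xs f → sumL (map φ xs) f ≡ sumL xs (λ x → f (φ x))
  sumL-map φ []       f = refl
  sumL-map φ (x ∷ xs) f = cong (λ z → f (φ x) ℤ.+ z) (sumL-map φ xs f)

sumL-cartesianProduct : ∀ {A B : Set} (xs : List A) (ys : List B) (F : A × B → ℤ) →
  sumL (cartesianProduct xs ys) F ≡ sumL xs (λ x → sumL ys (λ y → F (x , y)))
sumL-cartesianProduct []       ys F = refl
sumL-cartesianProduct (x ∷ xs) ys F = trans
  (sumL-++ (map (x ,_) ys) (cartesianProduct xs ys) F)
  (cong₂ ℤ._+_ (sumL-map (x ,_) ys F) (sumL-cartesianProduct xs ys F))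

-- The finite substitute for summing over all of `A`: any duplicate-free list containing the support
-- of `f` gives the same sum.
Covers : ∀ {A : Set} → List A → (A → ℤ) → Set
Covers xs f = ∀ x → f x ≢ 0ℤ → x ∈ xs

-- Both sums are the double sum of the diagonal kernel `K`, evaluated by rows or by columns: a line
-- through a support point meets the other list exactly once, and the remaining lines are zero.
sumL-independent : ∀ {A : Set} → DecidableEquality A → ∀ {xs ys : List A} {f} →
  Unique xs → Unique ys → Covers xs f → Covers ys f → sumL xs f ≡ sumL ys f
sumL-independent {A} _≟_ {xs} {ys} {f} uxs uys cxs cys = begin
  sumL xs f                             ≡⟨ sumL-cong xs (λ x → row uys cys x) ⟨
  sumL xs (λ x → sumL ys (K x))         ≡⟨ sumL-swap xs ys K ⟩
  sumL ys (λ y → sumL xs (λ x → K x y)) ≡⟨ sumL-cong ys (λ y → trans (sumL-cong xs (λ x → K-sym x y)) (row uxs cxs y)) ⟩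
  sumL ys f                             ∎
  where
  open ≡-Reasoning
  K : A → A → ℤ
  K x y = if does (x ≟ y) then f x else 0ℤ
  K-diagonal : ∀ x → K x x ≡ f x
  K-diagonal x rewrite dec-true (x ≟ x) refl = refl
  K-off : ∀ {x y} → x ≢ y → K x y ≡ 0ℤ
  K-off {x} {y} p rewrite dec-false (x ≟ y) p = refl
  K-sym : ∀ x y → K x y ≡ K y x
  K-sym x y with x ≟ y
  ... | yes refl = sym (K-diagonal x)
  ... | no  x≢y  = sym (K-off λ y≡x → x≢y (sym y≡x))
  K-zero : ∀ {x} y → f x ≡ 0ℤ → K x y ≡ 0ℤ
  K-zero {x} y p with x ≟ y
  ... | yes _ = p
  ... | no  _ = refl
  row : ∀ {zs} → Unique zs → Covers zs f → ∀ x → sumL zs (K x) ≡ f x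
  row {zs} uzs czs x with f x ℤ.≟ 0ℤ
  ... | yes fx≡0 = trans (sumL-zero zs (λ y → K-zero y fx≡0)) (sym fx≡0)
  ... | no  fx≢0 = trans (sumL-single (K x) uzs (czs x fx≢0) (λ y y≢x → K-off λ x≡y → y≢x (sym x≡y))) (K-diagonal x)

-- A preimage is demanded only where `g` is nonzero, so `φ` may parametrise just the residue classes
-- that support `g`.
sumL-reindex : ∀ {A B : Set} → DecidableEquality B → (φ : A → B) → (∀ {x y} → φ x ≡ φ y → x ≡ y) →
  ∀ {xs ys} (g : B → ℤ) → Unique xs → Unique ys →
  Covers xs (λ x → g (φ x)) → Covers ys g → (∀ y → g y ≢ 0ℤ → ∃ λ x → φ x ≡ y) →
  sumL xs (λ x → g (φ x)) ≡ sumL ys g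
sumL-reindex _≟_ φ inj {xs} g uxs uys cxs cys onto = trans (sym (sumL-map φ xs g))
  (sumL-independent _≟_ (Uniqueₚ.map⁺ inj uxs) uys covers cys)
  where
  covers : Covers (map φ xs) g
  covers y gy≢0 with onto y gy≢0
  ... | x , refl = ∈-map⁺ φ (cxs x gy≢0)

series : ∀ {A : Set} → List A → (A → ℤ) → (A → ℕ) → FPS
series xs w e i = sumL xs (λ x → w x ℤ.* qpow (e x) i)

series-⊛ : ∀ {A B : Set} (xs : List A) (ys : List B) w w′ e e′ n →
  (series xs w e ⊛ series ys w′ e′) n ≡
  sumL xs (λ x → sumL ys (λ y → w x ℤ.* w′ y ℤ.* qpow (e x ℕ.+ e′ y) n))
series-⊛ {A} {B} xs ys w w′ e e′ n = go xs n
  where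
  open ≡-Reasoning
  monomial : ∀ c x (zs : List B) n → ((λ i → c ℤ.* qpow x i) ⊛ series zs w′ e′) n ≡
    sumL zs (λ y → c ℤ.* w′ y ℤ.* qpow (x ℕ.+ e′ y) n)
  monomial c x zs n = begin
    ((λ i → c ℤ.* qpow x i) ⊛ series zs w′ e′) n             ≡⟨ ⊛-scaleˡ c (qpow x) (series zs w′ e′) n ⟩
    c ℤ.* (qpow x ⊛ series zs w′ e′) n                       ≡⟨ cong (c ℤ.*_) (inner zs n) ⟩
    c ℤ.* sumL zs (λ y → w′ y ℤ.* qpow (x ℕ.+ e′ y) n)       ≡⟨ sumL-*ˡ zs c _ ⟨
    sumL zs (λ y → c ℤ.* (w′ y ℤ.* qpow (x ℕ.+ e′ y) n))     ≡⟨ sumL-cong zs (λ y → sym (ℤₚ.*-assoc c (w′ y) _)) ⟩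
    sumL zs (λ y → c ℤ.* w′ y ℤ.* qpow (x ℕ.+ e′ y) n)       ∎
    where
    inner : ∀ zs n → (qpow x ⊛ series zs w′ e′) n ≡ sumL zs (λ y → w′ y ℤ.* qpow (x ℕ.+ e′ y) n)
    inner []       n = trans (⊛-comm (qpow x) nil n) (nil-⊛ (qpow x) n)
    inner (y ∷ zs) n = begin
      (qpow x ⊛ series (y ∷ zs) w′ e′) n
        ≡⟨ ⊛-comm (qpow x) (series (y ∷ zs) w′ e′) n ⟩
      (series (y ∷ zs) w′ e′ ⊛ qpow x) n
        ≡⟨ ⊛-distribʳ (qpow x) (λ i → w′ y ℤ.* qpow (e′ y) i) (series zs w′ e′) n ⟩
      ((λ i → w′ y ℤ.* qpow (e′ y) i) ⊛ qpow x) n ℤ.+ (series zs w′ e′ ⊛ qpow x) n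
        ≡⟨ cong₂ ℤ._+_ (⊛-scaleˡ (w′ y) (qpow (e′ y)) (qpow x) n) (⊛-comm (series zs w′ e′) (qpow x) n) ⟩
      w′ y ℤ.* (qpow (e′ y) ⊛ qpow x) n ℤ.+ (qpow x ⊛ series zs w′ e′) n
        ≡⟨ cong₂ ℤ._+_ (cong (w′ y ℤ.*_) (trans (⊛-comm (qpow (e′ y)) (qpow x) n) (sym (qpow-+ x (e′ y) n)))) (inner zs n) ⟩
      w′ y ℤ.* qpow (x ℕ.+ e′ y) n ℤ.+ sumL zs (λ y → w′ y ℤ.* qpow (x ℕ.+ e′ y) n) ∎
  go : ∀ zs n → (series zs w e ⊛ series ys w′ e′) n ≡
    sumL zs (λ x → sumL ys (λ y → w x ℤ.* w′ y ℤ.* qpow (e x ℕ.+ e′ y) n))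
  go []       n = nil-⊛ (series ys w′ e′) n
  go (z ∷ zs) n = trans
    (⊛-distribʳ (series ys w′ e′) (λ i → w z ℤ.* qpow (e z) i) (series zs w e) n)
    (cong₂ ℤ._+_ (monomial (w z) (e z) ys n) (go zs n))

-- Parity, divisibility indicators and quadratic exponents over the integers

module IntegerLattice where
  open import Data.Integer using (_+_; _*_; _-_; -_)

  *-nonzero : ∀ i j → i * j ≢ 0ℤ → i ≢ 0ℤ × j ≢ 0ℤ
  *-nonzero i j ij≢0 = (λ { refl → ij≢0 (ℤₚ.*-zeroˡ j) }) , (λ { refl → ij≢0 (ℤₚ.*-zeroʳ i) })

  -nonzero : ∀ {i j} → i - j ≢ 0ℤ → i ≢ 0ℤ ⊎ j ≢ 0ℤ
  -nonzero {i} {j} i-j≢0 with i ℤ.≟ 0ℤ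
  ... | no  i≢0  = inj₁ i≢0
  ... | yes refl = inj₂ λ { refl → i-j≢0 refl }

  parity-1+ : ∀ z → parity (1ℤ + z) ≡ - parity z
  parity-1+ (+ n)        = refl
  parity-1+ -[1+ zero ]  = refl
  parity-1+ -[1+ suc n ] = sym (ℤₚ.neg-involutive (parity -[1+ n ]))

  parity-pos-+ : ∀ n z → parity (+ n + z) ≡ parity (+ n) * parity z
  parity-pos-+ zero    z = trans (cong parity (ℤₚ.+-identityˡ z)) (sym (ℤₚ.*-identityˡ (parity z)))
  parity-pos-+ (suc n) z = begin
    parity (+ suc n + z)         ≡⟨ cong parity (ℤₚ.+-assoc 1ℤ (+ n) z) ⟩
    parity (1ℤ + (+ n + z))      ≡⟨ parity-1+ (+ n + z) ⟩
    - parity (+ n + z)           ≡⟨ cong -_ (parity-pos-+ n z) ⟩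
    - (parity (+ n) * parity z)  ≡⟨ ℤₚ.neg-distribˡ-* (parity (+ n)) (parity z) ⟩
    parity (+ suc n) * parity z  ∎
    where open ≡-Reasoning

  parity-square : ∀ z → parity z * parity z ≡ 1ℤ
  parity-square z = go ∣ z ∣
    where
    square-neg : ∀ x → - x * - x ≡ x * x
    square-neg = solve-∀
    go : ∀ n → alternating n * alternating n ≡ 1ℤ
    go zero    = refl
    go (suc n) = trans (square-neg (alternating n)) (go n)

  parity-+ : ∀ y z → parity (y + z) ≡ parity y * parity z
  parity-+ (+ n)    z = parity-pos-+ n z
  parity-+ -[1+ n ] z = begin
    parity y⁻                                   ≡⟨ ℤₚ.*-identityˡ _ ⟨
    1ℤ * parity y⁻                              ≡⟨ cong (_* parity y⁻) (parity-square (+ suc n)) ⟨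
    p * p * parity y⁻                           ≡⟨ ℤₚ.*-assoc p p (parity y⁻) ⟩
    p * (p * parity y⁻)                         ≡⟨ cong (p *_) (parity-pos-+ (suc n) y⁻) ⟨
    p * parity (+ suc n + (- + suc n + z))      ≡⟨ cong (λ x → p * parity x) (cancel (+ suc n) z) ⟩
    p * parity z                                ∎
    where
    open ≡-Reasoning
    y⁻ = -[1+ n ] + z
    p = parity (+ suc n)
    cancel : ∀ x z → x + (- x + z) ≡ z
    cancel = solve-∀

  parity-double : ∀ z → parity (z + z) ≡ 1ℤ
  parity-double z = trans (parity-+ z z) (parity-square z)

  even-or-odd : ∀ z → (∃ λ s → z ≡ s + s) ⊎ (∃ λ s → z ≡ 1ℤ + (s + s))
  even-or-odd z with z %ℕ 2 | a≡a%ℕn+[a/ℕn]*n z 2 | n%ℕd<d z 2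
  ... | zero  | eq | _ = inj₁ (z /ℕ 2 , trans eq (double (z /ℕ 2)))
    where
    double : ∀ s → 0ℤ + s * + 2 ≡ s + s
    double = solve-∀
  ... | suc zero | eq | _ = inj₂ (z /ℕ 2 , trans eq (double (z /ℕ 2)))
    where
    double : ∀ s → 1ℤ + s * + 2 ≡ 1ℤ + (s + s)
    double = solve-∀
  ... | suc (suc _) | _ | s≤s (s≤s ())

  divisible : ℤ → ℤ → ℤ
  divisible m x = if does (m ∣? x) then 1ℤ else 0ℤ

  divisible-yes : ∀ {m x} → m ∣ x → divisible m x ≡ 1ℤ
  divisible-yes {m} {x} p = cong (λ b → if b then 1ℤ else 0ℤ) (dec-true (m ∣? x) p)

  divisible-no : ∀ {m x} → ¬ m ∣ x → divisible m x ≡ 0ℤ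
  divisible-no {m} {x} p = cong (λ b → if b then 1ℤ else 0ℤ) (dec-false (m ∣? x) p)

  divisible-⇔ : ∀ {m x y} → (m ∣ x → m ∣ y) → (m ∣ y → m ∣ x) → divisible m x ≡ divisible m y
  divisible-⇔ {m} {x} {y} to from = decide (m ∣? y)
    where
    decide : Dec (m ∣ y) → divisible m x ≡ divisible m y
    decide (yes m∣y) = trans (divisible-yes (from m∣y)) (sym (divisible-yes m∣y))
    decide (no  m∤y) = trans (divisible-no λ m∣x → m∤y (to m∣x)) (sym (divisible-no m∤y))

  divisible-cong : ∀ {m x y} q → x ≡ y + q * m → divisible m x ≡ divisible m y
  divisible-cong {m} {x} {y} q refl = divisible-⇔
    (λ m∣x → ∣m+n∣m⇒∣n (subst (m ∣_) (ℤₚ.+-comm y (q * m)) m∣x) (divides q refl))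
    (λ m∣y → ∣m∣n⇒∣m+n m∣y (divides q refl))

  divisible-neg : ∀ m x → divisible m (- x) ≡ divisible m x
  divisible-neg m x = divisible-⇔ (λ p → subst (m ∣_) (ℤₚ.neg-involutive x) (neg p)) neg
    where
    neg : ∀ {y} → m ∣ y → m ∣ - y
    neg (divides q refl) = divides (- q) (ℤₚ.neg-distribˡ-* q m)

  divisible-nonzero : ∀ {m x} → divisible m x ≢ 0ℤ → ∃ λ q → x ≡ q * m
  divisible-nonzero {m} {x} p = decide (m ∣? x)
    where
    decide : Dec (m ∣ x) → ∃ λ q → x ≡ q * m
    decide (yes (divides q eq)) = q , eq
    decide (no  m∤x)            = contradiction (divisible-no m∤x) p

  square-abs : ∀ z → z * z ≡ + (∣ z ∣ ℕ.* ∣ z ∣)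
  square-abs (+ n)    = sym (ℤₚ.pos-* n n)
  square-abs -[1+ n ] = refl

  n≤n*n : ∀ n → n ≤ n ℕ.* n
  n≤n*n zero    = z≤n
  n≤n*n (suc n) = ℕₚ.m≤m*n (suc n) (suc n)

  triangle-quadratic : ∀ n → + 2 * + triangle n ≡ + n * + n - + n
  triangle-quadratic zero    = refl
  triangle-quadratic (suc n) = trans (distrib (+ triangle n) (+ n))
    (trans (cong (_+ (+ 2 * + n)) (triangle-quadratic n)) (next (+ n)))
    where
    distrib : ∀ t x → + 2 * (t + x) ≡ + 2 * t + + 2 * x
    distrib = solve-∀
    next : ∀ x → x * x - x + + 2 * x ≡ (1ℤ + x) * (1ℤ + x) - (1ℤ + x)
    next = solve-∀

  module _ (a′ c′ : ℕ) where
    open JacobiTripleProduct a′ c′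

    expo-quadratic : ∀ j → + 2 * + expo j ≡ + d * (j * j - j) + + 2 * + a * j
    expo-quadratic (+ j) = begin
      + 2 * (+ (d ℕ.* triangle j) + + (a ℕ.* j))    ≡⟨ cong₂ (λ x y → + 2 * (x + y)) (ℤₚ.pos-* d (triangle j)) (ℤₚ.pos-* a j) ⟩
      + 2 * (+ d * + triangle j + + a * + j)        ≡⟨ rearrange (+ d) (+ triangle j) (+ a) (+ j) ⟩
      + d * (+ 2 * + triangle j) + + 2 * + a * + j  ≡⟨ cong (λ x → + d * x + + 2 * + a * + j) (triangle-quadratic j) ⟩
      + d * (+ j * + j - + j) + + 2 * + a * + j     ∎
      where
      open ≡-Reasoning
      rearrange : ∀ d t a j → + 2 * (d * t + a * j) ≡ d * (+ 2 * t) + + 2 * a * j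
      rearrange = solve-∀
    expo-quadratic -[1+ j ] = begin
      + 2 * (+ (d ℕ.* triangle (suc j)) + + (c ℕ.* suc j))  ≡⟨ cong₂ (λ x y → + 2 * (x + y)) (ℤₚ.pos-* d (triangle (suc j))) (ℤₚ.pos-* c (suc j)) ⟩
      + 2 * (+ d * + triangle (suc j) + + c * y)            ≡⟨ rearrange (+ d) (+ triangle (suc j)) (+ c) y ⟩
      + d * (+ 2 * + triangle (suc j)) + + 2 * + c * y      ≡⟨ cong (λ x → + d * x + + 2 * + c * y) (triangle-quadratic (suc j)) ⟩
      + d * (y * y - y) + + 2 * + c * y                     ≡⟨ reflect (+ a) (+ c) y ⟩
      + d * (- y * - y - - y) + + 2 * + a * - y             ∎
      where
      open ≡-Reasoning
      y = + suc j
      rearrange : ∀ d t a j → + 2 * (d * t + a * j) ≡ d * (+ 2 * t) + + 2 * a * j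
      rearrange = solve-∀
      reflect : ∀ a c y → (a + c) * (y * y - y) + + 2 * c * y ≡ (a + c) * (- y * - y - - y) + + 2 * a * - y
      reflect = solve-∀

  -- `L₁` and `L₂` form a left inverse of an affine map with its denominators cleared by `K`, so
  -- injectivity reduces to two polynomial identities.
  linear-injective : ∀ K .{{_ : ℤ.NonZero K}} (φ : ℤ × ℤ → ℤ × ℤ) (L₁ L₂ : ℤ × ℤ → ℤ) →
    (∀ x y → K * x ≡ L₁ (φ (x , y))) → (∀ x y → K * y ≡ L₂ (φ (x , y))) → ∀ {p q} → φ p ≡ φ q → p ≡ q
  linear-injective K φ L₁ L₂ h₁ h₂ {x , y} {x′ , y′} eq = cong₂ _,_
    (ℤₚ.*-cancelˡ-≡ K x x′ (trans (h₁ x y) (trans (cong L₁ eq) (sym (h₁ x′ y′)))))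
    (ℤₚ.*-cancelˡ-≡ K y y′ (trans (h₂ x y) (trans (cong L₂ eq) (sym (h₂ x′ y′)))))

  -- Lattice points on the ellipse v² + 35u² = 840 N + 156

  module Lattice (N : ℕ) where

    B : ℕ
    B = 840 ℕ.* N ℕ.+ 156

    -- The identity is compared at q^N; clearing denominators, exponents become values of v² + 35u².
    norm : ℤ → ℤ → ℤ
    norm u v = v * v + + 35 * (u * u)

    hit : ℤ → ℤ → ℤ
    hit u v = if does (norm u v ℤ.≟ + B) then 1ℤ else 0ℤ

    hit-cong : ∀ {u v u′ v′} → norm u v ≡ norm u′ v′ → hit u v ≡ hit u′ v′
    hit-cong eq = cong (λ z → if does (z ℤ.≟ + B) then 1ℤ else 0ℤ) eq

    hit-nonzero : ∀ {u v} → hit u v ≢ 0ℤ → norm u v ≡ + B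
    hit-nonzero {u} {v} p with norm u v ℤ.≟ + B
    ... | yes eq = eq
    ... | no  _  = contradiction refl p

    hit-qpow : ∀ {u v} e → norm u v ≡ + (840 ℕ.* e ℕ.+ 156) → hit u v ≡ qpow e N
    hit-qpow {u} {v} e eq with N ℕ.≟ e
    ... | yes refl = trans (cong (λ b → if b then 1ℤ else 0ℤ) (dec-true (norm u v ℤ.≟ + B) eq)) (sym (qpow-eq {N} refl))
    ... | no  N≢e  = trans (cong (λ b → if b then 1ℤ else 0ℤ) (dec-false (norm u v ℤ.≟ + B) λ eq′ →
                       N≢e (ℕₚ.*-cancelˡ-≡ N e 840 (ℕₚ.+-cancelʳ-≡ 156 _ _ (ℤₚ.+-injective (trans (sym eq′) eq))))))
                       (sym (qpow-neq {e} N≢e))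

    hit-bound : ∀ {u v} → hit u v ≢ 0ℤ → ∣ u ∣ ≤ B × ∣ v ∣ ≤ B
    hit-bound {u} {v} p = (ℕₚ.≤-trans (n≤n*n ∣ u ∣) (ℕₚ.≤-trans (ℕₚ.m≤n*m (∣ u ∣ ℕ.* ∣ u ∣) 35) (ℕₚ.≤-trans (ℕₚ.m≤n+m _ (∣ v ∣ ℕ.* ∣ v ∣)) (ℕₚ.≤-reflexive eq))))
                        , (ℕₚ.≤-trans (n≤n*n ∣ v ∣) (ℕₚ.≤-trans (ℕₚ.m≤m+n _ _) (ℕₚ.≤-reflexive eq)))
      where
      eq : ∣ v ∣ ℕ.* ∣ v ∣ ℕ.+ 35 ℕ.* (∣ u ∣ ℕ.* ∣ u ∣) ≡ B
      eq = ℤₚ.+-injective (trans (cong₂ _+_ (sym (square-abs v)) (trans (ℤₚ.pos-* 35 (∣ u ∣ ℕ.* ∣ u ∣)) (cong (+ 35 *_) (sym (square-abs u)))))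
             (hit-nonzero {u} {v} p))

    -- Radius 2B makes this the very list over which `triple-product B` sums.
    rng : List ℤ
    rng = range (B ℕ.+ B)

    box : List (ℤ × ℤ)
    box = cartesianProduct rng rng

    box-unique : Unique box
    box-unique = Uniqueₚ.cartesianProduct⁺ (range-unique (B ℕ.+ B)) (range-unique (B ℕ.+ B))

    ∈-rng : ∀ z → ∣ z ∣ ≤ B → z ∈ rng
    ∈-rng z p = ∈-range z (ℕₚ.≤-trans p (ℕₚ.m≤m+n B B))

    _≟²_ : DecidableEquality (ℤ × ℤ)
    _≟²_ = ≡-dec ℤ._≟_ ℤ._≟_

    class : ℤ → ℤ → ℤ × ℤ → ℤ
    class c e (u , v) = divisible (+ 70) (v - c) * divisible (+ 12) (u - e * v)

    classHit : ℤ → ℤ → ℤ × ℤ → ℤ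
    classHit c e p = class c e p * hit (proj₁ p) (proj₂ p)

    -- Used for e = -1 and e = 7: both put u ≡ -v modulo 4, while modulo 3 they put u ≡ -v and u ≡ v
    -- respectively.
    S : ℤ → ℤ → ℤ
    S c e = sumL box (classHit c e)

    classHit-covers : ∀ c e → Covers box (classHit c e)
    classHit-covers c e (u , v) p = ∈-cartesianProduct⁺ (∈-rng u (proj₁ u,v≤)) (∈-rng v (proj₂ u,v≤))
      where u,v≤ = hit-bound {u} {v} (proj₂ (*-nonzero (class c e (u , v)) (hit u v) p))

    classHit-nonzero : ∀ {c e u v} → classHit c e (u , v) ≢ 0ℤ → (∃ λ s → v ≡ c + s * + 70) × (∃ λ t → u ≡ e * v + t * + 12)
    classHit-nonzero {c} {e} {u} {v} p
      with *-nonzero (class c e (u , v)) (hit u v) p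
    ... | p₁ , _ with *-nonzero (divisible (+ 70) (v - c)) (divisible (+ 12) (u - e * v)) p₁
    ... | p₂ , p₃ with divisible-nonzero {+ 70} p₂ | divisible-nonzero {+ 12} p₃
    ... | s , eq₁ | t , eq₂ = (s , trans (sym (restore v c)) (cong (λ z → c + z) eq₁)) , (t , trans (sym (restore u (e * v))) (cong (λ z → e * v + z) eq₂))
      where
      restore : ∀ x y → y + (x - y) ≡ x
      restore = solve-∀

    -- The norm-one rotation between the classes 11 and 39

    module Rotation where

      param : ℤ → ℤ × ℤ → ℤ × ℤ
      param c (s , t) = + 7 * (c + s * + 70) + t * + 12 , c + s * + 70

      -- In the coordinates of param, ρ is (u , v) ↦ ((u − v)/6 , −(v + 35u)/6): multiplication of
      -- v + u√−35 by the norm-one number (1 − √−35)/6, followed by z ↦ − z̄.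
      ρ : ℤ × ℤ → ℤ × ℤ
      ρ (s , t) = - + 41 * s - t - + 7 , + 1680 * s + + 41 * t + + 264

      -- For u = 7v + 12t the rotated point has u′ = v + 2t and v′ = -(41v + 70t), so it is
      -- integral. Moreover u′ - 7v′ = 288v + 492t is a multiple of 12, and v ≡ 11 gives v′ ≡ -451 ≡
      -- 39 (70). Both classes are thus parametrised by the same (s , t).
      φ₁ φ₂ : ℤ × ℤ → ℤ × ℤ
      φ₁ p = param (+ 11) p
      φ₂ p = param (+ 39) (ρ p)

      norm-φ : ∀ p → norm (proj₁ (φ₂ p)) (proj₂ (φ₂ p)) ≡ norm (proj₁ (φ₁ p)) (proj₂ (φ₁ p))
      norm-φ (s , t) = eq s t
        where
        eq : ∀ s t →
          let v = + 11 + s * + 70 ; u = + 7 * v + t * + 12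
              v′ = + 39 + (- + 41 * s - t - + 7) * + 70 ; u′ = + 7 * v′ + (+ 1680 * s + + 41 * t + + 264) * + 12
          in v′ * v′ + + 35 * (u′ * u′) ≡ v * v + + 35 * (u * u)
        eq = solve-∀

      -- From 70s = v - 11 comes B + 11, from 12t = u - 7v comes 8B; one radius serves both
      -- coordinates.
      bound : ∀ s t → ∣ + 7 * (+ 11 + s * + 70) + t * + 12 ∣ ≤ B → ∣ + 11 + s * + 70 ∣ ≤ B → ∣ s ∣ ≤ 8 ℕ.* B ℕ.+ 11 × ∣ t ∣ ≤ 8 ℕ.* B ℕ.+ 11
      bound s t u≤B v≤B = s≤ , t≤
        where
        v = + 11 + s * + 70
        u = + 7 * v + t * + 12
        s-eq : ∀ s → s * + 70 ≡ (+ 11 + s * + 70) - + 11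
        s-eq = solve-∀
        t-eq : ∀ v t → t * + 12 ≡ (+ 7 * v + t * + 12) - + 7 * v
        t-eq = solve-∀
        s≤ : ∣ s ∣ ≤ 8 ℕ.* B ℕ.+ 11
        s≤ = begin
          ∣ s ∣                     ≤⟨ ℕₚ.m≤m*n ∣ s ∣ 70 ⟩
          ∣ s ∣ ℕ.* 70              ≡⟨ ℤₚ.abs-* s (+ 70) ⟨
          ∣ s * + 70 ∣              ≡⟨ cong ∣_∣ (s-eq s) ⟩
          ∣ v - + 11 ∣              ≤⟨ ℤₚ.∣i-j∣≤∣i∣+∣j∣ v (+ 11) ⟩
          ∣ v ∣ ℕ.+ 11              ≤⟨ ℕₚ.+-monoˡ-≤ 11 v≤B ⟩
          B ℕ.+ 11                  ≤⟨ ℕₚ.+-monoˡ-≤ 11 (ℕₚ.m≤n*m B 8) ⟩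
          8 ℕ.* B ℕ.+ 11            ∎
          where open ℕₚ.≤-Reasoning
        t≤ : ∣ t ∣ ≤ 8 ℕ.* B ℕ.+ 11
        t≤ = begin
          ∣ t ∣                     ≤⟨ ℕₚ.m≤m*n ∣ t ∣ 12 ⟩
          ∣ t ∣ ℕ.* 12              ≡⟨ ℤₚ.abs-* t (+ 12) ⟨
          ∣ t * + 12 ∣              ≡⟨ cong ∣_∣ (t-eq v t) ⟩
          ∣ u - + 7 * v ∣           ≤⟨ ℤₚ.∣i-j∣≤∣i∣+∣j∣ u (+ 7 * v) ⟩
          ∣ u ∣ ℕ.+ ∣ + 7 * v ∣     ≡⟨ cong (∣ u ∣ ℕ.+_) (ℤₚ.abs-* (+ 7) v) ⟩
          ∣ u ∣ ℕ.+ 7 ℕ.* ∣ v ∣     ≤⟨ ℕₚ.+-mono-≤ u≤B (ℕₚ.*-monoʳ-≤ 7 v≤B) ⟩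
          B ℕ.+ 7 ℕ.* B             ≤⟨ ℕₚ.m≤m+n (8 ℕ.* B) 11 ⟩
          8 ℕ.* B ℕ.+ 11            ∎
          where open ℕₚ.≤-Reasoning

      classHit-φ : ∀ c s t → classHit c (+ 7) (+ 7 * (c + s * + 70) + t * + 12 , c + s * + 70) ≡ hit (+ 7 * (c + s * + 70) + t * + 12) (c + s * + 70)
      classHit-φ c s t = trans (cong (_* hit u v) (cong₂ _*_ (divisible-yes {+ 70} {v - c} (divides s (eq₁ c s))) (divisible-yes {+ 12} {u - + 7 * v} (divides t (eq₂ v t)))))
                               (ℤₚ.*-identityˡ (hit u v))
        where
        v = c + s * + 70
        u = + 7 * v + t * + 12
        eq₁ : ∀ c s → c + s * + 70 - c ≡ s * + 70
        eq₁ = solve-∀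
        eq₂ : ∀ v t → + 7 * v + t * + 12 - + 7 * v ≡ t * + 12
        eq₂ = solve-∀

      list : List (ℤ × ℤ)
      list = cartesianProduct (range (8 ℕ.* B ℕ.+ 11)) (range (8 ℕ.* B ℕ.+ 11))

      list-unique : Unique list
      list-unique = Uniqueₚ.cartesianProduct⁺ (range-unique (8 ℕ.* B ℕ.+ 11)) (range-unique (8 ℕ.* B ℕ.+ 11))

      hitφ₁ : ℤ × ℤ → ℤ
      hitφ₁ p = hit (proj₁ (φ₁ p)) (proj₂ (φ₁ p))

      hitφ₁-covers : Covers list hitφ₁
      hitφ₁-covers (s , t) p = ∈-cartesianProduct⁺ (∈-range s (proj₁ s,t≤)) (∈-range t (proj₂ s,t≤))
        where
        u,v≤ = hit-bound {proj₁ (φ₁ (s , t))} {proj₂ (φ₁ (s , t))} p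
        s,t≤ = bound s t (proj₁ u,v≤) (proj₂ u,v≤)

      g₁ : ∀ p → classHit (+ 11) (+ 7) (φ₁ p) ≡ hitφ₁ p
      g₁ (s , t) = classHit-φ (+ 11) s t

      g₂ : ∀ p → classHit (+ 39) (+ 7) (φ₂ p) ≡ hitφ₁ p
      g₂ (s , t) = trans (classHit-φ (+ 39) (- + 41 * s - t - + 7) (+ 1680 * s + + 41 * t + + 264))
        (hit-cong {proj₁ (φ₂ (s , t))} {proj₂ (φ₂ (s , t))} {proj₁ (φ₁ (s , t))} {proj₂ (φ₁ (s , t))} (norm-φ (s , t)))

      param-injective : ∀ c {p q} → param c p ≡ param c q → p ≡ q
      param-injective c = linear-injective (+ 420) (param c) (λ (u , v) → + 6 * (v - c)) (λ (u , v) → + 35 * (u - + 7 * v)) (eq₁ c) (eq₂ c)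
        where
        eq₁ : ∀ c s t → + 420 * s ≡ + 6 * (c + s * + 70 - c)
        eq₁ = solve-∀
        eq₂ : ∀ c s t → + 420 * t ≡ + 35 * (+ 7 * (c + s * + 70) + t * + 12 - + 7 * (c + s * + 70))
        eq₂ = solve-∀

      -- In the coordinates (u , v) the map is a reflection and undoes itself. The inverse therefore
      -- has the same linear part as `ρ`; the constants differ because it leads from class 39 back
      -- to class 11.
      ρ-injective : ∀ {p q} → ρ p ≡ ρ q → p ≡ q
      ρ-injective = linear-injective 1ℤ ρ (λ (s , t) → - + 23 - + 41 * s - t) (λ (s , t) → + 936 + + 1680 * s + + 41 * t) eq₁ eq₂
        where
        eq₁ : ∀ s t → 1ℤ * s ≡ - + 23 - + 41 * (- + 41 * s - t - + 7) - (+ 1680 * s + + 41 * t + + 264)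
        eq₁ = solve-∀
        eq₂ : ∀ s t → 1ℤ * t ≡ + 936 + + 1680 * (- + 41 * s - t - + 7) + + 41 * (+ 1680 * s + + 41 * t + + 264)
        eq₂ = solve-∀

      φ₁-onto : ∀ p → classHit (+ 11) (+ 7) p ≢ 0ℤ → ∃ λ x → φ₁ x ≡ p
      φ₁-onto (u , v) nz with classHit-nonzero {+ 11} {+ 7} {u} {v} nz
      ... | (s , refl) , (t , refl) = (s , t) , refl

      φ₂-onto : ∀ p → classHit (+ 39) (+ 7) p ≢ 0ℤ → ∃ λ x → φ₂ x ≡ p
      φ₂-onto (u , v) nz with classHit-nonzero {+ 39} {+ 7} {u} {v} nz
      ... | (s , refl) , (t , refl) = (- + 23 - + 41 * s - t , + 936 + + 1680 * s + + 41 * t) , cong (param (+ 39)) (cong₂ _,_ (eq₁ s t) (eq₂ s t))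
        where
        eq₁ : ∀ s t → - + 41 * (- + 23 - + 41 * s - t) - (+ 936 + + 1680 * s + + 41 * t) - + 7 ≡ s
        eq₁ = solve-∀
        eq₂ : ∀ s t → + 1680 * (- + 23 - + 41 * s - t) + + 41 * (+ 936 + + 1680 * s + + 41 * t) + + 264 ≡ t
        eq₂ = solve-∀

      -- Both counts are pulled back to the parameters (s , t), where the two hit conditions
      -- coincide by `norm-φ`.
      S-rotation : S (+ 11) (+ 7) ≡ S (+ 39) (+ 7)
      S-rotation = begin
        S (+ 11) (+ 7)                                       ≡⟨ sumL-reindex _≟²_ φ₁ (param-injective (+ 11)) (classHit (+ 11) (+ 7)) list-unique box-unique
                                                                  (λ p nz → hitφ₁-covers p (subst (_≢ 0ℤ) (g₁ p) nz)) (classHit-covers (+ 11) (+ 7)) φ₁-onto ⟨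
        sumL list (λ p → classHit (+ 11) (+ 7) (φ₁ p))       ≡⟨ sumL-cong list (λ p → trans (g₁ p) (sym (g₂ p))) ⟩
        sumL list (λ p → classHit (+ 39) (+ 7) (φ₂ p))       ≡⟨ sumL-reindex _≟²_ φ₂ (λ eq → ρ-injective (param-injective (+ 39) eq)) (classHit (+ 39) (+ 7)) list-unique box-unique
                                                                  (λ p nz → hitφ₁-covers p (subst (_≢ 0ℤ) (g₂ p) nz)) (classHit-covers (+ 39) (+ 7)) φ₂-onto ⟩
        S (+ 39) (+ 7)                                       ∎
        where open ≡-Reasoning

  -- The arguments are the predecessors of (a , c) = (5 , 2), (3 , 2) and (2 , 1). With the larger
  -- parameter as a, `expo j` is (7j² + 3j)/2, (5j² + j)/2 and (3j² + j)/2.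
  module T₇ = JacobiTripleProduct 4 1
  module T₅ = JacobiTripleProduct 2 1
  module T₃ = JacobiTripleProduct 1 0

  qpow-nonzero : ∀ {e n} → qpow e n ≢ 0ℤ → n ≡ e
  qpow-nonzero {e} {n} p with n ℕ.≟ e
  ... | yes eq = eq
  ... | no  n≢e = contradiction (qpow-neq n≢e) p

  -- The product of two theta series as a difference of lattice counts

  module ThetaProduct (N : ℕ) where
    open Lattice N

    N≤B : N ≤ B
    N≤B = ℕₚ.≤-trans (ℕₚ.m≤n*m N 840) (ℕₚ.m≤m+n (840 ℕ.* N) 156)

    -- Completing squares with x = 14n + 3 and y = 10m + 1 turns 840 times the total exponent, plus
    -- 156, into 15x² + 21y². This equals v² + 35u² for u = (x - y)/2, v = (5x + 7y)/2, which is
    -- `ψ₁`, and for u = (x + y)/2, v = (5x - 7y)/2, which is `ψ₂`.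
    ψ₁ ψ₂ : ℤ × ℤ → ℤ × ℤ
    ψ₁ (n , m) = + 7 * n - + 5 * m + + 1 , + 35 * (n + m) + + 11
    ψ₂ (n , m) = + 7 * n + + 5 * m + + 2 , + 35 * (n - m) + + 4

    hit₂ : ℤ × ℤ → ℤ
    hit₂ (u , v) = hit u v

    weight : ℤ × ℤ → ℤ
    weight (n , m) = qpow (T₇.expo n ℕ.+ T₅.expo m) N

    exponent : ∀ n m → + (840 ℕ.* (T₇.expo n ℕ.+ T₅.expo m) ℕ.+ 156)
      ≡ + 420 * (+ 7 * (n * n - n) + + 2 * + 5 * n) + + 420 * (+ 5 * (m * m - m) + + 2 * + 3 * m) + + 156
    exponent n m = begin
      + (840 ℕ.* (x ℕ.+ y)) + + 156               ≡⟨ cong (_+ + 156) (ℤₚ.pos-* 840 (x ℕ.+ y)) ⟩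
      + 840 * (+ x + + y) + + 156                 ≡⟨ split (+ x) (+ y) ⟩
      + 420 * (+ 2 * + x) + + 420 * (+ 2 * + y) + + 156
        ≡⟨ cong₂ (λ s t → + 420 * s + + 420 * t + + 156) (expo-quadratic 4 1 n) (expo-quadratic 2 1 m) ⟩
      + 420 * (+ 7 * (n * n - n) + + 2 * + 5 * n) + + 420 * (+ 5 * (m * m - m) + + 2 * + 3 * m) + + 156 ∎
      where
      open ≡-Reasoning
      x = T₇.expo n
      y = T₅.expo m
      split : ∀ x y → + 840 * (x + y) + + 156 ≡ + 420 * (+ 2 * x) + + 420 * (+ 2 * y) + + 156
      split = solve-∀

    hit-ψ₁ : ∀ p → hit₂ (ψ₁ p) ≡ weight p
    hit-ψ₁ (n , m) = hit-qpow {+ 7 * n - + 5 * m + + 1} {+ 35 * (n + m) + + 11} (T₇.expo n ℕ.+ T₅.expo m) (trans (eq n m) (sym (exponent n m)))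
      where
      eq : ∀ n m → (+ 35 * (n + m) + + 11) * (+ 35 * (n + m) + + 11) + + 35 * ((+ 7 * n - + 5 * m + + 1) * (+ 7 * n - + 5 * m + + 1))
        ≡ + 420 * (+ 7 * (n * n - n) + + 2 * + 5 * n) + + 420 * (+ 5 * (m * m - m) + + 2 * + 3 * m) + + 156
      eq = solve-∀

    hit-ψ₂ : ∀ p → hit₂ (ψ₂ p) ≡ weight p
    hit-ψ₂ (n , m) = hit-qpow {+ 7 * n + + 5 * m + + 2} {+ 35 * (n - m) + + 4} (T₇.expo n ℕ.+ T₅.expo m) (trans (eq n m) (sym (exponent n m)))
      where
      eq : ∀ n m → (+ 35 * (n - m) + + 4) * (+ 35 * (n - m) + + 4) + + 35 * ((+ 7 * n + + 5 * m + + 2) * (+ 7 * n + + 5 * m + + 2))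
        ≡ + 420 * (+ 7 * (n * n - n) + + 2 * + 5 * n) + + 420 * (+ 5 * (m * m - m) + + 2 * + 3 * m) + + 156
      eq = solve-∀

    -- ψ₁ lands in its class exactly when n + m is even, ψ₂ exactly when n + m is odd.
    class-ψ : ∀ n m → parity n * parity m ≡ class (+ 11) -1ℤ (ψ₁ (n , m)) - class (+ 39) -1ℤ (ψ₂ (n , m))
    class-ψ n m = decide (even-or-odd (n + m))
      where
      Goal : ℤ → Set
      Goal m = parity n * parity m ≡ class (+ 11) -1ℤ (ψ₁ (n , m)) - class (+ 39) -1ℤ (ψ₂ (n , m))
      sub : ∀ n m → n + m - n ≡ m
      sub = solve-∀
      -- With m eliminated through n + m = 2s, every residue is a polynomial identity in n and s.
      -- The class that is missed leaves -35 here and 35 in the odd case, whose indicator modulo 70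
      -- evaluates to 0.
      even : ∀ s → Goal (s + s - n)
      even s = trans (trans (sym (parity-+ n m′)) (trans (cong parity (back n s)) (parity-double s)))
        (sym (cong₂ _-_
          (cong₂ _*_ (divisible-cong {+ 70} {proj₂ (ψ₁ (n , m′)) - + 11} {0ℤ} s (eq₁ n s))
                     (divisible-cong {+ 12} {proj₁ (ψ₁ (n , m′)) - -1ℤ * proj₂ (ψ₁ (n , m′))} {0ℤ} (+ 5 * s + n + + 1) (eq₂ n s)))
          (cong (_* divisible (+ 12) (proj₁ (ψ₂ (n , m′)) - -1ℤ * proj₂ (ψ₂ (n , m′))))
            (divisible-cong {+ 70} {proj₂ (ψ₂ (n , m′)) - + 39} { - + 35} (n - s) (eq₃ n s)))))
        where
        m′ = s + s - n
        back : ∀ n s → n + (s + s - n) ≡ s + s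
        back = solve-∀
        eq₁ : ∀ n s → + 35 * (n + (s + s - n)) + + 11 - + 11 ≡ 0ℤ + s * + 70
        eq₁ = solve-∀
        eq₂ : ∀ n s → + 7 * n - + 5 * (s + s - n) + + 1 - -1ℤ * (+ 35 * (n + (s + s - n)) + + 11) ≡ 0ℤ + (+ 5 * s + n + + 1) * + 12
        eq₂ = solve-∀
        eq₃ : ∀ n s → + 35 * (n - (s + s - n)) + + 4 - + 39 ≡ - + 35 + (n - s) * + 70
        eq₃ = solve-∀
      odd : ∀ s → Goal (1ℤ + (s + s) - n)
      odd s = trans (trans (sym (parity-+ n m′)) (trans (cong parity (back n s)) (trans (parity-1+ (s + s)) (cong -_ (parity-double s)))))
        (sym (cong₂ _-_
          (cong (_* divisible (+ 12) (proj₁ (ψ₁ (n , m′)) - -1ℤ * proj₂ (ψ₁ (n , m′))))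
            (divisible-cong {+ 70} {proj₂ (ψ₁ (n , m′)) - + 11} {+ 35} s (eq₁ n s)))
          (cong₂ _*_ (divisible-cong {+ 70} {proj₂ (ψ₂ (n , m′)) - + 39} {0ℤ} (n - s - + 1) (eq₂ n s))
                     (divisible-cong {+ 12} {proj₁ (ψ₂ (n , m′)) - -1ℤ * proj₂ (ψ₂ (n , m′))} {0ℤ} (+ 6 * n - + 5 * s - + 2) (eq₃ n s)))))
        where
        m′ = 1ℤ + (s + s) - n
        back : ∀ n s → n + (1ℤ + (s + s) - n) ≡ 1ℤ + (s + s)
        back = solve-∀
        eq₁ : ∀ n s → + 35 * (n + (1ℤ + (s + s) - n)) + + 11 - + 11 ≡ + 35 + s * + 70
        eq₁ = solve-∀
        eq₂ : ∀ n s → + 35 * (n - (1ℤ + (s + s) - n)) + + 4 - + 39 ≡ 0ℤ + (n - s - + 1) * + 70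
        eq₂ = solve-∀
        eq₃ : ∀ n s → + 7 * n + + 5 * (1ℤ + (s + s) - n) + + 2 - -1ℤ * (+ 35 * (n - (1ℤ + (s + s) - n)) + + 4) ≡ 0ℤ + (+ 6 * n - + 5 * s - + 2) * + 12
        eq₃ = solve-∀
      decide : (∃ λ s → n + m ≡ s + s) ⊎ (∃ λ s → n + m ≡ 1ℤ + (s + s)) → Goal m
      decide (inj₁ (s , n+m≡)) = subst Goal (trans (sym (cong (_- n) n+m≡)) (sub n m)) (even s)
      decide (inj₂ (s , n+m≡)) = subst Goal (trans (sym (cong (_- n) n+m≡)) (sub n m)) (odd s)

    covers : ∀ c (ψ : ℤ × ℤ → ℤ × ℤ) → (∀ p → hit₂ (ψ p) ≡ weight p) → Covers box (λ p → classHit c -1ℤ (ψ p))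
    covers c ψ hit-ψ (n , m) nz = ∈-cartesianProduct⁺
      (∈-rng n (ℕₚ.≤-trans (T₇.∣j∣≤expo n) (ℕₚ.≤-trans (ℕₚ.m≤m+n (T₇.expo n) (T₅.expo m)) total≤B)))
      (∈-rng m (ℕₚ.≤-trans (T₅.∣j∣≤expo m) (ℕₚ.≤-trans (ℕₚ.m≤n+m (T₅.expo m) (T₇.expo n)) total≤B)))
      where
      total≤B : T₇.expo n ℕ.+ T₅.expo m ≤ B
      total≤B = subst (_≤ B) (qpow-nonzero {T₇.expo n ℕ.+ T₅.expo m}
        (subst (_≢ 0ℤ) (hit-ψ (n , m)) (proj₂ (*-nonzero (class c -1ℤ (ψ (n , m))) (hit₂ (ψ (n , m))) nz)))) N≤B

    ψ₁-injective : ∀ {p q} → ψ₁ p ≡ ψ₁ q → p ≡ q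
    ψ₁-injective = linear-injective (+ 420) ψ₁
      (λ (u , v) → + 35 * (u - + 1) + + 5 * (v - + 11)) (λ (u , v) → + 7 * (v - + 11) - + 35 * (u - + 1)) eq₁ eq₂
      where
      eq₁ : ∀ n m → + 420 * n ≡ + 35 * (+ 7 * n - + 5 * m + + 1 - + 1) + + 5 * (+ 35 * (n + m) + + 11 - + 11)
      eq₁ = solve-∀
      eq₂ : ∀ n m → + 420 * m ≡ + 7 * (+ 35 * (n + m) + + 11 - + 11) - + 35 * (+ 7 * n - + 5 * m + + 1 - + 1)
      eq₂ = solve-∀

    ψ₂-injective : ∀ {p q} → ψ₂ p ≡ ψ₂ q → p ≡ q
    ψ₂-injective = linear-injective (+ 420) ψ₂
      (λ (u , v) → + 35 * (u - + 2) + + 5 * (v - + 4)) (λ (u , v) → + 35 * (u - + 2) - + 7 * (v - + 4)) eq₁ eq₂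
      where
      eq₁ : ∀ n m → + 420 * n ≡ + 35 * (+ 7 * n + + 5 * m + + 2 - + 2) + + 5 * (+ 35 * (n - m) + + 4 - + 4)
      eq₁ = solve-∀
      eq₂ : ∀ n m → + 420 * m ≡ + 35 * (+ 7 * n + + 5 * m + + 2 - + 2) - + 7 * (+ 35 * (n - m) + + 4 - + 4)
      eq₂ = solve-∀

    ψ₁-onto : ∀ p → classHit (+ 11) -1ℤ p ≢ 0ℤ → ∃ λ x → ψ₁ x ≡ p
    ψ₁-onto (u , v) nz = build (classHit-nonzero {+ 11} { -1ℤ} {u} {v} nz)
      where
      eq₁ : ∀ s t → + 7 * (t - + 5 * s - + 1) - + 5 * (+ 7 * s - t + + 1) + + 1 ≡ -1ℤ * (+ 11 + s * + 70) + t * + 12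
      eq₁ = solve-∀
      eq₂ : ∀ s t → + 35 * ((t - + 5 * s - + 1) + (+ 7 * s - t + + 1)) + + 11 ≡ + 11 + s * + 70
      eq₂ = solve-∀
      build : (∃ λ s → v ≡ + 11 + s * + 70) × (∃ λ t → u ≡ -1ℤ * v + t * + 12) → ∃ λ x → ψ₁ x ≡ (u , v)
      -- v = 11 + 70s gives n + m = 2s, and then u - 1 = 12n - 10s determines n.
      build ((s , refl) , (t , refl)) = (t - + 5 * s - + 1 , + 7 * s - t + + 1) , cong₂ _,_ (eq₁ s t) (eq₂ s t)

    ψ₂-onto : ∀ p → classHit (+ 39) -1ℤ p ≢ 0ℤ → ∃ λ x → ψ₂ x ≡ p
    ψ₂-onto (u , v) nz = build (classHit-nonzero {+ 39} { -1ℤ} {u} {v} nz)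
      where
      eq₁ : ∀ s t → + 7 * (t - + 5 * s - + 3) + + 5 * (t - + 7 * s - + 4) + + 2 ≡ -1ℤ * (+ 39 + s * + 70) + t * + 12
      eq₁ = solve-∀
      eq₂ : ∀ s t → + 35 * ((t - + 5 * s - + 3) - (t - + 7 * s - + 4)) + + 4 ≡ + 39 + s * + 70
      eq₂ = solve-∀
      build : (∃ λ s → v ≡ + 39 + s * + 70) × (∃ λ t → u ≡ -1ℤ * v + t * + 12) → ∃ λ x → ψ₂ x ≡ (u , v)
      build ((s , refl) , (t , refl)) = (t - + 5 * s - + 3 , t - + 7 * s - + 4) , cong₂ _,_ (eq₁ s t) (eq₂ s t)

    θ-product : (T₇.θ ⊛ T₅.θ) N ≡ S (+ 11) -1ℤ - S (+ 39) -1ℤ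
    θ-product = begin
      (T₇.θ ⊛ T₅.θ) N
        ≡⟨ ⊛-congₙ {N} (λ i i≤N → T₇.triple-product B i (ℕₚ.≤-trans i≤N N≤B)) (λ i i≤N → T₅.triple-product B i (ℕₚ.≤-trans i≤N N≤B)) N ℕₚ.≤-refl ⟩
      (series rng parity T₇.expo ⊛ series rng parity T₅.expo) N
        ≡⟨ series-⊛ rng rng parity parity T₇.expo T₅.expo N ⟩
      sumL rng (λ n → sumL rng (λ m → parity n * parity m * weight (n , m)))
        ≡⟨ sumL-cartesianProduct rng rng (λ p → parity (proj₁ p) * parity (proj₂ p) * weight p) ⟨
      sumL box (λ p → parity (proj₁ p) * parity (proj₂ p) * weight p)
        ≡⟨ sumL-cong box pointwise ⟩
      sumL box (λ p → classHit (+ 11) -1ℤ (ψ₁ p) - classHit (+ 39) -1ℤ (ψ₂ p))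
        ≡⟨ sumL-minus box (λ p → classHit (+ 11) -1ℤ (ψ₁ p)) (λ p → classHit (+ 39) -1ℤ (ψ₂ p)) ⟩
      sumL box (λ p → classHit (+ 11) -1ℤ (ψ₁ p)) - sumL box (λ p → classHit (+ 39) -1ℤ (ψ₂ p))
        ≡⟨ cong₂ _-_
            (sumL-reindex _≟²_ ψ₁ ψ₁-injective (classHit (+ 11) -1ℤ) box-unique box-unique (covers (+ 11) ψ₁ hit-ψ₁) (classHit-covers (+ 11) -1ℤ) ψ₁-onto)
            (sumL-reindex _≟²_ ψ₂ ψ₂-injective (classHit (+ 39) -1ℤ) box-unique box-unique (covers (+ 39) ψ₂ hit-ψ₂) (classHit-covers (+ 39) -1ℤ) ψ₂-onto) ⟩
      S (+ 11) -1ℤ - S (+ 39) -1ℤ ∎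
      where
      open ≡-Reasoning
      pointwise : ∀ p → parity (proj₁ p) * parity (proj₂ p) * weight p ≡ classHit (+ 11) -1ℤ (ψ₁ p) - classHit (+ 39) -1ℤ (ψ₂ p)
      pointwise (n , m) = trans (cong (_* weight (n , m)) (class-ψ n m))
        (trans (distrib (class (+ 11) -1ℤ (ψ₁ (n , m))) (class (+ 39) -1ℤ (ψ₂ (n , m))) (weight (n , m)))
        (cong₂ (λ x y → class (+ 11) -1ℤ (ψ₁ (n , m)) * x - class (+ 39) -1ℤ (ψ₂ (n , m)) * y) (sym (hit-ψ₁ (n , m))) (sym (hit-ψ₂ (n , m)))))
        where
        distrib : ∀ a b w → (a - b) * w ≡ a * w - b * w
        distrib = solve-∀

  -- The sequence of the theorem and its signed square roots

  StrictlyIncreasing : (ℕ → ℕ) → Set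
  StrictlyIncreasing f = ∀ m n → m < n → f m < f n

  step⇒increasing : ∀ {f} → (∀ n → f n < f (suc n)) → StrictlyIncreasing f
  step⇒increasing {f} step m (suc n) (s≤s m≤n) with ℕₚ.m≤n⇒m<n∨m≡n m≤n
  ... | inj₁ m<n  = ℕₚ.<-trans (step⇒increasing step m n m<n) (step n)
  ... | inj₂ refl = step m

  increasing-reflects-< : ∀ {f} → StrictlyIncreasing f → ∀ {m n} → f m < f n → m < n
  increasing-reflects-< inc {m} {n} fm<fn with ℕₚ.<-cmp m n
  ... | tri< m<n _ _ = m<n
  ... | tri≈ _ refl _ = contradiction fm<fn (ℕₚ.<-irrefl refl)
  ... | tri> _ _ n<m = contradiction fm<fn (ℕₚ.<-asym (inc n m n<m))

  increasing-injective : ∀ {f} → StrictlyIncreasing f → ∀ {m n} → f m ≡ f n → m ≡ n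
  increasing-injective {f} inc {m} {n} eq with ℕₚ.<-cmp m n
  ... | tri< m<n _ _ = contradiction eq (ℕₚ.<⇒≢ (inc m n m<n))
  ... | tri≈ _ m≡n _ = m≡n
  ... | tri> _ _ n<m = contradiction (sym eq) (ℕₚ.<⇒≢ (inc n m n<m))

  n≤increasing : ∀ {f} → StrictlyIncreasing f → ∀ n → n ≤ f n
  n≤increasing inc zero    = z≤n
  n≤increasing inc (suc n) = ℕₚ.≤-trans (s≤s (n≤increasing inc n)) (inc n (suc n) (ℕₚ.n<1+n n))

  -- The positions at which `g` takes the values of `f` increase strictly, so the n-th of them is at
  -- least n.
  increasing-≤ : ∀ {f g} → StrictlyIncreasing f → StrictlyIncreasing g → (∀ n → ∃ λ m → f n ≡ g m) → ∀ n → g n ≤ f n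
  increasing-≤ {f} {g} incf incg f⊆g n = subst (g n ≤_) (sym (proj₂ (f⊆g n))) (mono (n≤increasing index-increasing n))
    where
    index : ℕ → ℕ
    index k = proj₁ (f⊆g k)
    index-increasing : StrictlyIncreasing index
    index-increasing k l k<l = increasing-reflects-< incg
      (subst (_< g (index l)) (proj₂ (f⊆g k)) (subst (f k <_) (proj₂ (f⊆g l)) (incf k l k<l)))
    mono : ∀ {k l} → k ≤ l → g k ≤ g l
    mono k≤l with ℕₚ.m≤n⇒m<n∨m≡n k≤l
    ... | inj₁ k<l  = ℕₚ.<⇒≤ (incg _ _ k<l)
    ... | inj₂ refl = ℕₚ.≤-refl

  same-range : ∀ {f g} → StrictlyIncreasing f → StrictlyIncreasing g →
    (∀ n → ∃ λ m → f n ≡ g m) → (∀ n → ∃ λ m → g n ≡ f m) → ∀ n → f n ≡ g n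
  same-range incf incg f⊆g g⊆f n = ℕₚ.≤-antisym (increasing-≤ incg incf g⊆f n) (increasing-≤ incf incg f⊆g n)

  -- The n-th positive k with k² ≡ 121 mod 840, listed by residue mod 420.
  root : ℕ → ℕ
  root 0 = 11
  root 1 = 31
  root 2 = 59
  root 3 = 101
  root 4 = 109
  root 5 = 151
  root 6 = 179
  root 7 = 199
  root 8 = 221
  root 9 = 241
  root 10 = 269
  root 11 = 311
  root 12 = 319
  root 13 = 361
  root 14 = 389
  root 15 = 409
  root (suc (suc (suc (suc (suc (suc (suc (suc (suc (suc (suc (suc (suc (suc (suc (suc n)))))))))))))))) = 420 ℕ.+ root n

  -- The quotient (k² - 121)/840 for k = `root n`; the recursion is (k + 420)² - k² = 840 (k + 210).
  index : ℕ → ℕ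
  index 0 = 0
  index 1 = 1
  index 2 = 4
  index 3 = 12
  index 4 = 14
  index 5 = 27
  index 6 = 38
  index 7 = 47
  index 8 = 58
  index 9 = 69
  index 10 = 86
  index 11 = 115
  index 12 = 121
  index 13 = 155
  index 14 = 180
  index 15 = 199
  index (suc (suc (suc (suc (suc (suc (suc (suc (suc (suc (suc (suc (suc (suc (suc (suc n)))))))))))))))) = index n ℕ.+ root n ℕ.+ 210

  -- The sign for which rootSign n * root n ≡ 4 mod 7.
  rootSign : ℕ → ℤ
  rootSign 0 = 1ℤ
  rootSign 1 = -1ℤ
  rootSign 2 = -1ℤ
  rootSign 3 = -1ℤ
  rootSign 4 = 1ℤ
  rootSign 5 = 1ℤ
  rootSign 6 = 1ℤ
  rootSign 7 = -1ℤ
  rootSign 8 = 1ℤ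
  rootSign 9 = -1ℤ
  rootSign 10 = -1ℤ
  rootSign 11 = -1ℤ
  rootSign 12 = 1ℤ
  rootSign 13 = 1ℤ
  rootSign 14 = 1ℤ
  rootSign 15 = -1ℤ
  rootSign (suc (suc (suc (suc (suc (suc (suc (suc (suc (suc (suc (suc (suc (suc (suc (suc n)))))))))))))))) = rootSign n

  root-square : ∀ n → root n ℕ.* root n ≡ 840 ℕ.* index n ℕ.+ 121
  root-square 0 = refl
  root-square 1 = refl
  root-square 2 = refl
  root-square 3 = refl
  root-square 4 = refl
  root-square 5 = refl
  root-square 6 = refl
  root-square 7 = refl
  root-square 8 = refl
  root-square 9 = refl
  root-square 10 = refl
  root-square 11 = refl
  root-square 12 = refl
  root-square 13 = refl
  root-square 14 = refl
  root-square 15 = refl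
  root-square (suc (suc (suc (suc (suc (suc (suc (suc (suc (suc (suc (suc (suc (suc (suc (suc n)))))))))))))))) = trans (expand (root n)) (trans (cong (λ x → x ℕ.+ 840 ℕ.* (root n ℕ.+ 210)) (root-square n)) (collect (index n) (root n)))
    where
    expand : ∀ k → (420 ℕ.+ k) ℕ.* (420 ℕ.+ k) ≡ k ℕ.* k ℕ.+ 840 ℕ.* (k ℕ.+ 210)
    expand k = lemma 210 k
      where
      lemma : ∀ c k → (2 ℕ.* c ℕ.+ k) ℕ.* (2 ℕ.* c ℕ.+ k) ≡ k ℕ.* k ℕ.+ (4 ℕ.* c) ℕ.* (k ℕ.+ c)
      lemma = ℕ-solve
    collect : ∀ b k → 840 ℕ.* b ℕ.+ 121 ℕ.+ 840 ℕ.* (k ℕ.+ 210) ≡ 840 ℕ.* (b ℕ.+ k ℕ.+ 210) ℕ.+ 121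
    collect b k = lemma 840 121 210 b k
      where
      lemma : ∀ x y z b k → x ℕ.* b ℕ.+ y ℕ.+ x ℕ.* (k ℕ.+ z) ≡ x ℕ.* (b ℕ.+ k ℕ.+ z) ℕ.+ y
      lemma = ℕ-solve

  root-step : ∀ n → root n < root (suc n)
  root-step 0 = ℕₚ.<ᵇ⇒< 11 31 tt
  root-step 1 = ℕₚ.<ᵇ⇒< 31 59 tt
  root-step 2 = ℕₚ.<ᵇ⇒< 59 101 tt
  root-step 3 = ℕₚ.<ᵇ⇒< 101 109 tt
  root-step 4 = ℕₚ.<ᵇ⇒< 109 151 tt
  root-step 5 = ℕₚ.<ᵇ⇒< 151 179 tt
  root-step 6 = ℕₚ.<ᵇ⇒< 179 199 tt
  root-step 7 = ℕₚ.<ᵇ⇒< 199 221 tt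
  root-step 8 = ℕₚ.<ᵇ⇒< 221 241 tt
  root-step 9 = ℕₚ.<ᵇ⇒< 241 269 tt
  root-step 10 = ℕₚ.<ᵇ⇒< 269 311 tt
  root-step 11 = ℕₚ.<ᵇ⇒< 311 319 tt
  root-step 12 = ℕₚ.<ᵇ⇒< 319 361 tt
  root-step 13 = ℕₚ.<ᵇ⇒< 361 389 tt
  root-step 14 = ℕₚ.<ᵇ⇒< 389 409 tt
  root-step 15 = ℕₚ.<ᵇ⇒< 409 431 tt
  root-step (suc (suc (suc (suc (suc (suc (suc (suc (suc (suc (suc (suc (suc (suc (suc (suc n)))))))))))))))) = ℕₚ.+-monoʳ-< 420 (root-step n)

  root-increasing : StrictlyIncreasing root
  root-increasing = step⇒increasing root-step

  index-increasing : StrictlyIncreasing index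
  index-increasing m n m<n = ℕₚ.*-cancelˡ-< 840 _ _ (ℕₚ.+-cancelʳ-< 121 _ _
    (subst (_< 840 ℕ.* index n ℕ.+ 121) (root-square m) (subst (root m ℕ.* root m <_) (root-square n)
      (ℕₚ.*-mono-< (root-increasing m n m<n) (root-increasing m n m<n)))))

  root-block : ∀ p j → root (p ℕ.* 16 ℕ.+ j) ≡ p ℕ.* 420 ℕ.+ root j
  root-block zero    j = refl
  root-block (suc p) j = cong (420 ℕ.+_) (root-block p j)

  rootSign-block : ∀ p j → rootSign (p ℕ.* 16 ℕ.+ j) ≡ rootSign j
  rootSign-block zero    j = refl
  rootSign-block (suc p) j = rootSign-block p j

  -- Decided by evaluation over all residues. Modulus 420 is the right period because k and k + 420
  -- have the same square modulo 840.
  root-residues : ∀ (r : Fin 420) → (toℕ r ℕ.* toℕ r) % 420 ≡ 121 → ∃ λ (j : Fin 16) → root (toℕ j) ≡ toℕ r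
  root-residues = toWitness {a? = Finₚ.all? λ r → ((toℕ r ℕ.* toℕ r) % 420 ℕ.≟ 121) →-dec Finₚ.any? λ j → root (toℕ j) ℕ.≟ toℕ r} tt

  root-complete : ∀ m k → k ℕ.* k ≡ 840 ℕ.* m ℕ.+ 121 → ∃ λ n → root n ≡ k
  root-complete m k eq = build (root-residues (fromℕ< (m%n<n k 420))
      (trans (cong (λ x → (x ℕ.* x) % 420) (Finₚ.toℕ-fromℕ< (m%n<n k 420))) r²%420))
    where
    open ≡-Reasoning
    r q : ℕ
    r = k % 420
    q = k / 420
    square : ∀ c r q → (r ℕ.+ q ℕ.* c) ℕ.* (r ℕ.+ q ℕ.* c) ≡ r ℕ.* r ℕ.+ (q ℕ.* (2 ℕ.* r ℕ.+ q ℕ.* c)) ℕ.* c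
    square = ℕ-solve
    target : ∀ c x m → (2 ℕ.* c) ℕ.* m ℕ.+ x ≡ x ℕ.+ (2 ℕ.* m) ℕ.* c
    target = ℕ-solve
    r²%420 : (r ℕ.* r) % 420 ≡ 121
    r²%420 = begin
      (r ℕ.* r) % 420                                                        ≡⟨ [m+kn]%n≡m%n (r ℕ.* r) (q ℕ.* (2 ℕ.* r ℕ.+ q ℕ.* 420)) 420 ⟨
      (r ℕ.* r ℕ.+ (q ℕ.* (2 ℕ.* r ℕ.+ q ℕ.* 420)) ℕ.* 420) % 420            ≡⟨ cong (_% 420) (square 420 r q) ⟨
      ((r ℕ.+ q ℕ.* 420) ℕ.* (r ℕ.+ q ℕ.* 420)) % 420                        ≡⟨ cong (λ x → (x ℕ.* x) % 420) (m≡m%n+[m/n]*n k 420) ⟨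
      (k ℕ.* k) % 420                                                        ≡⟨ cong (_% 420) (trans eq (target 420 121 m)) ⟩
      (121 ℕ.+ (2 ℕ.* m) ℕ.* 420) % 420                                      ≡⟨ [m+kn]%n≡m%n 121 (2 ℕ.* m) 420 ⟩
      121                                                                    ∎
    build : (∃ λ (j : Fin 16) → root (toℕ j) ≡ toℕ (fromℕ< (m%n<n k 420))) → ∃ λ n → root n ≡ k
    build (j , root-j) = q ℕ.* 16 ℕ.+ toℕ j , (begin
      root (q ℕ.* 16 ℕ.+ toℕ j)     ≡⟨ root-block q (toℕ j) ⟩
      q ℕ.* 420 ℕ.+ root (toℕ j)    ≡⟨ cong (q ℕ.* 420 ℕ.+_) (trans root-j (Finₚ.toℕ-fromℕ< (m%n<n k 420))) ⟩
      q ℕ.* 420 ℕ.+ r               ≡⟨ ℕₚ.+-comm (q ℕ.* 420) r ⟩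
      r ℕ.+ q ℕ.* 420               ≡⟨ m≡m%n+[m/n]*n k 420 ⟨
      k                             ∎)

  signedRoot : ℕ → ℤ
  signedRoot n = rootSign n * + root n

  -- Residue c ε j j′: the classes c mod 420 of signed roots, the sign ε they carry in the theorem,
  -- and the positions at which c = root j and c − 420 = − root j′ first occur.
  data Residue : ℤ → ℤ → ℕ → ℕ → Set where
    r11 : Residue (+ 11) 1ℤ 0 15
    r109 : Residue (+ 109) -1ℤ 4 11
    r151 : Residue (+ 151) -1ℤ 5 10
    r179 : Residue (+ 179) -1ℤ 6 9
    r221 : Residue (+ 221) -1ℤ 8 7
    r319 : Residue (+ 319) 1ℤ 12 3
    r361 : Residue (+ 361) 1ℤ 13 2
    r389 : Residue (+ 389) 1ℤ 14 1

  residue-spec : ∀ {c ε j j′} → Residue c ε j j′ →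
    (rootSign j ≡ 1ℤ × + root j ≡ c) × (rootSign j′ ≡ -1ℤ × + root j′ ≡ + 420 - c)
  residue-spec r11 = (refl , refl) , (refl , refl)
  residue-spec r109 = (refl , refl) , (refl , refl)
  residue-spec r151 = (refl , refl) , (refl , refl)
  residue-spec r179 = (refl , refl) , (refl , refl)
  residue-spec r221 = (refl , refl) , (refl , refl)
  residue-spec r319 = (refl , refl) , (refl , refl)
  residue-spec r361 = (refl , refl) , (refl , refl)
  residue-spec r389 = (refl , refl) , (refl , refl)

  -- A nonnegative ρ gives a positive root in block ρ. For ρ = -(p + 1) the value is -(420p + (420 -
  -- c)), the negative of a root in block p.
  residue-signedRoot : ∀ {c ε j j′} → Residue c ε j j′ → ∀ ρ → ∃ λ n → signedRoot n ≡ ρ * + 420 + c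
  residue-signedRoot {c} {j = j} res (+ p) = p ℕ.* 16 ℕ.+ j , (begin
    rootSign (p ℕ.* 16 ℕ.+ j) * + root (p ℕ.* 16 ℕ.+ j)   ≡⟨ cong₂ (λ s k → s * + k) (rootSign-block p j) (root-block p j) ⟩
    rootSign j * (+ (p ℕ.* 420) + + root j)               ≡⟨ cong₂ (λ s k → s * (+ (p ℕ.* 420) + k)) (proj₁ (proj₁ (residue-spec res))) (proj₂ (proj₁ (residue-spec res))) ⟩
    1ℤ * (+ (p ℕ.* 420) + c)                              ≡⟨ ℤₚ.*-identityˡ _ ⟩
    + (p ℕ.* 420) + c                                     ≡⟨ cong (_+ c) (ℤₚ.pos-* p 420) ⟩
    + p * + 420 + c                                       ∎)
    where open ≡-Reasoning
  residue-signedRoot {c} {j′ = j′} res -[1+ p ] = p ℕ.* 16 ℕ.+ j′ , (begin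
    rootSign (p ℕ.* 16 ℕ.+ j′) * + root (p ℕ.* 16 ℕ.+ j′) ≡⟨ cong₂ (λ s k → s * + k) (rootSign-block p j′) (root-block p j′) ⟩
    rootSign j′ * (+ (p ℕ.* 420) + + root j′)             ≡⟨ cong₂ (λ s k → s * (+ (p ℕ.* 420) + k)) (proj₁ (proj₂ (residue-spec res))) (proj₂ (proj₂ (residue-spec res))) ⟩
    -1ℤ * (+ (p ℕ.* 420) + (+ 420 - c))                   ≡⟨ cong (λ x → -1ℤ * (x + (+ 420 - c))) (ℤₚ.pos-* p 420) ⟩
    -1ℤ * (+ p * + 420 + (+ 420 - c))                     ≡⟨ eq (+ p) c ⟩
    - (1ℤ + + p) * + 420 + c                              ∎)
    where
    open ≡-Reasoning
    eq : ∀ p c → -1ℤ * (p * + 420 + (+ 420 - c)) ≡ - (1ℤ + p) * + 420 + c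
    eq = solve-∀

  sgn-periodic : ∀ n → sgn (16 ℕ.+ n) ≡ sgn n
  sgn-periodic n = trans (cong (-1ℤ ℤ.^_) (+-distrib-/-∣ˡ {16} (n ℕ.+ 4) {8} (ℕᵈ.divides 2 refl))) (square (-1ℤ ℤ.^ ((n ℕ.+ 4) / 8)))
    where
    square : ∀ x → -1ℤ * (-1ℤ * x) ≡ x
    square = solve-∀

  -- Why the sign is ⌊(n + 4)/8⌋: within a block of 16, the roots at n and 15 - n add up to 420 and
  -- have opposite `rootSign`, so they share a class c mod 420. The sign of the theorem agrees at
  -- these two places, hence is a function of c.
  signedRoot-residue : ∀ n → ∃ λ c → ∃ λ j → ∃ λ j′ → ∃ λ ρ → Residue c (sgn n) j j′ × signedRoot n ≡ ρ * + 420 + c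
  signedRoot-residue 0 = _ , _ , _ , 0ℤ , r11 , refl
  signedRoot-residue 1 = _ , _ , _ , -1ℤ , r389 , refl
  signedRoot-residue 2 = _ , _ , _ , -1ℤ , r361 , refl
  signedRoot-residue 3 = _ , _ , _ , -1ℤ , r319 , refl
  signedRoot-residue 4 = _ , _ , _ , 0ℤ , r109 , refl
  signedRoot-residue 5 = _ , _ , _ , 0ℤ , r151 , refl
  signedRoot-residue 6 = _ , _ , _ , 0ℤ , r179 , refl
  signedRoot-residue 7 = _ , _ , _ , -1ℤ , r221 , refl
  signedRoot-residue 8 = _ , _ , _ , 0ℤ , r221 , refl
  signedRoot-residue 9 = _ , _ , _ , -1ℤ , r179 , refl
  signedRoot-residue 10 = _ , _ , _ , -1ℤ , r151 , refl
  signedRoot-residue 11 = _ , _ , _ , -1ℤ , r109 , refl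
  signedRoot-residue 12 = _ , _ , _ , 0ℤ , r319 , refl
  signedRoot-residue 13 = _ , _ , _ , 0ℤ , r361 , refl
  signedRoot-residue 14 = _ , _ , _ , 0ℤ , r389 , refl
  signedRoot-residue 15 = _ , _ , _ , -1ℤ , r11 , refl
  signedRoot-residue (suc (suc (suc (suc (suc (suc (suc (suc (suc (suc (suc (suc (suc (suc (suc (suc n)))))))))))))))) = extend (signedRoot-residue n)
    where
    eq : ∀ s k ρ c → s * k ≡ ρ * + 420 + c → s * (+ 420 + k) ≡ (s + ρ) * + 420 + c
    eq s k ρ c p = trans (ℤₚ.*-distribˡ-+ s (+ 420) k) (trans (cong (λ x → s * + 420 + x) p) (collect s ρ c))
      where
      collect : ∀ s ρ c → s * + 420 + (ρ * + 420 + c) ≡ (s + ρ) * + 420 + c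
      collect = solve-∀
    extend : (∃ λ c → ∃ λ j → ∃ λ j′ → ∃ λ ρ → Residue c (sgn n) j j′ × signedRoot n ≡ ρ * + 420 + c) →
      ∃ λ c → ∃ λ j → ∃ λ j′ → ∃ λ ρ → Residue c (sgn (16 ℕ.+ n)) j j′ × signedRoot (16 ℕ.+ n) ≡ ρ * + 420 + c
    extend (c , j , j′ , ρ , res , p) = c , j , j′ , rootSign n + ρ ,
      subst (λ ε → Residue c ε j j′) (sym (sgn-periodic n)) res , eq (rootSign n) (+ root n) ρ c p

  ∣rootSign∣≡1 : ∀ n → ∣ rootSign n ∣ ≡ 1
  ∣rootSign∣≡1 0 = refl
  ∣rootSign∣≡1 1 = refl
  ∣rootSign∣≡1 2 = refl
  ∣rootSign∣≡1 3 = refl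
  ∣rootSign∣≡1 4 = refl
  ∣rootSign∣≡1 5 = refl
  ∣rootSign∣≡1 6 = refl
  ∣rootSign∣≡1 7 = refl
  ∣rootSign∣≡1 8 = refl
  ∣rootSign∣≡1 9 = refl
  ∣rootSign∣≡1 10 = refl
  ∣rootSign∣≡1 11 = refl
  ∣rootSign∣≡1 12 = refl
  ∣rootSign∣≡1 13 = refl
  ∣rootSign∣≡1 14 = refl
  ∣rootSign∣≡1 15 = refl
  ∣rootSign∣≡1 (suc (suc (suc (suc (suc (suc (suc (suc (suc (suc (suc (suc (suc (suc (suc (suc n)))))))))))))))) = ∣rootSign∣≡1 n

  ∣signedRoot∣ : ∀ n → ∣ signedRoot n ∣ ≡ root n
  ∣signedRoot∣ n = trans (ℤₚ.abs-* (rootSign n) (+ root n)) (trans (cong (ℕ._* root n) (∣rootSign∣≡1 n)) (ℕₚ.*-identityˡ (root n)))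

  signedRoot-injective : ∀ {m n} → signedRoot m ≡ signedRoot n → m ≡ n
  signedRoot-injective {m} {n} eq = increasing-injective root-increasing
    (trans (sym (∣signedRoot∣ m)) (trans (cong ∣_∣ eq) (∣signedRoot∣ n)))

  signedRoot-square : ∀ n → signedRoot n * signedRoot n ≡ + (840 ℕ.* index n ℕ.+ 121)
  signedRoot-square n = trans (square-abs (signedRoot n)) (cong +_ (trans (cong (λ x → x ℕ.* x) (∣signedRoot∣ n)) (root-square n)))

  -- Counting over a fixed v

  module Fibre (N : ℕ) where
    open Lattice N

    hit-neg : ∀ u v → hit (- u) v ≡ hit u v
    hit-neg u v = hit-cong { - u} {v} {u} {v} (eq u v)
      where
      eq : ∀ u v → v * v + + 35 * (- u * - u) ≡ v * v + + 35 * (u * u)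
      eq = solve-∀

    covers-hit : ∀ (w : ℤ → ℤ) v → Covers rng (λ u → w u * hit u v)
    covers-hit w v u nz = ∈-rng u (proj₁ (hit-bound {u} {v} (proj₂ (*-nonzero (w u) (hit u v) nz))))

    6k+1-bound : ∀ k → ∣ + 6 * k + + 1 ∣ ≤ B → ∣ k ∣ ≤ B ℕ.+ B
    6k+1-bound k bound = begin
      ∣ k ∣                       ≤⟨ ℕₚ.m≤n*m ∣ k ∣ 6 ⟩
      6 ℕ.* ∣ k ∣                 ≡⟨ ℤₚ.abs-* (+ 6) k ⟨
      ∣ + 6 * k ∣                 ≡⟨ cong ∣_∣ (shift k) ⟩
      ∣ + 6 * k + + 1 - + 1 ∣     ≤⟨ ℤₚ.∣i-j∣≤∣i∣+∣j∣ (+ 6 * k + + 1) (+ 1) ⟩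
      ∣ + 6 * k + + 1 ∣ ℕ.+ 1     ≤⟨ ℕₚ.+-mono-≤ bound (ℕₚ.≤-trans (ℕₚ.<ᵇ⇒< 0 156 _) (ℕₚ.m≤n+m 156 (840 ℕ.* N))) ⟩
      B ℕ.+ B                     ∎
      where
      open ℕₚ.≤-Reasoning
      shift : ∀ k → + 6 * k ≡ + 6 * k + + 1 - + 1
      shift = solve-∀

    opaque

      -- The points above v with u ≡ i (12). Opaque, so that the residue evaluations outside this
      -- block never unfold the sum.
      X : ℤ → ℤ → ℤ
      X v i = sumL rng (λ u → divisible (+ 12) (u - i) * hit u v)

      X-cong : ∀ v i j q → i ≡ j + q * + 12 → X v i ≡ X v j
      X-cong v i j q refl = sumL-cong rng λ u → cong (_* hit u v) (divisible-cong {+ 12} {u - i} {u - j} (- q) (eq u j q))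
        where
        eq : ∀ u j q → u - (j + q * + 12) ≡ u - j + - q * + 12
        eq = solve-∀

      X-neg : ∀ v i → X v (- i) ≡ X v i
      X-neg v i = trans (sumL-cong rng pointwise)
        (sumL-reindex ℤ._≟_ -_ ℤₚ.neg-injective g (range-unique (B ℕ.+ B)) (range-unique (B ℕ.+ B))
          (λ u nz → covers-hit (λ u → divisible (+ 12) (u - - i)) v u (subst (_≢ 0ℤ) (sym (pointwise u)) nz))
          (covers-hit (λ u → divisible (+ 12) (u - i)) v)
          (λ u _ → - u , ℤₚ.neg-involutive u))
        where
        g : ℤ → ℤ
        g u = divisible (+ 12) (u - i) * hit u v
        eq : ∀ u i → u - - i ≡ - (- u - i)
        eq = solve-∀
        pointwise : ∀ u → divisible (+ 12) (u - - i) * hit u v ≡ g (- u)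
        pointwise u = cong₂ _*_ (trans (cong (divisible (+ 12)) (eq u i)) (divisible-neg (+ 12) (- u - i))) (sym (hit-neg u v))

      -- 6k + 1 is 1 mod 12 for even k and 7 mod 12 for odd k, so the alternating sign of the
      -- pentagonal series becomes a difference of two residue classes.
      pentagonal : ∀ v → sumL rng (λ k → parity k * hit (+ 6 * k + + 1) v) ≡ X v (+ 1) - X v (+ 7)
      pentagonal v = begin
        sumL rng (λ k → parity k * hit (+ 6 * k + + 1) v)     ≡⟨ sumL-cong rng (λ k → cong (_* hit (+ 6 * k + + 1) v) (w-φ k)) ⟩
        sumL rng (λ k → g (φ k))                              ≡⟨ sumL-reindex ℤ._≟_ φ φ-injective g (range-unique (B ℕ.+ B)) (range-unique (B ℕ.+ B)) φ-covers (covers-hit w v) φ-onto ⟩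
        sumL rng g                                            ≡⟨ sumL-cong rng (λ u → distrib (divisible (+ 12) (u - + 1)) (divisible (+ 12) (u - + 7)) (hit u v)) ⟩
        sumL rng (λ u → divisible (+ 12) (u - + 1) * hit u v - divisible (+ 12) (u - + 7) * hit u v)
                                                              ≡⟨ sumL-minus rng (λ u → divisible (+ 12) (u - + 1) * hit u v) (λ u → divisible (+ 12) (u - + 7) * hit u v) ⟩
        X v (+ 1) - X v (+ 7)                                 ∎
        where
        open ≡-Reasoning
        φ w g : ℤ → ℤ
        φ k = + 6 * k + + 1
        w u = divisible (+ 12) (u - + 1) - divisible (+ 12) (u - + 7)
        g u = w u * hit u v
        distrib : ∀ a b w → (a - b) * w ≡ a * w - b * w
        distrib = solve-∀
        w-φ : ∀ k → parity k ≡ w (φ k)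
        w-φ k = decide (even-or-odd k)
          where
          eq₁ : ∀ s → + 6 * (s + s) + + 1 - + 1 ≡ + 0 + s * + 12
          eq₁ = solve-∀
          eq₂ : ∀ s → + 6 * (s + s) + + 1 - + 7 ≡ - + 6 + s * + 12
          eq₂ = solve-∀
          eq₃ : ∀ s → + 6 * (1ℤ + (s + s)) + + 1 - + 1 ≡ + 6 + s * + 12
          eq₃ = solve-∀
          eq₄ : ∀ s → + 6 * (1ℤ + (s + s)) + + 1 - + 7 ≡ + 0 + s * + 12
          eq₄ = solve-∀
          decide : (∃ λ s → k ≡ s + s) ⊎ (∃ λ s → k ≡ 1ℤ + (s + s)) → parity k ≡ w (φ k)
          decide (inj₁ (s , refl)) = trans (parity-double s) (sym (cong₂ _-_
            (divisible-cong {+ 12} {φ (s + s) - + 1} {+ 0} s (eq₁ s)) (divisible-cong {+ 12} {φ (s + s) - + 7} { - + 6} s (eq₂ s))))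
          decide (inj₂ (s , refl)) = trans (trans (parity-1+ (s + s)) (cong -_ (parity-double s))) (sym (cong₂ _-_
            (divisible-cong {+ 12} {φ (1ℤ + (s + s)) - + 1} {+ 6} s (eq₃ s)) (divisible-cong {+ 12} {φ (1ℤ + (s + s)) - + 7} {+ 0} s (eq₄ s))))
        φ-injective : ∀ {k l} → φ k ≡ φ l → k ≡ l
        φ-injective {k} {l} eq = ℤₚ.*-cancelˡ-≡ (+ 6) k l (trans (sym (back k)) (trans (cong (_- + 1) eq) (back l)))
          where
          back : ∀ k → + 6 * k + + 1 - + 1 ≡ + 6 * k
          back = solve-∀
        φ-covers : Covers rng (λ k → g (φ k))
        φ-covers k nz = ∈-range k (6k+1-bound k (proj₁ (hit-bound {φ k} {v} (proj₂ (*-nonzero (w (φ k)) (hit (φ k) v) nz)))))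
        φ-onto : ∀ u → g u ≢ 0ℤ → ∃ λ k → φ k ≡ u
        φ-onto u nz = decide (-nonzero (proj₁ (*-nonzero (w u) (hit u v) nz)))
          where
          eq₁ : ∀ s → + 6 * (s + s) + + 1 ≡ s * + 12 + + 1
          eq₁ = solve-∀
          eq₂ : ∀ s → + 6 * (1ℤ + (s + s)) + + 1 ≡ s * + 12 + + 7
          eq₂ = solve-∀
          restore : ∀ u c → u - c + c ≡ u
          restore = solve-∀
          decide : divisible (+ 12) (u - + 1) ≢ 0ℤ ⊎ divisible (+ 12) (u - + 7) ≢ 0ℤ → ∃ λ k → φ k ≡ u
          decide (inj₁ p) with divisible-nonzero {+ 12} {u - + 1} p
          ... | s , eq = s + s , trans (eq₁ s) (trans (cong (_+ + 1) (sym eq)) (restore u (+ 1)))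
          decide (inj₂ p) with divisible-nonzero {+ 12} {u - + 7} p
          ... | s , eq = 1ℤ + (s + s) , trans (eq₂ s) (trans (cong (_+ + 7) (sym eq)) (restore u (+ 7)))

      S-fibre : ∀ c e → S c e ≡ sumL rng (λ v → divisible (+ 70) (v - c) * X v (e * v))
      S-fibre c e = begin
        S c e                                                          ≡⟨ sumL-cartesianProduct rng rng (classHit c e) ⟩
        sumL rng (λ u → sumL rng (λ v → classHit c e (u , v)))         ≡⟨ sumL-swap rng rng (λ u v → classHit c e (u , v)) ⟩
        sumL rng (λ v → sumL rng (λ u → classHit c e (u , v)))         ≡⟨ sumL-cong rng (λ v → trans
                                                                            (sumL-cong rng (λ u → ℤₚ.*-assoc (divisible (+ 70) (v - c)) (divisible (+ 12) (u - e * v)) (hit u v)))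
                                                                            (sumL-*ˡ rng (divisible (+ 70) (v - c)) (λ u → divisible (+ 12) (u - e * v) * hit u v))) ⟩
        sumL rng (λ v → divisible (+ 70) (v - c) * X v (e * v))        ∎
        where open ≡-Reasoning

      X-zero : ∀ v i → (∀ u → hit u v ≡ 0ℤ) → X v i ≡ 0ℤ
      X-zero v i hit≡0 = sumL-zero rng λ u →
        trans (cong (divisible (+ 12) (u - i) *_) (hit≡0 u)) (ℤₚ.*-zeroʳ (divisible (+ 12) (u - i)))

    -- The contribution of v that both sides share: summed over all v it is the theta product, and
    -- at v = `signedRoot n` it is the n-th row of the left side.
    Y : ℤ → ℤ
    Y v = (divisible (+ 70) (v - + 11) - divisible (+ 70) (v - + 39)) * (X v (-1ℤ * v) - X v (+ 7 * v))

    -- By S-rotation, the two sums over u ≡ 7v mod 12 may be added for free.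
    S-difference : S (+ 11) -1ℤ - S (+ 39) -1ℤ ≡ sumL rng Y
    S-difference = begin
      S (+ 11) -1ℤ - S (+ 39) -1ℤ
        ≡⟨ pad (S (+ 11) -1ℤ) (S (+ 39) -1ℤ) (S (+ 11) (+ 7)) ⟩
      (S (+ 11) -1ℤ - S (+ 11) (+ 7)) - (S (+ 39) -1ℤ - S (+ 11) (+ 7))
        ≡⟨ cong (λ x → (S (+ 11) -1ℤ - S (+ 11) (+ 7)) - (S (+ 39) -1ℤ - x)) Rotation.S-rotation ⟩
      (S (+ 11) -1ℤ - S (+ 11) (+ 7)) - (S (+ 39) -1ℤ - S (+ 39) (+ 7))
        ≡⟨ cong₂ _-_ (cong₂ _-_ (S-fibre (+ 11) -1ℤ) (S-fibre (+ 11) (+ 7))) (cong₂ _-_ (S-fibre (+ 39) -1ℤ) (S-fibre (+ 39) (+ 7))) ⟩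
      (sumL rng (f (+ 11) -1ℤ) - sumL rng (f (+ 11) (+ 7))) - (sumL rng (f (+ 39) -1ℤ) - sumL rng (f (+ 39) (+ 7)))
        ≡⟨ cong₂ _-_ (sumL-minus rng (f (+ 11) -1ℤ) (f (+ 11) (+ 7))) (sumL-minus rng (f (+ 39) -1ℤ) (f (+ 39) (+ 7))) ⟨
      sumL rng (λ v → f (+ 11) -1ℤ v - f (+ 11) (+ 7) v) - sumL rng (λ v → f (+ 39) -1ℤ v - f (+ 39) (+ 7) v)
        ≡⟨ sumL-minus rng (λ v → f (+ 11) -1ℤ v - f (+ 11) (+ 7) v) (λ v → f (+ 39) -1ℤ v - f (+ 39) (+ 7) v) ⟨
      sumL rng (λ v → (f (+ 11) -1ℤ v - f (+ 11) (+ 7) v) - (f (+ 39) -1ℤ v - f (+ 39) (+ 7) v))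
        ≡⟨ sumL-cong rng (λ v → factor (divisible (+ 70) (v - + 11)) (divisible (+ 70) (v - + 39)) (X v (-1ℤ * v)) (X v (+ 7 * v))) ⟩
      sumL rng Y ∎
      where
      open ≡-Reasoning
      f : ℤ → ℤ → ℤ → ℤ
      f c e v = divisible (+ 70) (v - c) * X v (e * v)
      pad : ∀ a b c → a - b ≡ (a - c) - (b - c)
      pad = solve-∀
      factor : ∀ a b x y → (a * x - a * y) - (b * x - b * y) ≡ (a - b) * (x - y)
      factor = solve-∀

    -- 420 is the least common multiple of 70 and 12, so every congruence condition depends only on
    -- c; the first argument of `X`, which locates the fibre on the ellipse, remains v.
    Y-at : ∀ ρ c → let v = ρ * + 420 + c in
      Y v ≡ (divisible (+ 70) (c - + 11) - divisible (+ 70) (c - + 39)) * (X v (- c) - X v (+ 7 * c))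
    Y-at ρ c = cong₂ _*_
      (cong₂ _-_ (divisible-cong {+ 70} {v - + 11} {c - + 11} (+ 6 * ρ) (eq₁ ρ c (+ 11))) (divisible-cong {+ 70} {v - + 39} {c - + 39} (+ 6 * ρ) (eq₁ ρ c (+ 39))))
      (cong₂ _-_ (X-cong v (-1ℤ * v) (- c) (- + 35 * ρ) (eq₂ ρ c)) (X-cong v (+ 7 * v) (+ 7 * c) (+ 245 * ρ) (eq₃ ρ c)))
      where
      v = ρ * + 420 + c
      eq₁ : ∀ ρ c k → ρ * + 420 + c - k ≡ c - k + (+ 6 * ρ) * + 70
      eq₁ = solve-∀
      eq₂ : ∀ ρ c → -1ℤ * (ρ * + 420 + c) ≡ - c + (- + 35 * ρ) * + 12
      eq₂ = solve-∀
      eq₃ : ∀ ρ c → + 7 * (ρ * + 420 + c) ≡ + 7 * c + (+ 245 * ρ) * + 12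
      eq₃ = solve-∀

    -- Up to sign modulo 12, -c and 7c are 1 and 7 in one order or the other. The order contributes
    -- one sign, the class 11 or 39 modulo 70 another, and ε is their product.
    Y-residue : ∀ {c ε j j′} → Residue c ε j j′ → ∀ ρ → let v = ρ * + 420 + c in Y v ≡ ε * (X v (+ 1) - X v (+ 7))
    Y-residue {c} {ε} res ρ = trans (Y-at ρ c) (table res)
      where
      v = ρ * + 420 + c
      flip⁺ : ∀ a b → 1ℤ * (b - a) ≡ -1ℤ * (a - b)
      flip⁺ = solve-∀
      flip⁻ : ∀ a b → -1ℤ * (b - a) ≡ 1ℤ * (a - b)
      flip⁻ = solve-∀
      table : ∀ {c ε j j′} → Residue c ε j j′ →
        (divisible (+ 70) (c - + 11) - divisible (+ 70) (c - + 39)) * (X v (- c) - X v (+ 7 * c)) ≡ ε * (X v (+ 1) - X v (+ 7))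
      table r11 = cong₂ (λ x y → 1ℤ * (x - y)) (X-cong v (- + 11) (+ 1) (- + 1) refl) (trans (X-cong v (+ 77) (- + 7) (+ 7) refl) (X-neg v (+ 7)))
      table r109 = cong₂ (λ x y → -1ℤ * (x - y)) (trans (X-cong v (- + 109) (- + 1) (- + 9) refl) (X-neg v (+ 1))) (X-cong v (+ 763) (+ 7) (+ 63) refl)
      table r151 = trans (cong₂ (λ x y → 1ℤ * (x - y)) (trans (X-cong v (- + 151) (- + 7) (- + 12) refl) (X-neg v (+ 7))) (X-cong v (+ 1057) (+ 1) (+ 88) refl)) (flip⁺ (X v (+ 1)) (X v (+ 7)))
      table r179 = cong₂ (λ x y → -1ℤ * (x - y)) (X-cong v (- + 179) (+ 1) (- + 15) refl) (trans (X-cong v (+ 1253) (- + 7) (+ 105) refl) (X-neg v (+ 7)))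
      table r221 = trans (cong₂ (λ x y → 1ℤ * (x - y)) (X-cong v (- + 221) (+ 7) (- + 19) refl) (trans (X-cong v (+ 1547) (- + 1) (+ 129) refl) (X-neg v (+ 1)))) (flip⁺ (X v (+ 1)) (X v (+ 7)))
      table r319 = trans (cong₂ (λ x y → -1ℤ * (x - y)) (trans (X-cong v (- + 319) (- + 7) (- + 26) refl) (X-neg v (+ 7))) (X-cong v (+ 2233) (+ 1) (+ 186) refl)) (flip⁻ (X v (+ 1)) (X v (+ 7)))
      table r361 = cong₂ (λ x y → 1ℤ * (x - y)) (trans (X-cong v (- + 361) (- + 1) (- + 30) refl) (X-neg v (+ 1))) (X-cong v (+ 2527) (+ 7) (+ 210) refl)
      table r389 = trans (cong₂ (λ x y → -1ℤ * (x - y)) (X-cong v (- + 389) (+ 7) (- + 33) refl) (trans (X-cong v (+ 2723) (- + 1) (+ 227) refl) (X-neg v (+ 1)))) (flip⁻ (X v (+ 1)) (X v (+ 7)))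

    Y-vanishes : ∀ ρ c i → (let v = ρ * + 420 + c in X v (- c) ≡ X v i × X v (+ 7 * c) ≡ X v i) → Y (ρ * + 420 + c) ≡ 0ℤ
    Y-vanishes ρ c i (p , q) = trans (Y-at ρ c)
      (trans (cong (λ x → (divisible (+ 70) (c - + 11) - divisible (+ 70) (c - + 39)) * x) (ℤₚ.i≡j⇒i-j≡0 (trans p (sym q)))) (ℤₚ.*-zeroʳ (divisible (+ 70) (c - + 11) - divisible (+ 70) (c - + 39))))

    -- The classes 11 and 39 mod 70 lift to twelve classes mod 420. In the four divisible by 3,
    -- namely 81, 291, 39 and 249, -c ≡ 7c (12) and `Y` vanishes; the other eight are the classes of
    -- signed roots.
    Y-nonzero : ∀ v → Y v ≢ 0ℤ → ∃ λ n → signedRoot n ≡ v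
    Y-nonzero v nz = decide (-nonzero (proj₁ (*-nonzero (divisible (+ 70) (v - + 11) - divisible (+ 70) (v - + 39)) (X v (-1ℤ * v) - X v (+ 7 * v)) nz)))
      where
      restore : ∀ v c → v - c + c ≡ v
      restore = solve-∀
      regroup : ∀ i ρ c → (i + ρ * + 6) * + 70 + c ≡ ρ * + 420 + (i * + 70 + c)
      regroup = solve-∀
      representation : ∀ c → divisible (+ 70) (v - c) ≢ 0ℤ → ∃ λ i → ∃ λ ρ → i < 6 × v ≡ ρ * + 420 + (+ i * + 70 + c)
      representation c p with divisible-nonzero {+ 70} {v - c} p
      ... | q , eq = q %ℕ 6 , q /ℕ 6 , n%ℕd<d q 6 ,
        trans (sym (restore v c)) (trans (cong (_+ c) eq) (trans (cong (λ x → x * + 70 + c) (a≡a%ℕn+[a/ℕn]*n q 6)) (regroup (+ (q %ℕ 6)) (q /ℕ 6) c)))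
      absurd : ∀ {A : Set} ρ c → v ≡ ρ * + 420 + c → Y (ρ * + 420 + c) ≡ 0ℤ → A
      absurd ρ c eq Y≡0 = contradiction (trans (cong Y eq) Y≡0) nz
      found : ∀ {c ε j j′} → Residue c ε j j′ → ∀ ρ → v ≡ ρ * + 420 + c → ∃ λ n → signedRoot n ≡ v
      found res ρ eq = proj₁ (residue-signedRoot res ρ) , trans (proj₂ (residue-signedRoot res ρ)) (sym eq)
      from11 : (∃ λ i → ∃ λ ρ → i < 6 × v ≡ ρ * + 420 + (+ i * + 70 + + 11)) → ∃ λ n → signedRoot n ≡ v
      from11 (0 , ρ , _ , eq) = found r11 ρ eq
      from11 (1 , ρ , _ , eq) = absurd ρ (+ 81) eq (Y-vanishes ρ (+ 81) (+ 3) (X-cong (ρ * + 420 + + 81) (- + 81) (+ 3) (- + 7) refl , X-cong (ρ * + 420 + + 81) (+ 567) (+ 3) (+ 47) refl))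
      from11 (2 , ρ , _ , eq) = found r151 ρ eq
      from11 (3 , ρ , _ , eq) = found r221 ρ eq
      from11 (4 , ρ , _ , eq) = absurd ρ (+ 291) eq (Y-vanishes ρ (+ 291) (+ 9) (X-cong (ρ * + 420 + + 291) (- + 291) (+ 9) (- + 25) refl , X-cong (ρ * + 420 + + 291) (+ 2037) (+ 9) (+ 169) refl))
      from11 (5 , ρ , _ , eq) = found r361 ρ eq
      from11 (suc (suc (suc (suc (suc (suc _))))) , _ , s≤s (s≤s (s≤s (s≤s (s≤s (s≤s ()))))) , _)
      from39 : (∃ λ i → ∃ λ ρ → i < 6 × v ≡ ρ * + 420 + (+ i * + 70 + + 39)) → ∃ λ n → signedRoot n ≡ v
      from39 (0 , ρ , _ , eq) = absurd ρ (+ 39) eq (Y-vanishes ρ (+ 39) (+ 9) (X-cong (ρ * + 420 + + 39) (- + 39) (+ 9) (- + 4) refl , X-cong (ρ * + 420 + + 39) (+ 273) (+ 9) (+ 22) refl))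
      from39 (1 , ρ , _ , eq) = found r109 ρ eq
      from39 (2 , ρ , _ , eq) = found r179 ρ eq
      from39 (3 , ρ , _ , eq) = absurd ρ (+ 249) eq (Y-vanishes ρ (+ 249) (+ 3) (X-cong (ρ * + 420 + + 249) (- + 249) (+ 3) (- + 21) refl , X-cong (ρ * + 420 + + 249) (+ 1743) (+ 3) (+ 145) refl))
      from39 (4 , ρ , _ , eq) = found r319 ρ eq
      from39 (5 , ρ , _ , eq) = found r389 ρ eq
      from39 (suc (suc (suc (suc (suc (suc _))))) , _ , s≤s (s≤s (s≤s (s≤s (s≤s (s≤s ()))))) , _)
      decide : divisible (+ 70) (v - + 11) ≢ 0ℤ ⊎ divisible (+ 70) (v - + 39) ≢ 0ℤ → ∃ λ n → signedRoot n ≡ v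
      decide (inj₁ p) = from11 (representation (+ 11) p)
      decide (inj₂ p) = from39 (representation (+ 39) p)

    Y-covers : Covers rng Y
    Y-covers v nz with ∣ v ∣ ℕ.≤? B
    ... | yes v≤B = ∈-rng v v≤B
    ... | no  v≰B = contradiction (trans (cong₂ (λ x y → δ * (x - y)) (X-zero v (-1ℤ * v) hit≡0) (X-zero v (+ 7 * v) hit≡0)) (ℤₚ.*-zeroʳ δ)) nz
      where
      δ = divisible (+ 70) (v - + 11) - divisible (+ 70) (v - + 39)
      hit≡0 : ∀ u → hit u v ≡ 0ℤ
      hit≡0 u with hit u v ℤ.≟ 0ℤ
      ... | yes p = p
      ... | no  p = contradiction (proj₂ (hit-bound {u} {v} p)) v≰B

-- Clearing denominators in the product side

open IntegerLattice
open import Data.Nat using (_+_; _*_)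

prodFin-+ : ∀ m n F → prodFin (m + n) F ≐ prodFin m F ⊛ prodFin n (λ i → F (m + i))
prodFin-+ m zero    F rewrite ℕₚ.+-identityʳ m = ≐-sym (⊛-identityʳ (prodFin m F))
prodFin-+ m (suc n) F rewrite ℕₚ.+-suc m n = ≐-trans
  (⊛-congʳ (F (m + n)) (prodFin-+ m n F))
  (⊛-assoc (prodFin m F) (prodFin n (λ i → F (m + i))) (F (m + n)))

prodFin-blocks : ∀ d n F → prodFin (n * d) F ≐ prodFin n (λ i → prodFin d (λ r → F (i * d + r)))
prodFin-blocks d zero    F = ≐-refl
prodFin-blocks d (suc n) F rewrite ℕₚ.+-comm d (n * d) = ≐-trans
  (prodFin-+ (n * d) d F)
  (⊛-congʳ (prodFin d (λ r → F (n * d + r))) (prodFin-blocks d n F))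

-- For the coefficient of q^N the right side uses N + 1 blocks, that is at least N + 1 factors,
-- where the product on the left has already stabilised.
prodInf-blocks : ∀ d {F} → Convergent F → prodInf F ≐ prodInf (λ i → prodFin (suc d) (λ r → F (i * suc d + r)))
prodInf-blocks d {F} conv N = trans
  (sym (prodFin-prodInf conv (ℕₚ.≤-trans (ℕₚ.n≤1+n N) (ℕₚ.m≤m*n (suc N) (suc d))) N ℕₚ.≤-refl))
  (prodFin-blocks (suc d) (suc N) F N)

prodFin-convergent : ∀ d {H : ℕ → ℕ → FPS} → (∀ r → Convergent (H r)) → Convergent (λ i → prodFin d (λ r → H r i))
prodFin-convergent zero    conv i = λ _ _ → refl
prodFin-convergent (suc d) {H} conv i = ≐ₙ-trans
  (⊛-congₙ (prodFin-convergent d conv i) (conv d i)) (≐⇒≐ₙ (⊛-identityˡ one))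

prodInf-prodFin : ∀ d {H : ℕ → ℕ → FPS} → (∀ r → Convergent (H r)) →
  prodInf (λ i → prodFin d (λ r → H r i)) ≐ prodFin d (λ r → prodInf (H r))
prodInf-prodFin zero    conv = prodInf-one λ _ → ≐-refl
prodInf-prodFin (suc d) {H} conv = ≐-trans
  (prodInf-⊛ (prodFin-convergent d conv) (conv d))
  (⊛-congʳ (prodInf (H d)) (prodInf-prodFin d conv))

-- The exponents 1, 2, 3, ... are sorted by residue modulo d + 1; the moduli needed are 3 and 5.
poch-split : ∀ d → poch 1 1 ≐ prodFin (suc d) (λ r → poch (suc r) (suc d))
poch-split d = ≐-trans (prodInf-blocks d (oneMinusQ-convergent 0 0))
  (≐-trans (λ N → prodFin-cong (suc N) (λ i → prodFin-cong (suc d) (λ r n → cong (λ e → oneMinusQ e n) (exponent d i r))) N)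
           (prodInf-prodFin (suc d) (λ r → oneMinusQ-convergent r d)))
  where
  exponent : ∀ d i r → 1 + 1 * (i * suc d + r) ≡ suc r + suc d * i
  exponent = ℕ-solve

-- This makes `triple-product` for `T₃` Euler's pentagonal number theorem.
θ₃≐euler : T₃.θ ≐ poch 1 1
θ₃≐euler = ≐-trans (≐-trans (⊛-congʳ (poch 3 3) (⊛-comm (poch 2 3) (poch 1 3)))
  (⊛-congʳ (poch 3 3) (⊛-congʳ (poch 2 3) (≐-sym (⊛-identityˡ (poch 1 3)))))) (≐-sym (poch-split 2))

prodFin-5 : ∀ G → prodFin 5 G ≐ (G 0 ⊛ G 3) ⊛ (G 2 ⊛ G 1 ⊛ G 4)
prodFin-5 G = ≐-trans (regroup one (G 0) (G 1) (G 2) (G 3) (G 4)) (⊛-identityˡ ((G 0 ⊛ G 3) ⊛ (G 2 ⊛ G 1 ⊛ G 4)))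
  where
  regroup : ∀ o a b c d e → o ⊛ a ⊛ b ⊛ c ⊛ d ⊛ e ≐ o ⊛ ((a ⊛ d) ⊛ (c ⊛ b ⊛ e))
  regroup = solve 6 (λ o a b c d e → o :* a :* b :* c :* d :* e := o :* ((a :* d) :* (c :* b :* e))) λ _ → refl

euler≐θ₅ : poch 1 1 ≐ poch 1 5 ⊛ poch 4 5 ⊛ T₅.θ
euler≐θ₅ = ≐-trans (poch-split 4) (prodFin-5 (λ r → poch (suc r) 5))

rhs≐θ₇ : rhs ≐ T₇.θ ⊛ invPoch 1 5 ⊛ invPoch 4 5
rhs≐θ₇ = ⊛-congʳ (invPoch 4 5) (⊛-congʳ (invPoch 1 5) (⊛-congʳ (poch 7 7) (⊛-comm (poch 2 7) (poch 5 7))))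

-- The factors a and b of e meet their reciprocals i and j in r, and only t and s survive.
⊛-clear : ∀ e r a b s t i j → e ≐ a ⊛ b ⊛ s → r ≐ t ⊛ i ⊛ j → i ⊛ a ≐ one → j ⊛ b ≐ one → e ⊛ r ≐ t ⊛ s
⊛-clear e r a b s t i j e≐ r≐ ia jb = begin
  e ⊛ r                             ≈⟨ ⊛-cong e≐ r≐ ⟩
  a ⊛ b ⊛ s ⊛ (t ⊛ i ⊛ j)           ≈⟨ regroup a b s t i j ⟩
  i ⊛ a ⊛ (j ⊛ b) ⊛ (t ⊛ s)         ≈⟨ ⊛-congʳ (t ⊛ s) (⊛-cong ia jb) ⟩
  one ⊛ one ⊛ (t ⊛ s)               ≈⟨ ⊛-congʳ (t ⊛ s) (⊛-identityˡ one) ⟩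
  one ⊛ (t ⊛ s)                     ≈⟨ ⊛-identityˡ (t ⊛ s) ⟩
  t ⊛ s                             ∎
  where
  open SetoidReasoning setoid
  regroup : ∀ a b s t i j → a ⊛ b ⊛ s ⊛ (t ⊛ i ⊛ j) ≐ i ⊛ a ⊛ (j ⊛ b) ⊛ (t ⊛ s)
  regroup = solve 6 (λ a b s t i j → a :* b :* s :* (t :* i :* j) := i :* a :* (j :* b) :* (t :* s)) λ _ → refl

euler-rhs : poch 1 1 ⊛ rhs ≐ T₇.θ ⊛ T₅.θ
euler-rhs = ⊛-clear (poch 1 1) rhs (poch 1 5) (poch 4 5) T₅.θ T₇.θ (invPoch 1 5) (invPoch 4 5)
  euler≐θ₅ rhs≐θ₇ (invPoch-inverse 0 4) (invPoch-inverse 3 4)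

-- Comparison of the two sides

sumL-applyUpTo : ∀ {A : Set} n (p : ℕ → A) f → sumL (applyUpTo p n) f ≡ sumℤ n (λ k → f (p k))
sumL-applyUpTo zero    p f = refl
sumL-applyUpTo (suc n) p f = trans (cong (λ z → f (p 0) ℤ.+ z) (sumL-applyUpTo n (λ k → p (suc k)) f))
  (sym (sumℤ-head n (λ k → f (p k))))

sumℤ-extend : ∀ m k {f : ℕ → ℤ} → (∀ i → m ≤ i → f i ≡ 0ℤ) → sumℤ (m + k) f ≡ sumℤ m f
sumℤ-extend m zero    vanish rewrite ℕₚ.+-identityʳ m = refl
sumℤ-extend m (suc k) vanish rewrite ℕₚ.+-suc m k =
  trans (cong₂ ℤ._+_ (sumℤ-extend m k vanish) (vanish (m + k) (ℕₚ.m≤m+n m k))) (ℤₚ.+-identityʳ _)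

-- The number of summands in `lhs` varies with the coefficient; since a n ≥ n, one list reaching N
-- serves all coefficients up to q^N.
lhs-series : ∀ a → StrictlyIncreasing a → ∀ N → lhs a ≐[ N ] series (upTo (suc N)) sgn a
lhs-series a inc N i i≤N = begin
  sumℤ (suc i) (λ n → if does (a n ℕ.≟ i) then sgn n else 0ℤ)   ≡⟨ sumℤ-cong (suc i) (λ n _ → pointwise n) ⟩
  sumℤ (suc i) f                                                ≡⟨ sumℤ-extend (suc i) (N ℕ.∸ i) vanish ⟨
  sumℤ (suc i + (N ℕ.∸ i)) f                                    ≡⟨ cong (λ n → sumℤ (suc n) f) (ℕₚ.m+[n∸m]≡n i≤N) ⟩
  sumℤ (suc N) f                                                ≡⟨ sumL-applyUpTo (suc N) (λ k → k) f ⟨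
  sumL (upTo (suc N)) f                                         ∎
  where
  open ≡-Reasoning
  f : ℕ → ℤ
  f n = sgn n ℤ.* qpow (a n) i
  pointwise : ∀ n → (if does (a n ℕ.≟ i) then sgn n else 0ℤ) ≡ f n
  pointwise n = decide (a n ℕ.≟ i)
    where
    decide : Dec (a n ≡ i) → (if does (a n ℕ.≟ i) then sgn n else 0ℤ) ≡ f n
    decide (yes p) = trans (cong (λ b → if b then sgn n else 0ℤ) (dec-true (a n ℕ.≟ i) p))
      (sym (trans (cong (sgn n ℤ.*_) (qpow-eq (sym p))) (ℤₚ.*-identityʳ (sgn n))))
    decide (no p)  = trans (cong (λ b → if b then sgn n else 0ℤ) (dec-false (a n ℕ.≟ i) p))
      (sym (trans (cong (sgn n ℤ.*_) (qpow-neq (λ q → p (sym q)))) (ℤₚ.*-zeroʳ (sgn n))))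
  vanish : ∀ n → suc i ≤ n → f n ≡ 0ℤ
  vanish n i<n = trans (cong (sgn n ℤ.*_) (qpow-neq (ℕₚ.<⇒≢ (ℕₚ.<-≤-trans i<n (n≤increasing inc n))))) (ℤₚ.*-zeroʳ (sgn n))

module Comparison (N : ℕ) where
  open Lattice N
  open ThetaProduct N using (N≤B; θ-product)
  open Fibre N

  -- The constant 156 arises here as 121 + 35: v² is 840 `index n` + 121, and 840 times the
  -- pentagonal exponent plus 35 is 35 (6k + 1)².
  hit-signedRoot : ∀ n k → hit (+ 6 ℤ.* k ℤ.+ + 1) (signedRoot n) ≡ qpow (index n + T₃.expo k) N
  hit-signedRoot n k = hit-qpow {+ 6 ℤ.* k ℤ.+ + 1} {signedRoot n} (index n + T₃.expo k) (begin
    signedRoot n ℤ.* signedRoot n ℤ.+ tail-term                               ≡⟨ cong (ℤ._+ tail-term) (signedRoot-square n) ⟩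
    + (840 * index n) ℤ.+ + 121 ℤ.+ tail-term                                 ≡⟨ cong (λ x → x ℤ.+ + 121 ℤ.+ tail-term) (ℤₚ.pos-* 840 (index n)) ⟩
    + 840 ℤ.* + index n ℤ.+ + 121 ℤ.+ tail-term                               ≡⟨ eq₁ (+ index n) k ⟩
    + 840 ℤ.* + index n ℤ.+ + 420 ℤ.* (+ 3 ℤ.* (k ℤ.* k ℤ.- k) ℤ.+ + 2 ℤ.* + 2 ℤ.* k) ℤ.+ + 156
      ≡⟨ cong (λ x → + 840 ℤ.* + index n ℤ.+ + 420 ℤ.* x ℤ.+ + 156) (expo-quadratic 1 0 k) ⟨
    + 840 ℤ.* + index n ℤ.+ + 420 ℤ.* (+ 2 ℤ.* + T₃.expo k) ℤ.+ + 156         ≡⟨ eq₂ (+ index n) (+ T₃.expo k) ⟩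
    + 840 ℤ.* (+ index n ℤ.+ + T₃.expo k) ℤ.+ + 156                           ≡⟨ cong (ℤ._+ + 156) (ℤₚ.pos-* 840 (index n + T₃.expo k)) ⟨
    + (840 * (index n + T₃.expo k) + 156)                                     ∎)
    where
    open ≡-Reasoning
    tail-term : ℤ
    tail-term = + 35 ℤ.* ((+ 6 ℤ.* k ℤ.+ + 1) ℤ.* (+ 6 ℤ.* k ℤ.+ + 1))
    eq₁ : ∀ x k → + 840 ℤ.* x ℤ.+ + 121 ℤ.+ + 35 ℤ.* ((+ 6 ℤ.* k ℤ.+ + 1) ℤ.* (+ 6 ℤ.* k ℤ.+ + 1))
      ≡ + 840 ℤ.* x ℤ.+ + 420 ℤ.* (+ 3 ℤ.* (k ℤ.* k ℤ.- k) ℤ.+ + 2 ℤ.* + 2 ℤ.* k) ℤ.+ + 156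
    eq₁ = solve-∀
    eq₂ : ∀ x y → + 840 ℤ.* x ℤ.+ + 420 ℤ.* (+ 2 ℤ.* y) ℤ.+ + 156 ≡ + 840 ℤ.* (x ℤ.+ y) ℤ.+ + 156
    eq₂ = solve-∀

  row : ℕ → ℤ
  row n = sumL rng (λ k → sgn n ℤ.* parity k ℤ.* qpow (index n + T₃.expo k) N)

  -- Over v = `signedRoot n` both sides are multiples of `X v 1 − X v 7`: the row by `pentagonal`
  -- with factor `sgn n`, `Y` by `Y-residue` with factor ε. The type of `signedRoot-residue`
  -- identifies the two factors.
  row-Y : ∀ n → row n ≡ Y (signedRoot n)
  row-Y n = begin
    row n
      ≡⟨ sumL-cong rng (λ k → trans (ℤₚ.*-assoc (sgn n) (parity k) _) (cong (λ x → sgn n ℤ.* (parity k ℤ.* x)) (sym (hit-signedRoot n k)))) ⟩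
    sumL rng (λ k → sgn n ℤ.* (parity k ℤ.* hit (+ 6 ℤ.* k ℤ.+ + 1) v))
      ≡⟨ sumL-*ˡ rng (sgn n) (λ k → parity k ℤ.* hit (+ 6 ℤ.* k ℤ.+ + 1) v) ⟩
    sgn n ℤ.* sumL rng (λ k → parity k ℤ.* hit (+ 6 ℤ.* k ℤ.+ + 1) v)
      ≡⟨ cong (sgn n ℤ.*_) (pentagonal v) ⟩
    sgn n ℤ.* (X v (+ 1) ℤ.- X v (+ 7))
      ≡⟨ at-residue (signedRoot-residue n) ⟨
    Y v ∎
    where
    open ≡-Reasoning
    v = signedRoot n
    at-residue : (∃ λ c → ∃ λ j → ∃ λ j′ → ∃ λ ρ → Residue c (sgn n) j j′ × signedRoot n ≡ ρ ℤ.* + 420 ℤ.+ c) →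
      Y v ≡ sgn n ℤ.* (X v (+ 1) ℤ.- X v (+ 7))
    at-residue (c , j , j′ , ρ , res , p) = subst (λ v → Y v ≡ sgn n ℤ.* (X v (+ 1) ℤ.- X v (+ 7))) (sym p) (Y-residue res ρ)

  Y-signedRoot-covers : Covers (upTo (suc N)) (λ n → Y (signedRoot n))
  Y-signedRoot-covers n nz with n ℕ.≤? N
  ... | yes n≤N = ∈-upTo⁺ (s≤s n≤N)
  -- Read backwards, `row-Y` bounds the support: for n > N every exponent in the row is at least
  -- `index n` ≥ n, hence misses N.
  ... | no  n≰N = contradiction (trans (sym (row-Y n)) (sumL-zero rng λ k →
    trans (cong (sgn n ℤ.* parity k ℤ.*_) (qpow-neq (ℕₚ.<⇒≢ (ℕₚ.<-≤-trans (ℕₚ.≰⇒> n≰N)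
      (ℕₚ.≤-trans (n≤increasing index-increasing n) (ℕₚ.m≤m+n (index n) (T₃.expo k))))))) (ℤₚ.*-zeroʳ (sgn n ℤ.* parity k)))) nz

  lhs-product : (lhs index ⊛ T₃.θ) N ≡ (T₇.θ ⊛ T₅.θ) N
  lhs-product = begin
    (lhs index ⊛ T₃.θ) N
      ≡⟨ ⊛-congₙ {N} (lhs-series index index-increasing N) (λ i i≤N → T₃.triple-product B i (ℕₚ.≤-trans i≤N N≤B)) N ℕₚ.≤-refl ⟩
    (series (upTo (suc N)) sgn index ⊛ series rng parity T₃.expo) N
      ≡⟨ series-⊛ (upTo (suc N)) rng sgn parity index T₃.expo N ⟩
    sumL (upTo (suc N)) row
      ≡⟨ sumL-cong (upTo (suc N)) row-Y ⟩
    sumL (upTo (suc N)) (λ n → Y (signedRoot n))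
      ≡⟨ sumL-reindex ℤ._≟_ signedRoot signedRoot-injective Y (Uniqueₚ.upTo⁺ (suc N)) (range-unique (B + B)) Y-signedRoot-covers Y-covers Y-nonzero ⟩
    sumL rng Y
      ≡⟨ S-difference ⟨
    S (+ 11) -1ℤ ℤ.- S (+ 39) -1ℤ
      ≡⟨ θ-product ⟨
    (T₇.θ ⊛ T₅.θ) N ∎
    where open ≡-Reasoning

⊛-cancel-common : ∀ e e′ l r p → e 0 ≡ 1ℤ → e′ ≐ e → l ⊛ e′ ≐ p → e ⊛ r ≐ p → l ≐ r
⊛-cancel-common e e′ l r p e0 e′≐e le′ er = ⊛-cancelˡ e l r e0 (begin
  e ⊛ l      ≈⟨ ⊛-comm e l ⟩
  l ⊛ e      ≈⟨ ⊛-congˡ l e′≐e ⟨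
  l ⊛ e′     ≈⟨ le′ ⟩
  p          ≈⟨ er ⟨
  e ⊛ r      ∎)
  where open SetoidReasoning setoid

lhs-index : lhs index ≐ rhs
lhs-index = ⊛-cancel-common (poch 1 1) T₃.θ (lhs index) rhs (T₇.θ ⊛ T₅.θ)
  (prodFin-head (oneMinusQ-convergent 0 0) 1) θ₃≐euler Comparison.lhs-product euler-rhs

theorem3 : (a : ℕ → ℕ) →
    (∀ m n → m < n → a m < a n) →
    (∀ m → (∃ λ n → a n ≡ m) ⇔ (∃ λ k → k * k ≡ 840 * m + 121)) →
    ∀ N → lhs a N ≡ rhs N
theorem3 a increasing squares N = trans
  (sumℤ-cong (suc N) λ n _ → cong (λ x → if does (x ℕ.≟ N) then sgn n else 0ℤ) (a≡index n))
  (lhs-index N)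
  where
  a⊆index : ∀ n → ∃ λ m → a n ≡ index m
  a⊆index n = locate (Equivalence.to (squares (a n)) (n , refl))
    where
    match : ∀ {k} → k * k ≡ 840 * a n + 121 → (∃ λ m → root m ≡ k) → ∃ λ m → a n ≡ index m
    match k² (m , refl) = m , ℕₚ.*-cancelˡ-≡ (a n) (index m) 840 (ℕₚ.+-cancelʳ-≡ 121 (840 * a n) (840 * index m) (trans (sym k²) (root-square m)))
    locate : (∃ λ k → k * k ≡ 840 * a n + 121) → ∃ λ m → a n ≡ index m
    locate (k , k²) = match k² (root-complete (a n) k k²)
  index⊆a : ∀ n → ∃ λ m → index n ≡ a m
  index⊆a n = proj₁ found , sym (proj₂ found)
    where found = Equivalence.from (squares (index n)) (root n , root-square n)
  -- The hypotheses enter only through the range of `a`, which determines an increasing sequence;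
  -- from here the identity is the one for `index`.
  a≡index : ∀ n → a n ≡ index n
  a≡index = same-range increasing index-increasing a⊆index index⊆a
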